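{- Let $f(t),g(t)\in\mathbb{C}[[t]]$ be a delta series and an invertible series respectively with $g(0)=1$, let $r\ge 1$ be an integer, and put $A(t)=1/g(f^{ -1}(t))$, $H(t)=f^{ -1}(t)$, $\partial_y=\frac{\partial}{\partial y}$. For every $n\ge 0$ the Legendre-Gould Hopper based Sheffer polynomials have the explicit representations $${}_{{}_{s}LeG^{(r)}}s_{n}(x,y,z)=\left(\left(y+2D_x^{ -1}\frac{\partial}{\partial y}+rz\frac{\partial^{r-1}}{\partial y^{r-1}}-\frac{g'(\partial_y)}{g(\partial_y)}\right)\frac{1}{f'(\partial_y)}\right)^{n}\{1\}$$ and $${}_{{}_{s}LeG^{(r)}}s_{n}(x,y,z)=\left(\left(y+2D_x^{ -1}\frac{\partial}{\partial y}+rz\frac{\partial^{r-1}}{\partial y^{r-1}}\right)H'\!\left(H^{ -1}(\partial_y)\right)+\frac{A'\!\left(H^{ -1}(\partial_y)\right)}{A\!\left(H^{ -1}(\partial_y)\right)}\right)^{n}\{1\}.$$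
   Context: A delta series is $f\in\mathbb{C}[[t]]$ with $f(0)=0$, $f'(0)\neq 0$; $f^{ -1}$ and $H^{ -1}$ denote compositional inverses. An invertible series is $g\in\mathbb{C}[[t]]$ with $g(0)\ne 0$. $C_0(x)=\sum_{k\ge 0}\frac{(-1)^k x^k}{(k!)^2}$. $D_x^{ -1}h=\int_0^x h\,d\xi$ (integration in the variable $x$). All operators act on $\mathbb{C}[x,y,z]$; a formal power series in $\partial_y$ acts termwise (locally finite sum); $\{1\}$ denotes application to the constant polynomial $1$. The polynomials are determined by the generating function $$\frac{1}{g(f^{ -1}(t))}\,C_0\!\left(-x\,(f^{ -1}(t))^2\right)\exp\!\left(y f^{ -1}(t)+z\,(f^{ -1}(t))^r\right)=\sum_{n=0}^{\infty}{}_{{}_{s}LeG^{(r)}}s_{n}(x,y,z)\frac{t^n}{n!}.$$ -}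

module Defs where

open import Level using (0ℓ; _⊔_) renaming (suc to lsuc)
open import Algebra.Apartness.Bundles using (HeytingCommutativeRing; HeytingField)
open import Algebra.Apartness.Structures using (IsHeytingField)
open import Algebra.Bundles using (CommutativeRing; RawRing)
import Algebra.Definitions.RawMonoid as RawMonoidDefs
import Algebra.Properties.Ring as RingProperties
open import Algebra.Structures using (IsCommutativeRing)
import Algebra.Solver.Ring.AlmostCommutativeRing as ACR
import Algebra.Solver.Ring.Simple as Solver
open import Data.List.Base using (List; []; _∷_; map; foldr; length)
open import Data.Nat.Base as ℕ using (ℕ; zero; suc)
import Data.Nat.Properties as ℕₚ
open import Data.Product.Base using (∃; _×_; _,_; proj₁; proj₂)
open import Data.Rational.Base as ℚ using (ℚ; 0ℚ; 1ℚ; ½; ∣_∣; _≤_; _<_)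
import Data.Rational.Properties as ℚₚ
import Data.Rational.Solver as ℚSolver
open import Data.Sum.Base using (_⊎_; inj₁; inj₂)
open import Data.Empty using (⊥-elim)
open import Relation.Binary.PropositionalEquality using (_≡_; refl; sym; trans; cong; cong₂; subst; subst₂)
open import Relation.Binary.PropositionalEquality.Properties using (isEquivalence)
open import Relation.Binary.Definitions using (tri<; tri≈; tri>)
import Relation.Binary.Reasoning.Setoid as SetoidReasoning
open import Relation.Nullary using (¬_; Dec; yes; no)

infix 6 _+i_

record ℚ[i] : Set where
  constructor _+i_
  field
    re im : ℚ

open ℚ[i] public

module Gaussian where

  infix  8 -_
  infixl 7 _*_
  infixl 6 _+_ _-_

  _+_ _*_ : ℚ[i] → ℚ[i] → ℚ[i]
  (a +i b) + (c +i d) = (a ℚ.+ c) +i (b ℚ.+ d)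
  (a +i b) * (c +i d) = (a ℚ.* c ℚ.- b ℚ.* d) +i (a ℚ.* d ℚ.+ b ℚ.* c)

  -_ : ℚ[i] → ℚ[i]
  - (a +i b) = (ℚ.- a) +i (ℚ.- b)

  0# 1# : ℚ[i]
  0# = 0ℚ +i 0ℚ
  1# = 1ℚ +i 0ℚ

  -- The taxicab norm on ℚ(i); it is equivalent to the modulus, so it gives the
  -- same Cauchy sequences and the same null sequences, and it is rational.
  ‖_‖ : ℚ[i] → ℚ
  ‖ a +i b ‖ = ∣ a ∣ ℚ.+ ∣ b ∣

  private
    open module S = ℚSolver.+-*-Solver using (solve; _:=_; con; _:*_; _:+_; _:-_)

  +-assoc : ∀ x y z → (x + y) + z ≡ x + (y + z)
  +-assoc (a +i b) (c +i d) (e +i f) = cong₂ _+i_ (ℚₚ.+-assoc a c e) (ℚₚ.+-assoc b d f)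

  +-comm : ∀ x y → x + y ≡ y + x
  +-comm (a +i b) (c +i d) = cong₂ _+i_ (ℚₚ.+-comm a c) (ℚₚ.+-comm b d)

  +-identityˡ : ∀ x → 0# + x ≡ x
  +-identityˡ (a +i b) = cong₂ _+i_ (ℚₚ.+-identityˡ a) (ℚₚ.+-identityˡ b)

  +-inverseˡ : ∀ x → - x + x ≡ 0#
  +-inverseˡ (a +i b) = cong₂ _+i_ (ℚₚ.+-inverseˡ a) (ℚₚ.+-inverseˡ b)

  *-comm : ∀ x y → x * y ≡ y * x
  *-comm (a +i b) (c +i d) = cong₂ _+i_
    (solve 4 (λ a b c d → a :* c :- b :* d := c :* a :- d :* b) refl a b c d)
    (solve 4 (λ a b c d → a :* d :+ b :* c := c :* b :+ d :* a) refl a b c d)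

  *-assoc : ∀ x y z → (x * y) * z ≡ x * (y * z)
  *-assoc (a +i b) (c +i d) (e +i f) = cong₂ _+i_
    (solve 6 (λ a b c d e f → (a :* c :- b :* d) :* e :- (a :* d :+ b :* c) :* f
                           := a :* (c :* e :- d :* f) :- b :* (c :* f :+ d :* e)) refl a b c d e f)
    (solve 6 (λ a b c d e f → (a :* c :- b :* d) :* f :+ (a :* d :+ b :* c) :* e
                           := a :* (c :* f :+ d :* e) :+ b :* (c :* e :- d :* f)) refl a b c d e f)

  *-identityˡ : ∀ x → 1# * x ≡ x
  *-identityˡ (a +i b) = cong₂ _+i_
    (solve 2 (λ a b → con 1ℚ :* a :- con 0ℚ :* b := a) refl a b)
    (solve 2 (λ a b → con 1ℚ :* b :+ con 0ℚ :* a := b) refl a b)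

  *-distribˡ-+ : ∀ x y z → x * (y + z) ≡ x * y + x * z
  *-distribˡ-+ (a +i b) (c +i d) (e +i f) = cong₂ _+i_
    (solve 6 (λ a b c d e f → a :* (c :+ e) :- b :* (d :+ f)
                           := (a :* c :- b :* d) :+ (a :* e :- b :* f)) refl a b c d e f)
    (solve 6 (λ a b c d e f → a :* (d :+ f) :+ b :* (c :+ e)
                           := (a :* d :+ b :* c) :+ (a :* f :+ b :* e)) refl a b c d e f)

  isCommutativeRing : IsCommutativeRing _≡_ _+_ _*_ -_ 0# 1#
  isCommutativeRing = record
    { isRing = record
      { +-isAbelianGroup = record
        { isGroup = record
          { isMonoid = record
            { isSemigroup = record
              { isMagma = record { isEquivalence = isEquivalence ; ∙-cong = cong₂ _+_ }
              ; assoc = +-assoc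
              }
            ; identity = +-identityˡ , λ x → trans (+-comm x 0#) (+-identityˡ x)
            }
          ; inverse = +-inverseˡ , λ x → trans (+-comm x (- x)) (+-inverseˡ x)
          ; ⁻¹-cong = cong -_
          }
        ; comm = +-comm
        }
      ; *-cong = cong₂ _*_
      ; *-assoc = *-assoc
      ; *-identity = *-identityˡ , λ x → trans (*-comm x 1#) (*-identityˡ x)
      ; distrib = *-distribˡ-+ , λ x y z →
          trans (*-comm (y + z) x) (trans (*-distribˡ-+ x y z) (cong₂ _+_ (*-comm x y) (*-comm x z)))
      }
    ; *-comm = *-comm
    }

  commutativeRing : CommutativeRing 0ℓ 0ℓ
  commutativeRing = record { isCommutativeRing = isCommutativeRing }

  _-_ : ℚ[i] → ℚ[i] → ℚ[i]
  z - w = z + - w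

  _≟_ : (x y : ℚ[i]) → Dec (x ≡ y)
  (a +i b) ≟ (c +i d) with a ℚₚ.≟ c | b ℚₚ.≟ d
  ... | yes refl | yes refl = yes refl
  ... | no a≢c   | _        = no λ { refl → a≢c refl }
  ... | yes _    | no b≢d   = no λ { refl → b≢d refl }

  -- Total inverse on ℚ(i), with 0⁻¹ = 0.
  infix 9 _⁻¹
  _⁻¹ : ℚ[i] → ℚ[i]
  (a +i b) ⁻¹ with a ℚ.* a ℚ.+ b ℚ.* b ℚₚ.≟ 0ℚ
  ... | yes _  = 0#
  ... | no q≢0 = (a ℚ.* r) +i (ℚ.- b ℚ.* r)
    where r = (ℚ.1/ (a ℚ.* a ℚ.+ b ℚ.* b)) {{ℚ.≢-nonZero q≢0}}

private
  module G = Gaussian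
  open Gaussian using (‖_‖)

  module GS = Solver (ACR.fromCommutativeRing G.commutativeRing) G._≟_
  module QS = ℚSolver.+-*-Solver

  <⇒≱ᵠ : ∀ {a b} → a < b → ¬ (b ≤ a)
  <⇒≱ᵠ p q = ℚₚ.<-irrefl refl (ℚₚ.<-≤-trans p q)

  *-mono : ∀ {a b c d} → 0ℚ ≤ a → a ≤ b → 0ℚ ≤ c → c ≤ d → a ℚ.* c ≤ b ℚ.* d
  *-mono {a} {b} {c} {d} 0≤a a≤b 0≤c c≤d = ℚₚ.≤-trans
    (ℚₚ.*-monoʳ-≤-nonNeg c {{ℚ.nonNegative 0≤c}} a≤b)
    (ℚₚ.*-monoˡ-≤-nonNeg b {{ℚ.nonNegative (ℚₚ.≤-trans 0≤a a≤b)}} c≤d)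

  *-nonneg : ∀ {a b} → 0ℚ ≤ a → 0ℚ ≤ b → 0ℚ ≤ a ℚ.* b
  *-nonneg {a} {b} p q = subst (_≤ a ℚ.* b) (ℚₚ.*-zeroˡ 0ℚ) (*-mono ℚₚ.≤-refl p ℚₚ.≤-refl q)

  +-nonneg : ∀ {a b} → 0ℚ ≤ a → 0ℚ ≤ b → 0ℚ ≤ a ℚ.+ b
  +-nonneg {a} {b} p q = subst (_≤ a ℚ.+ b) (ℚₚ.+-identityˡ 0ℚ) (ℚₚ.+-mono-≤ p q)

  *-pos : ∀ {a b} → 0ℚ < a → 0ℚ < b → 0ℚ < a ℚ.* b
  *-pos {a} {b} p q = ℚₚ.positive⁻¹ (a ℚ.* b) {{ℚₚ.pos*pos⇒pos a {{ℚ.positive p}} b {{ℚ.positive q}}}}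

  +-pos : ∀ {a b} → 0ℚ < a → 0ℚ < b → 0ℚ < a ℚ.+ b
  +-pos {a} {b} p q = subst (_< a ℚ.+ b) (ℚₚ.+-identityˡ 0ℚ) (ℚₚ.+-mono-< p q)

  ≤∧≢⇒<ᵠ : ∀ {a b} → a ≤ b → ¬ (a ≡ b) → a < b
  ≤∧≢⇒<ᵠ {a} {b} p q with ℚₚ.<-cmp a b
  ... | tri< a<b _ _ = a<b
  ... | tri≈ _ e _   = ⊥-elim (q e)
  ... | tri> _ _ b<a = ⊥-elim (<⇒≱ᵠ b<a p)

  +-pos-nonneg : ∀ {a b} → 0ℚ < a → 0ℚ ≤ b → 0ℚ < a ℚ.+ b
  +-pos-nonneg {a} {b} p q = subst (_< a ℚ.+ b) (ℚₚ.+-identityˡ 0ℚ) (ℚₚ.+-mono-<-≤ p q)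

  0<1 : 0ℚ < 1ℚ
  0<1 = ℚₚ.positive⁻¹ 1ℚ

  0<½ : 0ℚ < ½
  0<½ = ℚₚ.positive⁻¹ ½

  half-pos : ∀ {e} → 0ℚ < e → 0ℚ < ½ ℚ.* e
  half-pos = *-pos 0<½

  half+half : ∀ e → ½ ℚ.* e ℚ.+ ½ ℚ.* e ≡ e
  half+half e = trans (sym (ℚₚ.*-distribʳ-+ e ½ ½)) (ℚₚ.*-identityˡ e)

  inv⁺ : ∀ q → 0ℚ < q → ∃ λ r → 0ℚ < r × q ℚ.* r ≡ 1ℚ
  inv⁺ q 0<q = (ℚ.1/ q) {{nz}} , ℚₚ.positive⁻¹ _ {{ℚₚ.1/pos⇒pos q {{ℚ.positive 0<q}}}}
             , ℚₚ.*-inverseʳ q {{nz}}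
    where nz = ℚₚ.pos⇒nonZero q {{ℚ.positive 0<q}}

  ≤-+-cancel : ∀ a b c → a ≤ b ℚ.+ c → a ℚ.- c ≤ b
  ≤-+-cancel a b c p = subst (a ℚ.- c ≤_)
    (QS.solve 2 (λ b c → b QS.:+ c QS.:- c QS.:= b) refl b c) (ℚₚ.+-monoˡ-≤ (ℚ.- c) p)

  ‖‖-nonneg : ∀ z → 0ℚ ≤ ‖ z ‖
  ‖‖-nonneg (a +i b) = +-nonneg (ℚₚ.0≤∣p∣ a) (ℚₚ.0≤∣p∣ b)

  +-interchange : ∀ a b c d → (a ℚ.+ b) ℚ.+ (c ℚ.+ d) ≡ (a ℚ.+ c) ℚ.+ (b ℚ.+ d)
  +-interchange = QS.solve 4 (λ a b c d → (a QS.:+ b) QS.:+ (c QS.:+ d) QS.:= (a QS.:+ c) QS.:+ (b QS.:+ d)) refl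

  ‖‖-+ : ∀ z w → ‖ z G.+ w ‖ ≤ ‖ z ‖ ℚ.+ ‖ w ‖
  ‖‖-+ (a +i b) (c +i d) = subst (∣ a ℚ.+ c ∣ ℚ.+ ∣ b ℚ.+ d ∣ ≤_) (+-interchange (∣ a ∣) (∣ c ∣) (∣ b ∣) (∣ d ∣))
    (ℚₚ.+-mono-≤ (ℚₚ.∣p+q∣≤∣p∣+∣q∣ a c) (ℚₚ.∣p+q∣≤∣p∣+∣q∣ b d))

  ‖‖-neg : ∀ z → ‖ G.- z ‖ ≡ ‖ z ‖
  ‖‖-neg (a +i b) = cong₂ ℚ._+_ (ℚₚ.∣-p∣≡∣p∣ a) (ℚₚ.∣-p∣≡∣p∣ b)

  ‖‖-* : ∀ z w → ‖ z G.* w ‖ ≤ ‖ z ‖ ℚ.* ‖ w ‖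
  ‖‖-* (a +i b) (c +i d) = subst (∣ a ℚ.* c ℚ.- b ℚ.* d ∣ ℚ.+ ∣ a ℚ.* d ℚ.+ b ℚ.* c ∣ ≤_)
    (trans (cong₂ ℚ._+_ (cong₂ ℚ._+_ (ℚₚ.∣p*q∣≡∣p∣*∣q∣ a c) (ℚₚ.∣p*q∣≡∣p∣*∣q∣ b d))
                        (cong₂ ℚ._+_ (ℚₚ.∣p*q∣≡∣p∣*∣q∣ a d) (ℚₚ.∣p*q∣≡∣p∣*∣q∣ b c)))
           (QS.solve 4 (λ a b c d → (a QS.:* c QS.:+ b QS.:* d) QS.:+ (a QS.:* d QS.:+ b QS.:* c)
                            QS.:= (a QS.:+ b) QS.:* (c QS.:+ d)) refl (∣ a ∣) (∣ b ∣) (∣ c ∣) (∣ d ∣)))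
    (ℚₚ.+-mono-≤ (ℚₚ.∣p-q∣≤∣p∣+∣q∣ (a ℚ.* c) (b ℚ.* d)) (ℚₚ.∣p+q∣≤∣p∣+∣q∣ (a ℚ.* d) (b ℚ.* c)))

  sq-abs : ∀ a → a ℚ.* a ≡ ∣ a ∣ ℚ.* ∣ a ∣
  sq-abs a with ℚₚ.∣p∣≡p∨∣p∣≡-p a
  ... | inj₁ e = sym (cong₂ ℚ._*_ e e)
  ... | inj₂ e = trans (QS.solve 1 (λ a → a QS.:* a QS.:= (QS.:- a) QS.:* (QS.:- a)) refl a) (sym (cong₂ ℚ._*_ e e))

  sq-nonneg : ∀ a → 0ℚ ≤ a ℚ.* a
  sq-nonneg a = subst (0ℚ ≤_) (sym (sq-abs a)) (*-nonneg (ℚₚ.0≤∣p∣ a) (ℚₚ.0≤∣p∣ a))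

  ‖‖-dist-sym : ∀ z w → ‖ z G.- w ‖ ≡ ‖ w G.- z ‖
  ‖‖-dist-sym z w = trans (sym (‖‖-neg (z G.- w)))
    (cong ‖_‖ (GS.solve 2 (λ z w → GS.:- (z GS.:- w) GS.:= w GS.:- z) refl z w))

  ‖‖-dist-tri : ∀ z w v → ‖ z G.- v ‖ ≤ ‖ z G.- w ‖ ℚ.+ ‖ w G.- v ‖
  ‖‖-dist-tri z w v = subst (λ u → ‖ u ‖ ≤ ‖ z G.- w ‖ ℚ.+ ‖ w G.- v ‖)
    (GS.solve 3 (λ z w v → (z GS.:- w) GS.:+ (w GS.:- v) GS.:= z GS.:- v) refl z w v)
    (‖‖-+ (z G.- w) (w G.- v))

  ‖‖-≤-dist : ∀ z w → ‖ z ‖ ≤ ‖ z G.- w ‖ ℚ.+ ‖ w ‖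
  ‖‖-≤-dist z w = subst (λ u → ‖ u ‖ ≤ ‖ z G.- w ‖ ℚ.+ ‖ w ‖)
    (GS.solve 2 (λ z w → (z GS.:- w) GS.:+ w GS.:= z) refl z w) (‖‖-+ (z G.- w) w)

  -- ‖z‖² ≤ 2 (re² + im²)
  ‖‖-sq : ∀ a b → ‖ a +i b ‖ ℚ.* ‖ a +i b ‖ ≤ (1ℚ ℚ.+ 1ℚ) ℚ.* (a ℚ.* a ℚ.+ b ℚ.* b)
  ‖‖-sq a b = subst₂ _≤_ (ℚₚ.+-identityʳ _)
    (trans (QS.solve 2 (λ x y → (x QS.:+ y) QS.:* (x QS.:+ y) QS.:+ (x QS.:- y) QS.:* (x QS.:- y)
               QS.:= (QS.con 1ℚ QS.:+ QS.con 1ℚ) QS.:* (x QS.:* x QS.:+ y QS.:* y)) refl (∣ a ∣) (∣ b ∣))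
           (cong ((1ℚ ℚ.+ 1ℚ) ℚ.*_) (sym (cong₂ ℚ._+_ (sq-abs a) (sq-abs b)))))
    (ℚₚ.+-monoʳ-≤ (‖ a +i b ‖ ℚ.* ‖ a +i b ‖) (sq-nonneg (∣ a ∣ ℚ.- ∣ b ∣)))

  G-inverse : ∀ z {δ δ⁻¹} → 0ℚ < δ → 0ℚ < δ⁻¹ → δ ℚ.* δ⁻¹ ≡ 1ℚ → δ ≤ ‖ z ‖ →
              z G.* z G.⁻¹ ≡ G.1# × ‖ z G.⁻¹ ‖ ≤ (1ℚ ℚ.+ 1ℚ) ℚ.* δ⁻¹
  G-inverse (a +i b) {δ} {δ⁻¹} 0<δ 0<δ⁻¹ δδ⁻¹ δ≤ with a ℚ.* a ℚ.+ b ℚ.* b ℚₚ.≟ 0ℚ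
  ... | yes q≡0 = ⊥-elim (<⇒≱ᵠ (*-pos 0<δ 0<δ)
          (subst (δ ℚ.* δ ≤_) (trans (cong ((1ℚ ℚ.+ 1ℚ) ℚ.*_) q≡0) (ℚₚ.*-zeroʳ (1ℚ ℚ.+ 1ℚ)))
            (ℚₚ.≤-trans (*-mono (ℚₚ.<⇒≤ 0<δ) δ≤ (ℚₚ.<⇒≤ 0<δ) δ≤) (‖‖-sq a b))))
  ... | no q≢0 = prod , bound
    where
    q = a ℚ.* a ℚ.+ b ℚ.* b
    instance nz = ℚ.≢-nonZero q≢0
    r = (ℚ.1/ q) {{nz}}
    N = ‖ a +i b ‖
    0≤q : 0ℚ ≤ q
    0≤q = +-nonneg (sq-nonneg a) (sq-nonneg b)
    qr : q ℚ.* r ≡ 1ℚ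
    qr = ℚₚ.*-inverseʳ q
    pos-q : ℚ.Positive q
    pos-q = ℚ.positive (≤∧≢⇒<ᵠ 0≤q (λ e → q≢0 (sym e)))
    0≤r : 0ℚ ≤ r
    0≤r = ℚₚ.<⇒≤ (ℚₚ.positive⁻¹ r {{ℚₚ.1/pos⇒pos q {{pos-q}}}})
    prod : (a +i b) G.* ((a ℚ.* r) +i (ℚ.- b ℚ.* r)) ≡ G.1#
    prod = cong₂ _+i_
      (trans (QS.solve 3 (λ a b r → a QS.:* (a QS.:* r) QS.:- b QS.:* (QS.:- b QS.:* r)
                QS.:= (a QS.:* a QS.:+ b QS.:* b) QS.:* r) refl a b r) qr)
      (QS.solve 3 (λ a b r → a QS.:* (QS.:- b QS.:* r) QS.:+ b QS.:* (a QS.:* r) QS.:= QS.con 0ℚ) refl a b r)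
    norm : ‖ (a ℚ.* r) +i (ℚ.- b ℚ.* r) ‖ ≡ N ℚ.* r
    norm = trans (cong₂ ℚ._+_ (ℚₚ.∣p*q∣≡∣p∣*∣q∣ a r)
              (trans (ℚₚ.∣p*q∣≡∣p∣*∣q∣ (ℚ.- b) r) (cong (ℚ._* ∣ r ∣) (ℚₚ.∣-p∣≡∣p∣ b))))
            (trans (sym (ℚₚ.*-distribʳ-+ (∣ r ∣) (∣ a ∣) (∣ b ∣))) (cong (N ℚ.*_) (ℚₚ.0≤p⇒∣p∣≡p 0≤r)))
    0≤N = ‖‖-nonneg (a +i b)
    -- N r = (δ N) r δ⁻¹ ≤ N² r δ⁻¹ ≤ 2 q r δ⁻¹ = 2 δ⁻¹
    bound : ‖ (a ℚ.* r) +i (ℚ.- b ℚ.* r) ‖ ≤ (1ℚ ℚ.+ 1ℚ) ℚ.* δ⁻¹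
    bound = subst₂ _≤_
      (trans (QS.solve 4 (λ d n r e → ((d QS.:* n) QS.:* r) QS.:* e QS.:= (n QS.:* r) QS.:* (d QS.:* e)) refl δ N r δ⁻¹)
             (trans (cong ((N ℚ.* r) ℚ.*_) δδ⁻¹) (trans (ℚₚ.*-identityʳ _) (sym norm))))
      (trans (QS.solve 4 (λ t q r e → ((t QS.:* q) QS.:* r) QS.:* e QS.:= (t QS.:* e) QS.:* (q QS.:* r)) refl (1ℚ ℚ.+ 1ℚ) q r δ⁻¹)
             (trans (cong (((1ℚ ℚ.+ 1ℚ) ℚ.* δ⁻¹) ℚ.*_) qr) (ℚₚ.*-identityʳ _)))
      (*-mono (*-nonneg (*-nonneg (ℚₚ.<⇒≤ 0<δ) 0≤N) 0≤r)
         (*-mono (*-nonneg (ℚₚ.<⇒≤ 0<δ) 0≤N)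
            (ℚₚ.≤-trans (*-mono (ℚₚ.<⇒≤ 0<δ) δ≤ 0≤N ℚₚ.≤-refl) (‖‖-sq a b)) 0≤r ℚₚ.≤-refl)
         (ℚₚ.<⇒≤ 0<δ⁻¹) ℚₚ.≤-refl)

  prodDiff : ∀ {a b c d B B' δ} → ‖ a ‖ ≤ B → ‖ d ‖ ≤ B' → ‖ b G.- d ‖ ≤ δ → ‖ a G.- c ‖ ≤ δ →
             ‖ a G.* b G.- c G.* d ‖ ≤ (B ℚ.+ B') ℚ.* δ
  prodDiff {a} {b} {c} {d} {B} {B'} {δ} pa pd pbd pac = subst₂ _≤_
    (cong ‖_‖ (GS.solve 4 (λ a b c d → a GS.:* (b GS.:- d) GS.:+ (a GS.:- c) GS.:* d
                 GS.:= a GS.:* b GS.:- c GS.:* d) refl a b c d))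
    (QS.solve 3 (λ B B' e → B QS.:* e QS.:+ e QS.:* B' QS.:= (B QS.:+ B') QS.:* e) refl B B' δ)
    (ℚₚ.≤-trans (‖‖-+ (a G.* (b G.- d)) ((a G.- c) G.* d))
      (ℚₚ.+-mono-≤
        (ℚₚ.≤-trans (‖‖-* a (b G.- d)) (*-mono (‖‖-nonneg a) pa (‖‖-nonneg (b G.- d)) pbd))
        (ℚₚ.≤-trans (‖‖-* (a G.- c) d) (*-mono (‖‖-nonneg (a G.- c)) pac (‖‖-nonneg d) pd))))

  scale : ∀ B {ε} → 0ℚ < B → 0ℚ < ε → ∃ λ δ → 0ℚ < δ × B ℚ.* δ ≡ ε
  scale B {ε} 0<B 0<ε with inv⁺ B 0<B
  ... | r , 0<r , Br = r ℚ.* ε , *-pos 0<r 0<ε ,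
    trans (sym (ℚₚ.*-assoc B r ε)) (trans (cong (ℚ._* ε) Br) (ℚₚ.*-identityˡ ε))

IsCauchy : (ℕ → ℚ[i]) → Set
IsCauchy x = ∀ ε → 0ℚ < ε → ∃ λ N → ∀ m n → N ℕ.≤ m → N ℕ.≤ n → ‖ x m G.- x n ‖ ≤ ε

-- The field of complex numbers, as the completion of ℚ(i): Cauchy sequences
-- modulo null sequences.
record ℂ : Set where
  constructor mkℂ
  field
    seq    : ℕ → ℚ[i]
    cauchy : IsCauchy seq

open ℂ public

infix 4 _≈ᶜ_ _#ᶜ_

_≈ᶜ_ : ℂ → ℂ → Set
x ≈ᶜ y = ∀ ε → 0ℚ < ε → ∃ λ N → ∀ n → N ℕ.≤ n → ‖ seq x n G.- seq y n ‖ ≤ ε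

-- Apartness, the positive form of x ≠ y: the distance is bounded below.
_#ᶜ_ : ℂ → ℂ → Set
x #ᶜ y = ∃ λ ε → 0ℚ < ε × ∃ λ N → ∀ n → N ℕ.≤ n → ε ≤ ‖ seq x n G.- seq y n ‖

private

  ≤⊔ˡ : ∀ {m n k} → m ℕ.⊔ n ℕ.≤ k → m ℕ.≤ k
  ≤⊔ˡ {m} {n} p = ℕₚ.≤-trans (ℕₚ.m≤m⊔n m n) p

  ≤⊔ʳ : ∀ {m n k} → m ℕ.⊔ n ℕ.≤ k → n ℕ.≤ k
  ≤⊔ʳ {m} {n} p = ℕₚ.≤-trans (ℕₚ.m≤n⊔m m n) p

  ‖z-z‖≤ : ∀ z {ε} → 0ℚ < ε → ‖ z G.- z ‖ ≤ ε
  ‖z-z‖≤ z {ε} 0<ε = subst (_≤ ε) (sym (cong ‖_‖ (CommutativeRing.-‿inverseʳ G.commutativeRing z))) (ℚₚ.<⇒≤ 0<ε)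

  const-cauchy : ∀ z → IsCauchy (λ _ → z)
  const-cauchy z ε 0<ε = 0 , λ _ _ _ _ → ‖z-z‖≤ z 0<ε

  ‖+-+‖ : ∀ a b c d → ‖ (a G.+ b) G.- (c G.+ d) ‖ ≤ ‖ a G.- c ‖ ℚ.+ ‖ b G.- d ‖
  ‖+-+‖ a b c d = subst (λ u → ‖ u ‖ ≤ ‖ a G.- c ‖ ℚ.+ ‖ b G.- d ‖)
    (GS.solve 4 (λ a b c d → (a GS.:- c) GS.:+ (b GS.:- d) GS.:= (a GS.:+ b) GS.:- (c GS.:+ d)) refl a b c d)
    (‖‖-+ (a G.- c) (b G.- d))

  ‖--‖ : ∀ a b → ‖ G.- a G.- G.- b ‖ ≡ ‖ a G.- b ‖
  ‖--‖ a b = trans (cong ‖_‖ (GS.solve 2 (λ a b → GS.:- a GS.:- GS.:- b GS.:= GS.:- (a GS.:- b)) refl a b))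
    (‖‖-neg (a G.- b))

  +-cauchy : ∀ {x y} → IsCauchy x → IsCauchy y → IsCauchy (λ n → x n G.+ y n)
  +-cauchy {x} {y} p q ε 0<ε =
    let (M , f) = p (½ ℚ.* ε) (half-pos 0<ε)
        (N , g) = q (½ ℚ.* ε) (half-pos 0<ε)
    in M ℕ.⊔ N , λ m n i j → subst (‖ (x m G.+ y m) G.- (x n G.+ y n) ‖ ≤_) (half+half ε)
    (ℚₚ.≤-trans (‖+-+‖ (x m) (y m) (x n) (y n))
      (ℚₚ.+-mono-≤ (f m n (≤⊔ˡ {M} {N} i) (≤⊔ˡ {M} {N} j)) (g m n (≤⊔ʳ {M} {N} i) (≤⊔ʳ {M} {N} j))))

  neg-cauchy : ∀ {x} → IsCauchy x → IsCauchy (λ n → G.- x n)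
  neg-cauchy {x} p ε 0<ε =
    let (N , f) = p ε 0<ε
    in N , λ m n i j → subst (_≤ ε) (sym (‖--‖ (x m) (x n))) (f m n i j)

  bounded : ∀ {x} → IsCauchy x → ∃ λ B → 0ℚ < B × ∃ λ N → ∀ n → N ℕ.≤ n → ‖ x n ‖ ≤ B
  bounded {x} p =
    let (N , f) = p 1ℚ 0<1
    in 1ℚ ℚ.+ ‖ x N ‖
              , +-pos-nonneg 0<1 (‖‖-nonneg (x N))
              , N , λ n i → ℚₚ.≤-trans (‖‖-≤-dist (x n) (x N)) (ℚₚ.+-monoˡ-≤ ‖ x N ‖ (f n N i ℕₚ.≤-refl))

  *-cauchy : ∀ {x y} → IsCauchy x → IsCauchy y → IsCauchy (λ n → x n G.* y n)
  *-cauchy {x} {y} p q ε 0<ε =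
    let (B , 0<B , K , b) = bounded {x} p
        (B' , 0<B' , K' , b') = bounded {y} q
        (δ , 0<δ , eq) = scale (B ℚ.+ B') (+-pos 0<B 0<B') 0<ε
        (M , f) = p δ 0<δ
        (N , g) = q δ 0<δ
    in (K ℕ.⊔ K') ℕ.⊔ (M ℕ.⊔ N) , λ m n i j →
    subst (‖ x m G.* y m G.- x n G.* y n ‖ ≤_) eq
      (prodDiff {x m} {y m} {x n} {y n}
        (b m (≤⊔ˡ {K} {K'} (≤⊔ˡ {K ℕ.⊔ K'} {M ℕ.⊔ N} i)))
        (b' n (≤⊔ʳ {K} {K'} (≤⊔ˡ {K ℕ.⊔ K'} {M ℕ.⊔ N} j)))
        (g m n (≤⊔ʳ {M} {N} (≤⊔ʳ {K ℕ.⊔ K'} {M ℕ.⊔ N} i)) (≤⊔ʳ {M} {N} (≤⊔ʳ {K ℕ.⊔ K'} {M ℕ.⊔ N} j)))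
        (f m n (≤⊔ˡ {M} {N} (≤⊔ʳ {K ℕ.⊔ K'} {M ℕ.⊔ N} i)) (≤⊔ˡ {M} {N} (≤⊔ʳ {K ℕ.⊔ K'} {M ℕ.⊔ N} j))))

abstract
  private
    sum-cauchy : ∀ x y → IsCauchy (λ n → seq x n G.+ seq y n)
    sum-cauchy x y = +-cauchy {seq x} {seq y} (cauchy x) (cauchy y)

    prod-cauchy : ∀ x y → IsCauchy (λ n → seq x n G.* seq y n)
    prod-cauchy x y = *-cauchy {seq x} {seq y} (cauchy x) (cauchy y)

    opp-cauchy : ∀ x → IsCauchy (λ n → G.- seq x n)
    opp-cauchy x = neg-cauchy {seq x} (cauchy x)

infix  8 -ᶜ_
infixl 7 _*ᶜ_
infixl 6 _+ᶜ_

_+ᶜ_ _*ᶜ_ : ℂ → ℂ → ℂ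
x +ᶜ y = mkℂ (λ n → seq x n G.+ seq y n) (sum-cauchy x y)
x *ᶜ y = mkℂ (λ n → seq x n G.* seq y n) (prod-cauchy x y)

-ᶜ_ : ℂ → ℂ
-ᶜ x = mkℂ (λ n → G.- seq x n) (opp-cauchy x)

0ᶜ 1ᶜ : ℂ
0ᶜ = mkℂ (λ _ → G.0#) (const-cauchy G.0#)
1ᶜ = mkℂ (λ _ → G.1#) (const-cauchy G.1#)

private
  pointwise : ∀ x y → (∀ n → seq x n ≡ seq y n) → x ≈ᶜ y
  pointwise x y e ε 0<ε = 0 , λ n _ → subst (λ w → ‖ seq x n G.- w ‖ ≤ ε) (e n) (‖z-z‖≤ (seq x n) 0<ε)

  ≈-refl : ∀ {x} → x ≈ᶜ x
  ≈-refl {x} = pointwise x x (λ _ → refl)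

  ≈-sym : ∀ {x y} → x ≈ᶜ y → y ≈ᶜ x
  ≈-sym {x} {y} p ε 0<ε =
    let (N , f) = p ε 0<ε
    in N , λ n i → subst (_≤ ε) (‖‖-dist-sym (seq x n) (seq y n)) (f n i)

  ≈-trans : ∀ {x y z} → x ≈ᶜ y → y ≈ᶜ z → x ≈ᶜ z
  ≈-trans {x} {y} {z} p q ε 0<ε =
    let (M , f) = p (½ ℚ.* ε) (half-pos 0<ε)
        (N , g) = q (½ ℚ.* ε) (half-pos 0<ε)
    in M ℕ.⊔ N , λ n i → subst (‖ seq x n G.- seq z n ‖ ≤_) (half+half ε)
    (ℚₚ.≤-trans (‖‖-dist-tri (seq x n) (seq y n) (seq z n))
      (ℚₚ.+-mono-≤ (f n (≤⊔ˡ {M} {N} i)) (g n (≤⊔ʳ {M} {N} i))))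

  +-congᶜ : ∀ {x y u v} → x ≈ᶜ y → u ≈ᶜ v → x +ᶜ u ≈ᶜ y +ᶜ v
  +-congᶜ {x} {y} {u} {v} p q ε 0<ε =
    let (M , f) = p (½ ℚ.* ε) (half-pos 0<ε)
        (N , g) = q (½ ℚ.* ε) (half-pos 0<ε)
    in M ℕ.⊔ N , λ n i →
    subst (‖ (seq x n G.+ seq u n) G.- (seq y n G.+ seq v n) ‖ ≤_) (half+half ε)
    (ℚₚ.≤-trans (‖+-+‖ (seq x n) (seq u n) (seq y n) (seq v n))
      (ℚₚ.+-mono-≤ (f n (≤⊔ˡ {M} {N} i)) (g n (≤⊔ʳ {M} {N} i))))

  neg-congᶜ : ∀ {x y} → x ≈ᶜ y → -ᶜ x ≈ᶜ -ᶜ y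
  neg-congᶜ {x} {y} p ε 0<ε =
    let (N , f) = p ε 0<ε
    in N , λ n i → subst (_≤ ε) (sym (‖--‖ (seq x n) (seq y n))) (f n i)

  *-congᶜ : ∀ {x y u v} → x ≈ᶜ y → u ≈ᶜ v → x *ᶜ u ≈ᶜ y *ᶜ v
  *-congᶜ {x} {y} {u} {v} p q ε 0<ε =
    let (B , 0<B , K , b) = bounded {seq x} (cauchy x)
        (B' , 0<B' , K' , b') = bounded {seq v} (cauchy v)
        (δ , 0<δ , eq) = scale (B ℚ.+ B') (+-pos 0<B 0<B') 0<ε
        (M , f) = p δ 0<δ
        (N , g) = q δ 0<δ
    in (K ℕ.⊔ K') ℕ.⊔ (M ℕ.⊔ N) , λ n i →
    subst (‖ seq x n G.* seq u n G.- seq y n G.* seq v n ‖ ≤_) eq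
      (prodDiff {seq x n} {seq u n} {seq y n} {seq v n}
        (b n (≤⊔ˡ {K} {K'} (≤⊔ˡ {K ℕ.⊔ K'} {M ℕ.⊔ N} i)))
        (b' n (≤⊔ʳ {K} {K'} (≤⊔ˡ {K ℕ.⊔ K'} {M ℕ.⊔ N} i)))
        (g n (≤⊔ʳ {M} {N} (≤⊔ʳ {K ℕ.⊔ K'} {M ℕ.⊔ N} i)))
        (f n (≤⊔ˡ {M} {N} (≤⊔ʳ {K ℕ.⊔ K'} {M ℕ.⊔ N} i))))

  module CR = CommutativeRing G.commutativeRing

private
  ℂ-isCommutativeRing : IsCommutativeRing _≈ᶜ_ _+ᶜ_ _*ᶜ_ -ᶜ_ 0ᶜ 1ᶜ
  ℂ-isCommutativeRing = record
    { isRing = record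
      { +-isAbelianGroup = record
        { isGroup = record
          { isMonoid = record
            { isSemigroup = record
              { isMagma = record
                { isEquivalence = record
                  { refl = λ {x} → ≈-refl {x} ; sym = λ {x} {y} → ≈-sym {x} {y} ; trans = λ {x} {y} {z} → ≈-trans {x} {y} {z} }
                ; ∙-cong = λ {x} {y} {u} {v} → +-congᶜ {x} {y} {u} {v}
                }
              ; assoc = λ x y z → pointwise ((x +ᶜ y) +ᶜ z) (x +ᶜ (y +ᶜ z)) (λ n → CR.+-assoc (seq x n) (seq y n) (seq z n))
              }
            ; identity = (λ x → pointwise (0ᶜ +ᶜ x) x (λ n → CR.+-identityˡ (seq x n)))
                       , (λ x → pointwise (x +ᶜ 0ᶜ) x (λ n → CR.+-identityʳ (seq x n)))
            }
          ; inverse = (λ x → pointwise (-ᶜ x +ᶜ x) 0ᶜ (λ n → CR.-‿inverseˡ (seq x n)))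
                    , (λ x → pointwise (x +ᶜ -ᶜ x) 0ᶜ (λ n → CR.-‿inverseʳ (seq x n)))
          ; ⁻¹-cong = λ {x} {y} → neg-congᶜ {x} {y}
          }
        ; comm = λ x y → pointwise (x +ᶜ y) (y +ᶜ x) (λ n → CR.+-comm (seq x n) (seq y n))
        }
      ; *-cong = λ {x} {y} {u} {v} → *-congᶜ {x} {y} {u} {v}
      ; *-assoc = λ x y z → pointwise ((x *ᶜ y) *ᶜ z) (x *ᶜ (y *ᶜ z)) (λ n → CR.*-assoc (seq x n) (seq y n) (seq z n))
      ; *-identity = (λ x → pointwise (1ᶜ *ᶜ x) x (λ n → CR.*-identityˡ (seq x n)))
                   , (λ x → pointwise (x *ᶜ 1ᶜ) x (λ n → CR.*-identityʳ (seq x n)))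
      ; distrib = (λ x y z → pointwise (x *ᶜ (y +ᶜ z)) ((x *ᶜ y) +ᶜ (x *ᶜ z)) (λ n → CR.distribˡ (seq x n) (seq y n) (seq z n)))
                , (λ x y z → pointwise ((y +ᶜ z) *ᶜ x) ((y *ᶜ x) +ᶜ (z *ᶜ x)) (λ n → CR.distribʳ (seq x n) (seq y n) (seq z n)))
      }
    ; *-comm = λ x y → pointwise (x *ᶜ y) (y *ᶜ x) (λ n → CR.*-comm (seq x n) (seq y n))
    }

  #ᶜ-irrefl : ∀ {x y} → x ≈ᶜ y → ¬ (x #ᶜ y)
  #ᶜ-irrefl {x} {y} p (ε , 0<ε , N , f) =
    let (M , g) = p (½ ℚ.* ε) (half-pos 0<ε)
    in <⇒≱ᵠ (subst₂ _<_ (ℚₚ.+-identityʳ (½ ℚ.* ε)) (half+half ε) (ℚₚ.+-monoʳ-< (½ ℚ.* ε) (half-pos 0<ε)))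
    (ℚₚ.≤-trans (f (N ℕ.⊔ M) (ℕₚ.m≤m⊔n N M)) (g (N ℕ.⊔ M) (ℕₚ.m≤n⊔m N M)))

  #ᶜ-sym : ∀ {x y} → x #ᶜ y → y #ᶜ x
  #ᶜ-sym {x} {y} (ε , 0<ε , N , f) = ε , 0<ε , N , λ n i → subst (ε ≤_) (‖‖-dist-sym (seq x n) (seq y n)) (f n i)

  -- The distance between two Cauchy sequences varies by at most ε far out.
  settle : ∀ x y ε → 0ℚ < ε → ∃ λ N → ∀ m n → N ℕ.≤ m → N ℕ.≤ n →
           ‖ seq x m G.- seq y m ‖ ≤ ε ℚ.+ ‖ seq x n G.- seq y n ‖
  settle x y ε 0<ε =
    let (N , f) = cauchy (x +ᶜ -ᶜ y) ε 0<ε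
    in N , λ m n i j → ℚₚ.≤-trans (‖‖-≤-dist (seq x m G.- seq y m) (seq x n G.- seq y n))
                                  (ℚₚ.+-monoˡ-≤ ‖ seq x n G.- seq y n ‖ (f m n i j))

  large⇒# : ∀ x y ε N → 0ℚ < ε →
            (∀ m n → N ℕ.≤ m → N ℕ.≤ n → ‖ seq x m G.- seq y m ‖ ≤ ½ ℚ.* ε ℚ.+ ‖ seq x n G.- seq y n ‖) →
            ∀ k → N ℕ.≤ k → ε ≤ ‖ seq x k G.- seq y k ‖ → x #ᶜ y
  large⇒# x y ε N 0<ε h k N≤k p = ½ ℚ.* ε , half-pos 0<ε , N , λ n i →
    subst (_≤ ‖ seq x n G.- seq y n ‖)
      (trans (cong (ℚ._- ½ ℚ.* ε) (sym (half+half ε)))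
        (QS.solve 1 (λ h → h QS.:+ h QS.:- h QS.:= h) refl (½ ℚ.* ε)))
      (≤-+-cancel ε ‖ seq x n G.- seq y n ‖ (½ ℚ.* ε)
        (ℚₚ.≤-trans p (subst (‖ seq x k G.- seq y k ‖ ≤_) (ℚₚ.+-comm (½ ℚ.* ε) ‖ seq x n G.- seq y n ‖) (h k n N≤k i))))

  #ᶜ-cotrans : ∀ {x y} → x #ᶜ y → ∀ z → (x #ᶜ z) ⊎ (z #ᶜ y)
  #ᶜ-cotrans {x} {y} (ε , 0<ε , N , f) z =
    decide (ℚₚ.≤-total (½ ℚ.* ε) ‖ seq x k G.- seq z k ‖)
    where
    S  = settle x z (½ ℚ.* (½ ℚ.* ε)) (half-pos (half-pos 0<ε))
    S' = settle z y (½ ℚ.* (½ ℚ.* ε)) (half-pos (half-pos 0<ε))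
    M  = proj₁ S
    g  = proj₂ S
    M' = proj₁ S'
    g' = proj₂ S'
    k = N ℕ.⊔ (M ℕ.⊔ M')
    N≤k : N ℕ.≤ k
    N≤k = ℕₚ.m≤m⊔n N (M ℕ.⊔ M')
    M≤k : M ℕ.≤ k
    M≤k = ≤⊔ˡ {M} {M'} (ℕₚ.m≤n⊔m N (M ℕ.⊔ M'))
    M'≤k : M' ℕ.≤ k
    M'≤k = ≤⊔ʳ {M} {M'} (ℕₚ.m≤n⊔m N (M ℕ.⊔ M'))
    d₁ = ‖ seq x k G.- seq z k ‖
    d₂ = ‖ seq z k G.- seq y k ‖
    decide : ½ ℚ.* ε ≤ d₁ ⊎ d₁ ≤ ½ ℚ.* ε → (x #ᶜ z) ⊎ (z #ᶜ y)
    decide (inj₁ p) = inj₁ (large⇒# x z (½ ℚ.* ε) M (half-pos 0<ε) g k M≤k p)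
    decide (inj₂ p) = inj₂ (large⇒# z y (½ ℚ.* ε) M' (half-pos 0<ε) g' k M'≤k
      (subst (_≤ d₂)
        (trans (cong (ℚ._- ½ ℚ.* ε) (sym (half+half ε)))
          (QS.solve 1 (λ h → h QS.:+ h QS.:- h QS.:= h) refl (½ ℚ.* ε)))
        (≤-+-cancel ε d₂ (½ ℚ.* ε)
          (ℚₚ.≤-trans (f k N≤k) (ℚₚ.≤-trans (‖‖-dist-tri (seq x k) (seq z k) (seq y k))
            (subst (d₁ ℚ.+ d₂ ≤_) (ℚₚ.+-comm (½ ℚ.* ε) d₂) (ℚₚ.+-monoˡ-≤ d₂ p)))))))

  ¬#⇒≈ : ∀ x y → ¬ (x #ᶜ y) → x ≈ᶜ y
  ¬#⇒≈ x y ¬x#y ε 0<ε =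
    N , λ n i → decide n i (ℚₚ.≤-total (½ ℚ.* ε) ‖ seq x n G.- seq y n ‖)
    where
    S = settle x y (½ ℚ.* (½ ℚ.* ε)) (half-pos (half-pos 0<ε))
    N = proj₁ S
    g = proj₂ S
    ½ε≤ε : ½ ℚ.* ε ≤ ε
    ½ε≤ε = subst₂ _≤_ (ℚₚ.+-identityʳ (½ ℚ.* ε)) (half+half ε) (ℚₚ.+-monoʳ-≤ (½ ℚ.* ε) (ℚₚ.<⇒≤ (half-pos 0<ε)))
    decide : ∀ n → N ℕ.≤ n → ½ ℚ.* ε ≤ ‖ seq x n G.- seq y n ‖ ⊎ ‖ seq x n G.- seq y n ‖ ≤ ½ ℚ.* ε →
             ‖ seq x n G.- seq y n ‖ ≤ ε
    decide n i (inj₁ p) = ⊥-elim (¬x#y (large⇒# x y (½ ℚ.* ε) N (half-pos 0<ε) g n i p))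
    decide n i (inj₂ p) = ℚₚ.≤-trans p ½ε≤ε

  inverse : ∀ {x y} → x #ᶜ y → ∃ λ w → (w *ᶜ (x +ᶜ -ᶜ y) ≈ᶜ 1ᶜ) × ((x +ᶜ -ᶜ y) *ᶜ w ≈ᶜ 1ᶜ)
  inverse {x} {y} (δ , 0<δ , N , f) =
    w , ≈-trans {w *ᶜ d} {d *ᶜ w} {1ᶜ} (pointwise (w *ᶜ d) (d *ᶜ w) (λ n → CR.*-comm (seq w n) (seq d n))) dw , dw
    where
    d     = x +ᶜ -ᶜ y
    I     = inv⁺ δ 0<δ
    δ⁻¹   = proj₁ I
    0<δ⁻¹ = proj₁ (proj₂ I)
    δδ⁻¹  = proj₂ (proj₂ I)
    K     = (1ℚ ℚ.+ 1ℚ) ℚ.* δ⁻¹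
    0<K : 0ℚ < K
    0<K = *-pos (+-pos 0<1 0<1) 0<δ⁻¹
    inv : ∀ n → N ℕ.≤ n → seq d n G.* seq d n G.⁻¹ ≡ G.1# × ‖ seq d n G.⁻¹ ‖ ≤ K
    inv n i = G-inverse (seq d n) 0<δ 0<δ⁻¹ δδ⁻¹ (f n i)
    diff : ∀ a b a' b' → a G.* a' ≡ G.1# → b G.* b' ≡ G.1# → a' G.- b' ≡ (a' G.* b') G.* (b G.- a)
    diff a b a' b' p q = trans
      (trans (GS.solve 2 (λ a' b' → a' GS.:- b' GS.:= a' GS.:* GS.con G.1# GS.:- b' GS.:* GS.con G.1#) refl a' b')
             (cong₂ (λ u v → a' G.* u G.- b' G.* v) (sym q) (sym p)))
      (GS.solve 4 (λ a b a' b' → a' GS.:* (b GS.:* b') GS.:- b' GS.:* (a GS.:* a')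
          GS.:= (a' GS.:* b') GS.:* (b GS.:- a)) refl a b a' b')
    w-cauchy : IsCauchy (λ n → seq d n G.⁻¹)
    w-cauchy ε 0<ε =
      let (η , 0<η , eq) = scale (K ℚ.* K) (*-pos 0<K 0<K) 0<ε
          (M , g) = cauchy d η 0<η
      in N ℕ.⊔ M , λ m n i j → subst₂ _≤_
        (cong ‖_‖ (sym (diff (seq d m) (seq d n) (seq d m G.⁻¹) (seq d n G.⁻¹)
           (proj₁ (inv m (≤⊔ˡ {N} {M} i))) (proj₁ (inv n (≤⊔ˡ {N} {M} j))))))
        eq
        (ℚₚ.≤-trans (‖‖-* (seq d m G.⁻¹ G.* seq d n G.⁻¹) (seq d n G.- seq d m))
          (*-mono (‖‖-nonneg (seq d m G.⁻¹ G.* seq d n G.⁻¹))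
            (ℚₚ.≤-trans (‖‖-* (seq d m G.⁻¹) (seq d n G.⁻¹))
              (*-mono (‖‖-nonneg (seq d m G.⁻¹)) (proj₂ (inv m (≤⊔ˡ {N} {M} i)))
                      (‖‖-nonneg (seq d n G.⁻¹)) (proj₂ (inv n (≤⊔ˡ {N} {M} j)))))
            (‖‖-nonneg (seq d n G.- seq d m))
            (g n m (≤⊔ʳ {N} {M} j) (≤⊔ʳ {N} {M} i))))
    w : ℂ
    w = mkℂ (λ n → seq d n G.⁻¹) w-cauchy
    dw : d *ᶜ w ≈ᶜ 1ᶜ
    dw ε 0<ε = N , λ n i → subst (λ u → ‖ u G.- G.1# ‖ ≤ ε) (sym (proj₁ (inv n i))) (‖z-z‖≤ G.1# 0<ε)

  unit⇒# : ∀ x y w → (x +ᶜ -ᶜ y) *ᶜ w ≈ᶜ 1ᶜ → x #ᶜ y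
  unit⇒# x y w p =
    ½ ℚ.* r , *-pos 0<½ 0<r , K ℕ.⊔ M , bound
    where
    b* = bounded {seq w} (cauchy w)
    B   = proj₁ b*
    0<B = proj₁ (proj₂ b*)
    K   = proj₁ (proj₂ (proj₂ b*))
    b   = proj₂ (proj₂ (proj₂ b*))
    M   = proj₁ (p ½ 0<½)
    f   = proj₂ (p ½ 0<½)
    I   = inv⁺ B 0<B
    r   = proj₁ I
    0<r = proj₁ (proj₂ I)
    Br  = proj₂ (proj₂ I)
    bound : ∀ n → K ℕ.⊔ M ℕ.≤ n → ½ ℚ.* r ≤ ‖ seq x n G.- seq y n ‖
    bound n i = subst (½ ℚ.* r ≤_)
      (trans (ℚₚ.*-assoc D B r) (trans (cong (D ℚ.*_) Br) (ℚₚ.*-identityʳ D)))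
      (*-mono (ℚₚ.<⇒≤ 0<½) half≤ (ℚₚ.<⇒≤ 0<r) ℚₚ.≤-refl)
      where
      D = ‖ seq x n G.- seq y n ‖
      P = (seq x n G.- seq y n) G.* seq w n
      half≤ : ½ ≤ D ℚ.* B
      half≤ = ℚₚ.≤-trans
        (≤-+-cancel 1ℚ ‖ P ‖ ½
          (ℚₚ.≤-trans (‖‖-≤-dist G.1# P)
            (subst (‖ G.1# G.- P ‖ ℚ.+ ‖ P ‖ ≤_) (ℚₚ.+-comm ½ ‖ P ‖)
              (ℚₚ.+-monoˡ-≤ ‖ P ‖ (subst (_≤ ½) (‖‖-dist-sym P G.1#) (f n (≤⊔ʳ {K} {M} i)))))))
        (ℚₚ.≤-trans (‖‖-* (seq x n G.- seq y n) (seq w n))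
          (*-mono (‖‖-nonneg (seq x n G.- seq y n)) ℚₚ.≤-refl (‖‖-nonneg (seq w n)) (b n (≤⊔ˡ {K} {M} i))))

  ℂ-isHeytingField′ : IsHeytingField _≈ᶜ_ _#ᶜ_ _+ᶜ_ _*ᶜ_ -ᶜ_ 0ᶜ 1ᶜ
  ℂ-isHeytingField′ = record
    { isHeytingCommutativeRing = record
      { isCommutativeRing = ℂ-isCommutativeRing
      ; isApartnessRelation = record
        { irrefl = λ {x} {y} → #ᶜ-irrefl {x} {y}
        ; sym = λ {x} {y} → #ᶜ-sym {x} {y}
        ; cotrans = λ {x} {y} → #ᶜ-cotrans {x} {y}
        }
      ; #⇒invertible = λ {x} {y} → inverse {x} {y}
      ; invertible⇒# = λ {x} {y} p → unit⇒# x y (proj₁ p) (proj₂ (proj₂ p))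
      }
    ; tight = λ x y → ¬#⇒≈ x y , λ x≈y x#y → #ᶜ-irrefl {x} {y} x≈y x#y
    }

abstract
  ℂ-isHeytingField : IsHeytingField _≈ᶜ_ _#ᶜ_ _+ᶜ_ _*ᶜ_ -ᶜ_ 0ᶜ 1ᶜ
  ℂ-isHeytingField = ℂ-isHeytingField′

ℂ-heytingField : HeytingField 0ℓ 0ℓ 0ℓ
ℂ-heytingField = record { isHeytingField = ℂ-isHeytingField }

ℂ-commutativeRing : CommutativeRing 0ℓ 0ℓ
ℂ-commutativeRing =
  HeytingCommutativeRing.commutativeRing (HeytingField.heytingCommutativeRing ℂ-heytingField)

infixr 8 _·ᶜ_

_·ᶜ_ : ℕ → ℂ → ℂ
_·ᶜ_ = RawMonoidDefs._×_ (RawRing.+-rawMonoid (CommutativeRing.rawRing ℂ-commutativeRing))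

private
  0≤re : ∀ n k → 0ℚ ≤ re (seq (n ·ᶜ 1ᶜ) k)
  0≤re zero    k = ℚₚ.≤-refl
  0≤re (suc n) k = +-nonneg (ℚₚ.<⇒≤ 0<1) (0≤re n k)

ℂ-characteristic-zero : ∀ n → (suc n ·ᶜ 1ᶜ) #ᶜ 0ᶜ
ℂ-characteristic-zero n = 1ℚ , 0<1 , 0 , λ k _ → bound k
  where
  bound : ∀ k → 1ℚ ≤ ‖ seq (suc n ·ᶜ 1ᶜ) k G.- G.0# ‖
  bound k = ℚₚ.≤-trans 1≤p (subst (λ u → p ≤ ∣ u ∣ ℚ.+ ∣ im (seq (suc n ·ᶜ 1ᶜ) k) ℚ.+ 0ℚ ∣) (sym (ℚₚ.+-identityʳ p))
              (subst (_≤ ∣ p ∣ ℚ.+ q) (trans (ℚₚ.+-identityʳ ∣ p ∣) (ℚₚ.0≤p⇒∣p∣≡p 0≤p))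
                (ℚₚ.+-monoʳ-≤ ∣ p ∣ (ℚₚ.0≤∣p∣ (im (seq (suc n ·ᶜ 1ᶜ) k) ℚ.+ 0ℚ)))))
    where
    p = re (seq (suc n ·ᶜ 1ᶜ) k)
    q = ∣ im (seq (suc n ·ᶜ 1ᶜ) k) ℚ.+ 0ℚ ∣
    1≤p : 1ℚ ≤ p
    1≤p = subst (_≤ p) (ℚₚ.+-identityʳ 1ℚ) (ℚₚ.+-monoʳ-≤ 1ℚ (0≤re n k))
    0≤p : 0ℚ ≤ p
    0≤p = ℚₚ.≤-trans (ℚₚ.<⇒≤ 0<1) 1≤p

module PowerSeries {c ℓ} (R : RawRing c ℓ) where
  open RawRing R
  open RawMonoidDefs +-rawMonoid renaming (_×_ to _·_) using ()

  Series : Set c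
  Series = ℕ → Carrier

  infix  4 _≈ˢ_
  infixl 6 _+ˢ_ _-ˢ_
  infixl 7 _*ˢ_
  infix  8 -ˢ_
  infixr 8 _^ˢ_
  infixl 9 _∘ˢ_

  _≈ˢ_ : Series → Series → Set ℓ
  f ≈ˢ g = ∀ n → f n ≈ g n

  -- ∑< n a = a 0 + … + a (n - 1)
  ∑< : ℕ → (ℕ → Carrier) → Carrier
  ∑< zero    a = 0#
  ∑< (suc n) a = ∑< n a + a n

  constˢ : Carrier → Series
  constˢ a zero    = a
  constˢ a (suc _) = 0#

  0ˢ 1ˢ t : Series
  0ˢ _ = 0#
  1ˢ = constˢ 1#
  t zero          = 0#
  t (suc zero)    = 1#
  t (suc (suc _)) = 0#

  _+ˢ_ _*ˢ_ : Series → Series → Series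
  (f +ˢ g) n = f n + g n
  (f *ˢ g) n = ∑< (suc n) (λ k → f k * g (n ℕ.∸ k))

  -ˢ_ : Series → Series
  (-ˢ f) n = - f n

  _-ˢ_ : Series → Series → Series
  f -ˢ g = f +ˢ (-ˢ g)

  _^ˢ_ : Series → ℕ → Series
  f ^ˢ zero  = 1ˢ
  f ^ˢ suc n = f *ˢ (f ^ˢ n)

  -- f(h(t)) for h with h(0) = 0: the powers hᵏ with k > n do not contribute to
  -- the coefficient of tⁿ, so the sum stops at k = n.  Every use below has an
  -- inner series without constant term.
  _∘ˢ_ : Series → Series → Series
  (f ∘ˢ h) n = ∑< (suc n) (λ k → f k * (h ^ˢ k) n)

  deriv : Series → Series
  deriv f n = suc n · f (suc n)

  dropConstant : Series → Series
  dropConstant f zero    = 0#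
  dropConstant f (suc n) = f (suc n)

  dropLinear : Series → Series
  dropLinear f zero          = 0#
  dropLinear f (suc zero)    = 0#
  dropLinear f (suc (suc n)) = f (suc (suc n))

-- R[X]: coefficient lists, lowest degree first, up to trailing zeros.
module Polynomial {c ℓ} (R : RawRing c ℓ) where
  open RawRing R
  open RawMonoidDefs +-rawMonoid renaming (_×_ to _·_) using ()

  Poly : Set c
  Poly = List Carrier

  coeff : Poly → ℕ → Carrier
  coeff []      _       = 0#
  coeff (a ∷ p) zero    = a
  coeff (a ∷ p) (suc n) = coeff p n

  _≈ᴾ_ : Poly → Poly → Set ℓ
  p ≈ᴾ q = ∀ n → coeff p n ≈ coeff q n

  _+ᴾ_ _*ᴾ_ : Poly → Poly → Poly
  []      +ᴾ q       = q
  (a ∷ p) +ᴾ []      = a ∷ p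
  (a ∷ p) +ᴾ (b ∷ q) = (a + b) ∷ (p +ᴾ q)
  []      *ᴾ q = []
  (a ∷ p) *ᴾ q = map (a *_) q +ᴾ (0# ∷ (p *ᴾ q))

  C : Carrier → Poly
  C a = a ∷ []

  X : Poly
  X = 0# ∷ 1# ∷ []

  scaleFrom : ℕ → Poly → Poly
  scaleFrom n []      = []
  scaleFrom n (a ∷ p) = (n · a) ∷ scaleFrom (suc n) p

  derivᴾ : Poly → Poly
  derivᴾ []      = []
  derivᴾ (_ ∷ p) = scaleFrom 1 p

  rawRing : RawRing c ℓ
  rawRing = record
    { Carrier = Poly ; _≈_ = _≈ᴾ_ ; _+_ = _+ᴾ_ ; _*_ = _*ᴾ_ ; -_ = map (-_) ; 0# = [] ; 1# = C 1# }

record CharacteristicZeroField c ℓ₁ ℓ₂ : Set (lsuc (c ⊔ ℓ₁ ⊔ ℓ₂)) where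
  field
    heytingField : HeytingField c ℓ₁ ℓ₂

  open HeytingField heytingField public
    using (heytingCommutativeRing; _#_; #-irrefl; #-cotrans; #⇒invertible; invertible⇒#)
  open HeytingCommutativeRing heytingCommutativeRing public using (commutativeRing)
  open CommutativeRing commutativeRing public
  open RawMonoidDefs (RawRing.+-rawMonoid rawRing) public using () renaming (_×_ to _·_)

  field
    characteristic-zero : ∀ n → (suc n · 1#) # 0#

ℂ-field : CharacteristicZeroField 0ℓ 0ℓ 0ℓ
ℂ-field = record { heytingField = ℂ-heytingField ; characteristic-zero = ℂ-characteristic-zero }

module Sheffer {c ℓ₁ ℓ₂} (K : CharacteristicZeroField c ℓ₁ ℓ₂) where

  private
    module K = CharacteristicZeroField K
    open K hiding (rawRing)

    #-resp-≈ : ∀ {a b} → a ≈ b → b # 0# → a # 0#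
    #-resp-≈ {a} {b} a≈b b#0 = go (#-cotrans b#0 a)
      where
      go : b # a ⊎ a # 0# → a # 0#
      go (inj₁ b#a) = ⊥-elim (#-irrefl (K.sym a≈b) b#a)
      go (inj₂ a#0) = a#0

    x-0≈x : ∀ x → x - 0# ≈ x
    x-0≈x x = K.trans (+-congˡ -0#≈0#) (+-identityʳ x)
      where open RingProperties ring using (-0#≈0#)

    unit⇒#0 : ∀ a b → b * a ≈ 1# → a # 0#
    unit⇒#0 a b ba≈1 = invertible⇒# (b , K.trans (*-congˡ (x-0≈x a)) ba≈1
                                       , K.trans (*-comm (a - 0#) b) (K.trans (*-congˡ (x-0≈x a)) ba≈1))

  open PowerSeries K.rawRing public

  inv : ∀ a → a # 0# → Carrier
  inv a a#0 = proj₁ (#⇒invertible a#0)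

  inv-inverse : ∀ a (a#0 : a # 0#) → a * inv a a#0 ≈ 1#
  inv-inverse a a#0 = K.trans (*-congʳ (K.sym (x-0≈x a))) (proj₂ (proj₂ (#⇒invertible a#0)))

  -- 1/(n+1) and 1/n!
  1/suc : ℕ → Carrier
  1/suc n = inv (suc n · 1#) (characteristic-zero n)

  1/fact : ℕ → Carrier
  1/fact zero    = 1#
  1/fact (suc n) = 1/suc n * 1/fact n

  -- f'(0) ≠ 0 (and g(0) ≠ 0 below) is rendered by apartness from 0, i.e. invertibility.
  record DeltaSeries : Set (c ⊔ ℓ₁ ⊔ ℓ₂) where
    field
      series   : Series
      constant : series 0 ≈ 0#
      derivAt0 : deriv series 0 # 0#

  record InvertibleSeries : Set (c ⊔ ℓ₂) where
    field
      series   : Series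
      constant : series 0 # 0#

  open DeltaSeries public using (series)
  open InvertibleSeries public using (series)

  private
    module Δ = DeltaSeries
    module I = InvertibleSeries

  -- With h = u + (terms of positive degree) and v = 1/u, the reciprocal is the
  -- fixed point of q ↦ v (1 - (h - u) q).  The m-th iterate from 0 is correct
  -- in degrees below m.
  reciprocalStep : InvertibleSeries → Series → Series
  reciprocalStep h q = constˢ (inv (series h 0) (I.constant h)) *ˢ (1ˢ -ˢ dropConstant (series h) *ˢ q)

  reciprocalApprox : InvertibleSeries → ℕ → Series
  reciprocalApprox h zero    = 0ˢ
  reciprocalApprox h (suc m) = reciprocalStep h (reciprocalApprox h m)

  reciprocal : InvertibleSeries → InvertibleSeries
  reciprocal h = record
    { series   = λ n → reciprocalApprox h (suc n) n
    ; constant = unit⇒#0 (0# + v * (1# - (0# + 0# * 0#))) u (begin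
        u * (0# + v * (1# - (0# + 0# * 0#)))  ≈⟨ *-congˡ (+-identityˡ _) ⟩
        u * (v * (1# - (0# + 0# * 0#)))       ≈⟨ *-congˡ (*-congˡ (+-congˡ (-‿cong (K.trans (+-identityˡ _) (zeroˡ 0#))))) ⟩
        u * (v * (1# - 0#))                   ≈⟨ *-congˡ (K.trans (*-congˡ (x-0≈x 1#)) (*-identityʳ v)) ⟩
        u * v                                 ≈⟨ inv-inverse u (I.constant h) ⟩
        1#                                    ∎)
    }
    where
    open SetoidReasoning setoid
    u = series h 0
    v = inv u (I.constant h)

  -- The compositional inverse is the fixed point of
  -- H ↦ (1/f'(0)) (t - (f₂ H² + f₃ H³ + …)).  The m-th iterate from 0 is correct
  -- in degrees up to m.
  inverseStep : DeltaSeries → Series → Series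
  inverseStep f H = constˢ (inv (deriv (series f) 0) (Δ.derivAt0 f)) *ˢ (t -ˢ dropLinear (series f) ∘ˢ H)

  inverseApprox : DeltaSeries → ℕ → Series
  inverseApprox f zero    = 0ˢ
  inverseApprox f (suc m) = inverseStep f (inverseApprox f m)

  infix 10 _⁻¹

  _⁻¹ : DeltaSeries → DeltaSeries
  f ⁻¹ = record
    { series   = λ n → inverseApprox f n n
    ; constant = K.refl
    ; derivAt0 = unit⇒#0 (h₁ + 0#) u (begin
        u * (h₁ + 0#)   ≈⟨ *-congˡ (+-identityʳ h₁) ⟩
        u * h₁          ≈⟨ *-congˡ h₁≈v ⟩
        u * v           ≈⟨ inv-inverse u (Δ.derivAt0 f) ⟩
        1#              ∎)
    }
    where
    open SetoidReasoning setoid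
    u  = deriv (series f) 0
    v  = inv u (Δ.derivAt0 f)
    h₁ = inverseApprox f 1 1
    tail₁ : (dropLinear (series f) ∘ˢ 0ˢ) 1 ≈ 0#
    tail₁ = K.trans (+-cong (K.trans (+-identityˡ _) (zeroˡ _)) (zeroˡ _)) (+-identityˡ 0#)
    h₁≈v : h₁ ≈ v
    h₁≈v = begin
      h₁                                                       ≈⟨ +-cong (+-identityˡ _) (zeroˡ _) ⟩
      v * (1# - (dropLinear (series f) ∘ˢ 0ˢ) 1) + 0#  ≈⟨ +-identityʳ _ ⟩
      v * (1# - (dropLinear (series f) ∘ˢ 0ˢ) 1)       ≈⟨ *-congˡ (+-congˡ (-‿cong tail₁)) ⟩
      v * (1# - 0#)                                            ≈⟨ K.trans (*-congˡ (x-0≈x 1#)) (*-identityʳ v) ⟩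
      v                                                        ∎

  deriv-delta : DeltaSeries → InvertibleSeries
  deriv-delta f = record { series = deriv (series f) ; constant = Δ.derivAt0 f }

  _∘ᴵ_ : InvertibleSeries → DeltaSeries → InvertibleSeries
  g ∘ᴵ h = record
    { series   = series g ∘ˢ series h
    ; constant = #-resp-≈ (K.trans (+-identityˡ _) (*-identityʳ (series g 0))) (I.constant g)
    }

  infixl 7 _/ˢ_
  _/ˢ_ : Series → InvertibleSeries → Series
  h /ˢ g = h *ˢ series (reciprocal g)

  private
    module Px = Polynomial K.rawRing
    module Py = Polynomial Px.rawRing
    module Pz = Polynomial Py.rawRing
    module P  = RawRing Pz.rawRing

  -- K[x][y][z]: the outermost lists are in powers of z, the innermost in powers of x.
  K[x,y,z] : Set c
  K[x,y,z] = Pz.Poly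

  infix 4 _≈ᵖ_
  infixl 6 _+ᵖ_
  infixl 7 _*ᵖ_
  infixr 8 _·ᵖ_

  _≈ᵖ_ : K[x,y,z] → K[x,y,z] → Set ℓ₁
  _≈ᵖ_ = P._≈_

  _+ᵖ_ _*ᵖ_ : K[x,y,z] → K[x,y,z] → K[x,y,z]
  _+ᵖ_ = P._+_
  _*ᵖ_ = P._*_

  -ᵖ_ : K[x,y,z] → K[x,y,z]
  -ᵖ_ = P.-_

  _·ᵖ_ : ℕ → K[x,y,z] → K[x,y,z]
  _·ᵖ_ = RawMonoidDefs._×_ P.+-rawMonoid

  constᵖ : Carrier → K[x,y,z]
  constᵖ a = Pz.C (Py.C (Px.C a))

  0ᵖ 1ᵖ x y z : K[x,y,z]
  0ᵖ = P.0#
  1ᵖ = P.1#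
  x = Pz.C (Py.C Px.X)
  y = Pz.C Py.X
  z = Pz.X

  private
    module Sᵖ = PowerSeries Pz.rawRing

  liftˢ : Series → Sᵖ.Series
  liftˢ φ n = constᵖ (φ n)

  [-1]^_ : ℕ → Carrier
  [-1]^ zero  = 1#
  [-1]^ suc k = - ([-1]^ k)

  -- C₀(w) = ∑ (-1)ᵏ wᵏ / (k!)²
  C₀ : Series
  C₀ k = [-1]^ k * (1/fact k * 1/fact k)

  expˢ : Series
  expˢ = 1/fact

  -- (1/g(H(t))) C₀(-x H(t)²) exp(y H(t) + z H(t)ʳ) with H = f⁻¹, in K[x,y,z][[t]].
  generatingFunction : DeltaSeries → InvertibleSeries → ℕ → Sᵖ.Series
  generatingFunction f g r =
    liftˢ (series (reciprocal (g ∘ᴵ (f ⁻¹))))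
      Sᵖ.*ˢ (liftˢ C₀ Sᵖ.∘ˢ (Sᵖ.-ˢ (Sᵖ.constˢ x Sᵖ.*ˢ H Sᵖ.^ˢ 2)))
      Sᵖ.*ˢ (liftˢ expˢ Sᵖ.∘ˢ (Sᵖ.constˢ y Sᵖ.*ˢ H Sᵖ.+ˢ Sᵖ.constˢ z Sᵖ.*ˢ H Sᵖ.^ˢ r))
    where
    H : Sᵖ.Series
    H = liftˢ (series (f ⁻¹))

  -- ∑ sₙ(x,y,z) tⁿ/n!
  exponentialSeries : (ℕ → K[x,y,z]) → Sᵖ.Series
  exponentialSeries s n = constᵖ (1/fact n) *ᵖ s n

  -- s is the sequence of Legendre–Gould–Hopper based Sheffer polynomials.
  IsLegendreGouldHopperSheffer : DeltaSeries → InvertibleSeries → ℕ → (ℕ → K[x,y,z]) → Set ℓ₁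
  IsLegendreGouldHopperSheffer f g r s = generatingFunction f g r Sᵖ.≈ˢ exponentialSeries s

  Operator : Set c
  Operator = K[x,y,z] → K[x,y,z]

  infixl 6 _⊕_ _⊖_
  infixr 7 _•_
  infixr 8 _^ᵒ_

  _⊕_ _⊖_ : Operator → Operator → Operator
  (S ⊕ T) p = S p +ᵖ T p
  (S ⊖ T) p = S p +ᵖ (-ᵖ T p)

  _•_ : ℕ → Operator → Operator
  (n • T) p = n ·ᵖ T p

  _^ᵒ_ : Operator → ℕ → Operator
  (T ^ᵒ zero)  p = p
  (T ^ᵒ suc n) p = T ((T ^ᵒ n) p)

  multiplyBy : K[x,y,z] → Operator
  multiplyBy q p = q *ᵖ p

  ∂y : Operator
  ∂y = map Py.derivᴾ

  divideFrom : ℕ → List Carrier → List Carrier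
  divideFrom n []      = []
  divideFrom n (a ∷ p) = (1/suc n * a) ∷ divideFrom (suc n) p

  integrate : List Carrier → List Carrier
  integrate p = 0# ∷ divideFrom 0 p

  Dx⁻¹ : Operator
  Dx⁻¹ = map (map integrate)

  -- φ(∂y) p = ∑ φₖ ∂yᵏ p, where ∂yᵏ p vanishes once k reaches the length of every
  -- coefficient list in y.
  _⟨∂y⟩ : Series → Operator
  (φ ⟨∂y⟩) p = Sᵖ.∑< (foldr ℕ._⊔_ 0 (map length p)) (λ k → constᵖ (φ k) *ᵖ (∂y ^ᵒ k) p)

open Sheffer ℂ-field public renaming (K[x,y,z] to ℂ[x,y,z])

{-# OPTIONS --safe #-}

-- Write H = f⁻¹ and A = 1/(g ∘ H).  In the generating function the coefficient of xⁱyʲzᵏ is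
-- A Hᑫ / (i!² j! k!) with q = 2i + j + rk, so everything can be read off from the one-variable
-- series A Hᑫ.  On these coefficients φ(∂y) multiplies by φ(H), while
-- M = y + 2 Dx⁻¹ ∂y + r z ∂yʳ⁻¹ replaces Hᑫ by q Hᑫ⁻¹, its three terms contributing j, 2i and rk
-- to the factor q.  Since 1/f′(H) = H′ = H′(H⁻¹(H)) and A′ = -(g′/g)(H) H′ A, both operators turn
-- A Hᑫ into A (Hᑫ)′ + A′ Hᑫ = (A Hᑫ)′; taking the coefficient of tⁿ, they send the n-th
-- polynomial to the (n+1)-st.

module Submission where

open import Algebra.Bundles using (CommutativeRing; RawRing)
import Algebra.Definitions.RawMonoid as RawMonoidDefs
open import Algebra.Morphism.Structures using (module RingMorphisms)
import Algebra.Properties.CommutativeMonoid.Mult as CommutativeMult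
import Algebra.Properties.Ring as RingProperties
import Algebra.Properties.Semiring.Mult as Mult
import Algebra.Solver.Ring.NaturalCoefficients.Default as Solver
open import Data.Empty using (⊥-elim)
open import Data.List.Base using ([]; _∷_; map; foldr; length)
open import Data.Nat.Base as ℕ using (ℕ; zero; suc; _<_; _≤_; _∸_; z≤n; s≤s)
import Data.Nat.Properties as ℕₚ
open import Data.Nat.Solver using (module +-*-Solver)
open import Data.Product.Base using (_×_; _,_)
open import Data.Sum.Base using (inj₁; inj₂)
open import Defs using (module PowerSeries; module Polynomial; module Sheffer; CharacteristicZeroField)
open import Function.Base using (_∘_)
open import Relation.Binary.PropositionalEquality as ≡ using (_≡_; _≢_)
import Relation.Binary.Reasoning.Setoid as SetoidReasoning
open import Relation.Nullary using (yes; no)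

-- Polynomials are given as coefficient lists that only form a raw ring. Their ring laws are never
-- proved: taking coefficients is a homomorphism into K[[x]][[y]][[z]], and equality of polynomials
-- is by definition equality of coefficients, so all computations move there without loss. The
-- series ring is therefore built over an arbitrary commutative ring and used at four levels, for x,
-- y, z and t. Identities between series rest on f = f(0) + t · `tail f`, which turns products and
-- composites into recursions. Multiplication by a series without constant term gains one degree of
-- agreement, so such identities follow by induction on the degree; a similar gain makes the
-- iterations for reciprocals and compositional inverses converge. A polynomial of the sequence is a
-- single coefficient in t. Differentiation reads the coefficient of index n + 1 at index n, which
-- is why an operator that differentiates the generating series advances n by one.

-- The commutative ring of formal power series.

module SeriesRing {c ℓ} (R : CommutativeRing c ℓ) where
  open CommutativeRing R hiding (zero)
  open PowerSeries rawRing
  open SetoidReasoning setoid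
  private
    module S = Solver commutativeSemiring

  ∑-cong : ∀ n {a b : ℕ → Carrier} → (∀ k → k < n → a k ≈ b k) → ∑< n a ≈ ∑< n b
  ∑-cong zero    e = refl
  ∑-cong (suc n) e = +-cong (∑-cong n (λ k k<n → e k (ℕₚ.m<n⇒m<1+n k<n))) (e n ℕₚ.≤-refl)

  ∑-zero : ∀ n {a : ℕ → Carrier} → (∀ k → k < n → a k ≈ 0#) → ∑< n a ≈ 0#
  ∑-zero zero    e = refl
  ∑-zero (suc n) e = trans (+-cong (∑-zero n (λ k k<n → e k (ℕₚ.m<n⇒m<1+n k<n))) (e n ℕₚ.≤-refl)) (+-identityˡ 0#)

  ∑-suc : ∀ n (a : ℕ → Carrier) → ∑< (suc n) a ≈ a 0 + ∑< n (a ∘ suc)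
  ∑-suc zero    a = +-comm 0# (a 0)
  ∑-suc (suc n) a = trans (+-congʳ (∑-suc n a)) (+-assoc _ _ _)

  *-∑ : ∀ n x (a : ℕ → Carrier) → x * ∑< n a ≈ ∑< n (λ k → x * a k)
  *-∑ zero    x a = zeroʳ x
  *-∑ (suc n) x a = trans (distribˡ x _ _) (+-congʳ (*-∑ n x a))

  ∑-truncate : ∀ m d {a : ℕ → Carrier} → (∀ k → m ≤ k → a k ≈ 0#) → ∑< (d ℕ.+ m) a ≈ ∑< m a
  ∑-truncate m zero    e = refl
  ∑-truncate m (suc d) e = trans (+-cong (∑-truncate m d e) (e _ (ℕₚ.m≤n+m m d))) (+-identityʳ _)

  -- Both sums extend to `m + n` terms without change. This trades the cutoff of φ(∂y), a length of
  -- lists, for the cutoff given by the degree in t.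
  ∑-supports : ∀ m n {a : ℕ → Carrier} → (∀ k → m ≤ k → a k ≈ 0#) → (∀ k → n ≤ k → a k ≈ 0#) →
               ∑< m a ≈ ∑< n a
  ∑-supports m n {a} e e′ = begin
    ∑< m a           ≈⟨ ∑-truncate m n e ⟨
    ∑< (n ℕ.+ m) a   ≡⟨ ≡.cong (λ k → ∑< k a) (ℕₚ.+-comm n m) ⟩
    ∑< (m ℕ.+ n) a   ≈⟨ ∑-truncate n m e′ ⟩
    ∑< n a           ∎

  -- The sums to be collapsed end at the degree in t, while `i` comes from a monomial and may lie
  -- outside the range; the last hypothesis covers that case.
  ∑-single : ∀ n i {a : ℕ → Carrier} → (∀ k → k ≢ i → a k ≈ 0#) → (n ≤ i → a i ≈ 0#) → ∑< n a ≈ a i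
  ∑-single zero    i e e′ = sym (e′ z≤n)
  ∑-single (suc n) i e e′ with n ℕₚ.≟ i
  ... | yes ≡.refl = trans (+-congʳ (∑-zero n (λ k k<n → e k (ℕₚ.<⇒≢ k<n)))) (+-identityˡ _)
  ... | no n≢i     = trans (+-cong (∑-single n i e (λ n≤i → e′ (ℕₚ.≤∧≢⇒< n≤i n≢i))) (e n n≢i)) (+-identityʳ _)

  tail : Series → Series
  tail f n = f (suc n)

  tail-t : tail t ≈ˢ 1ˢ
  tail-t zero    = refl
  tail-t (suc _) = refl

  const-0 : constˢ 0# ≈ˢ 0ˢ
  const-0 zero    = refl
  const-0 (suc _) = refl

  const-cong : ∀ {a b} → a ≈ b → constˢ a ≈ˢ constˢ b
  const-cong e zero    = e
  const-cong e (suc _) = refl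

  infixl 7 _⊗_

  -- Opaque, so that unification never unfolds a product into its sum.
  opaque
    _⊗_ : Series → Series → Series
    _⊗_ = _*ˢ_

    ⊗-def : ∀ f g n → (f *ˢ g) n ≈ (f ⊗ g) n
    ⊗-def f g n = refl

    ⊗-zero : ∀ f g → (f ⊗ g) 0 ≈ f 0 * g 0
    ⊗-zero f g = +-identityˡ _

    -- Writing f as f(0) + t · `tail f` makes the Cauchy product a recursion in the degree.
    -- Distributivity and associativity are inductions through it; commutativity also needs the
    -- mirror image `⊗-sucʳ`.
    ⊗-sucˡ : ∀ f g n → (f ⊗ g) (suc n) ≈ f 0 * g (suc n) + (tail f ⊗ g) n
    ⊗-sucˡ f g n = ∑-suc (suc n) _

    ⊗-sucʳ : ∀ f g n → (f ⊗ g) (suc n) ≈ (f ⊗ tail g) n + f (suc n) * g 0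
    ⊗-sucʳ f g n = +-cong
      (∑-cong (suc n) λ { k (s≤s k≤n) → *-congˡ (reflexive (≡.cong g (ℕₚ.+-∸-assoc 1 k≤n))) })
      (*-congˡ (reflexive (≡.cong g (ℕₚ.n∸n≡0 (suc n)))))

    ⊗-terms : ∀ {f f′ g g′} n → (∀ p → p ≤ n → f p * g (n ℕ.∸ p) ≈ f′ p * g′ (n ℕ.∸ p)) →
              (f ⊗ g) n ≈ (f′ ⊗ g′) n
    ⊗-terms n e = ∑-cong (suc n) λ { p (s≤s p≤n) → e p p≤n }

  infix 4 _≈[_]_
  -- Congruence modulo tⁿ, the relation carried through the inductions on the degree and the
  -- fixed-point arguments.
  _≈[_]_ : Series → ℕ → Series → Set ℓ
  f ≈[ n ] g = ∀ m → m < n → f m ≈ g m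

  ⊗-cong[] : ∀ n {f f′ g g′} → f ≈[ n ] f′ → g ≈[ n ] g′ → f ⊗ g ≈[ n ] f′ ⊗ g′
  ⊗-cong[] n e e′ m m<n = ⊗-terms m λ p p≤m →
    *-cong (e p (ℕₚ.≤-<-trans p≤m m<n)) (e′ _ (ℕₚ.≤-<-trans (ℕₚ.m∸n≤m m p) m<n))

  ⊗-cong : ∀ {f f′ g g′} → f ≈ˢ f′ → g ≈ˢ g′ → f ⊗ g ≈ˢ f′ ⊗ g′
  ⊗-cong e e′ n = ⊗-terms n λ p _ → *-cong (e p) (e′ _)

  ⊗-comm : ∀ f g → f ⊗ g ≈ˢ g ⊗ f
  ⊗-comm f g zero    = trans (⊗-zero f g) (trans (*-comm _ _) (sym (⊗-zero g f)))
  ⊗-comm f g (suc n) = begin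
    (f ⊗ g) (suc n)                       ≈⟨ ⊗-sucˡ f g n ⟩
    f 0 * g (suc n) + (tail f ⊗ g) n      ≈⟨ +-cong (*-comm _ _) (⊗-comm (tail f) g n) ⟩
    g (suc n) * f 0 + (g ⊗ tail f) n      ≈⟨ +-comm _ _ ⟩
    (g ⊗ tail f) n + g (suc n) * f 0      ≈⟨ ⊗-sucʳ g f n ⟨
    (g ⊗ f) (suc n)                       ∎

  ⊗-zeroˡ : ∀ f → 0ˢ ⊗ f ≈ˢ 0ˢ
  ⊗-zeroˡ f zero    = trans (⊗-zero 0ˢ f) (zeroˡ _)
  ⊗-zeroˡ f (suc n) = trans (⊗-sucˡ 0ˢ f n) (trans (+-cong (zeroˡ _) (⊗-zeroˡ f n)) (+-identityˡ 0#))

  const-⊗ : ∀ a f n → (constˢ a ⊗ f) n ≈ a * f n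
  const-⊗ a f zero    = ⊗-zero (constˢ a) f
  const-⊗ a f (suc n) = trans (⊗-sucˡ (constˢ a) f n) (trans (+-congˡ (⊗-zeroˡ f n)) (+-identityʳ _))

  t-⊗-suc : ∀ f n → (t ⊗ f) (suc n) ≈ f n
  t-⊗-suc f n = begin
    (t ⊗ f) (suc n)                      ≈⟨ ⊗-sucˡ t f n ⟩
    0# * f (suc n) + (tail t ⊗ f) n      ≈⟨ +-cong (zeroˡ _) (⊗-cong {g = f} tail-t (λ _ → refl) n) ⟩
    0# + (1ˢ ⊗ f) n                      ≈⟨ +-identityˡ _ ⟩
    (1ˢ ⊗ f) n                           ≈⟨ const-⊗ 1# f n ⟩
    1# * f n                             ≈⟨ *-identityˡ _ ⟩
    f n                                  ∎

  t-⊗-zero : ∀ f → (t ⊗ f) 0 ≈ 0#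
  t-⊗-zero f = trans (⊗-zero t f) (zeroˡ _)

  ⊗-distribʳ : ∀ h f g → (f +ˢ g) ⊗ h ≈ˢ f ⊗ h +ˢ g ⊗ h
  ⊗-distribʳ h f g zero    = trans (⊗-zero _ h) (trans (distribʳ _ _ _) (sym (+-cong (⊗-zero f h) (⊗-zero g h))))
  ⊗-distribʳ h f g (suc n) = begin
    ((f +ˢ g) ⊗ h) (suc n)                                 ≈⟨ ⊗-sucˡ (f +ˢ g) h n ⟩
    (f 0 + g 0) * h (suc n) + ((tail f +ˢ tail g) ⊗ h) n   ≈⟨ +-congˡ (⊗-distribʳ h (tail f) (tail g) n) ⟩
    (f 0 + g 0) * h (suc n) + ((tail f ⊗ h) n + (tail g ⊗ h) n)
      ≈⟨ S.solve 5 (λ a b h u v → ((a S.:+ b) S.:* h S.:+ (u S.:+ v)) S.:= (a S.:* h S.:+ u) S.:+ (b S.:* h S.:+ v)) refl (f 0) (g 0) (h (suc n)) _ _ ⟩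
    (f 0 * h (suc n) + (tail f ⊗ h) n) + (g 0 * h (suc n) + (tail g ⊗ h) n)  ≈⟨ +-cong (⊗-sucˡ f h n) (⊗-sucˡ g h n) ⟨
    (f ⊗ h) (suc n) + (g ⊗ h) (suc n)                      ∎

  scale-⊗ : ∀ a f g n → ((λ m → a * f m) ⊗ g) n ≈ a * (f ⊗ g) n
  scale-⊗ a f g zero    = trans (⊗-zero _ g) (trans (*-assoc _ _ _) (*-congˡ (sym (⊗-zero f g))))
  scale-⊗ a f g (suc n) = begin
    ((λ m → a * f m) ⊗ g) (suc n)                            ≈⟨ ⊗-sucˡ (λ m → a * f m) g n ⟩
    a * f 0 * g (suc n) + ((λ m → a * f (suc m)) ⊗ g) n      ≈⟨ +-cong (*-assoc _ _ _) (scale-⊗ a (tail f) g n) ⟩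
    a * (f 0 * g (suc n)) + a * (tail f ⊗ g) n               ≈⟨ distribˡ _ _ _ ⟨
    a * (f 0 * g (suc n) + (tail f ⊗ g) n)                   ≈⟨ *-congˡ (⊗-sucˡ f g n) ⟨
    a * (f ⊗ g) (suc n)                                      ∎

  tail-⊗ : ∀ f g → tail (f ⊗ g) ≈ˢ (λ n → f 0 * tail g n) +ˢ tail f ⊗ g
  tail-⊗ f g n = ⊗-sucˡ f g n

  ⊗-assoc : ∀ f g h → (f ⊗ g) ⊗ h ≈ˢ f ⊗ (g ⊗ h)
  ⊗-assoc f g h zero    = begin
    ((f ⊗ g) ⊗ h) 0       ≈⟨ ⊗-zero (f ⊗ g) h ⟩
    (f ⊗ g) 0 * h 0       ≈⟨ *-congʳ (⊗-zero f g) ⟩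
    f 0 * g 0 * h 0       ≈⟨ *-assoc _ _ _ ⟩
    f 0 * (g 0 * h 0)     ≈⟨ *-congˡ (⊗-zero g h) ⟨
    f 0 * (g ⊗ h) 0       ≈⟨ ⊗-zero f (g ⊗ h) ⟨
    (f ⊗ (g ⊗ h)) 0       ∎
  ⊗-assoc f g h (suc n) = begin
    ((f ⊗ g) ⊗ h) (suc n)
      ≈⟨ ⊗-sucˡ (f ⊗ g) h n ⟩
    (f ⊗ g) 0 * h (suc n) + (tail (f ⊗ g) ⊗ h) n
      ≈⟨ +-cong (*-congʳ (⊗-zero f g)) (⊗-cong {g = h} (tail-⊗ f g) (λ _ → refl) n) ⟩
    f 0 * g 0 * h (suc n) + (((λ m → f 0 * tail g m) +ˢ tail f ⊗ g) ⊗ h) n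
      ≈⟨ +-congˡ (⊗-distribʳ h (λ m → f 0 * tail g m) (tail f ⊗ g) n) ⟩
    f 0 * g 0 * h (suc n) + (((λ m → f 0 * tail g m) ⊗ h) n + ((tail f ⊗ g) ⊗ h) n)
      ≈⟨ +-congˡ (+-cong (scale-⊗ (f 0) (tail g) h n) (⊗-assoc (tail f) g h n)) ⟩
    f 0 * g 0 * h (suc n) + (f 0 * (tail g ⊗ h) n + (tail f ⊗ (g ⊗ h)) n)
      ≈⟨ S.solve 5 (λ f g h u v → f S.:* g S.:* h S.:+ (f S.:* u S.:+ v) S.:= f S.:* (g S.:* h S.:+ u) S.:+ v) refl (f 0) (g 0) (h (suc n)) _ _ ⟩
    f 0 * (g 0 * h (suc n) + (tail g ⊗ h) n) + (tail f ⊗ (g ⊗ h)) n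
      ≈⟨ +-congʳ (*-congˡ (⊗-sucˡ g h n)) ⟨
    f 0 * (g ⊗ h) (suc n) + (tail f ⊗ (g ⊗ h)) n
      ≈⟨ ⊗-sucˡ f (g ⊗ h) n ⟨
    (f ⊗ (g ⊗ h)) (suc n)  ∎

  ⊗-identityˡ : ∀ f → 1ˢ ⊗ f ≈ˢ f
  ⊗-identityˡ f n = trans (const-⊗ 1# f n) (*-identityˡ _)

  seriesRing : CommutativeRing c ℓ
  seriesRing = record
    { Carrier = Series ; _≈_ = _≈ˢ_ ; _+_ = _+ˢ_ ; _*_ = _⊗_ ; -_ = -ˢ_ ; 0# = 0ˢ ; 1# = 1ˢ
    ; isCommutativeRing = record
      { isRing = record
        { +-isAbelianGroup = record
          { isGroup = record
            { isMonoid = record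
              { isSemigroup = record
                { isMagma = record
                  { isEquivalence = record
                    { refl = λ _ → refl ; sym = λ e n → sym (e n) ; trans = λ e e′ n → trans (e n) (e′ n) }
                  ; ∙-cong = λ e e′ n → +-cong (e n) (e′ n)
                  }
                ; assoc = λ f g h n → +-assoc (f n) (g n) (h n)
                }
              ; identity = (λ f n → +-identityˡ (f n)) , (λ f n → +-identityʳ (f n))
              }
            ; inverse = (λ f n → -‿inverseˡ (f n)) , (λ f n → -‿inverseʳ (f n))
            ; ⁻¹-cong = λ e n → -‿cong (e n)
            }
          ; comm = λ f g n → +-comm (f n) (g n)
          }
        ; *-cong = ⊗-cong
        ; *-assoc = ⊗-assoc
        ; *-identity = ⊗-identityˡ , λ f n → trans (⊗-comm f 1ˢ n) (⊗-identityˡ f n)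
        ; distrib = (λ h f g n → trans (⊗-comm h (f +ˢ g) n) (trans (⊗-distribʳ h f g n)
                      (+-cong (⊗-comm f h n) (⊗-comm g h n))))
                  , ⊗-distribʳ
        }
      ; *-comm = ⊗-comm
      }
    }

-- Powers, derivatives and composites of power series.

module SeriesCalculus {c ℓ} (R : CommutativeRing c ℓ) where
  open CommutativeRing R hiding (zero)
  open PowerSeries rawRing
  open SeriesRing R
  open Mult semiring using () renaming (_×_ to _·_; ×-congʳ to ·-congʳ; ×-comm-* to ·-comm-*; ×-assoc-* to ·-assoc-*)
  open CommutativeMult +-commutativeMonoid using () renaming (×-distrib-+ to ·-distrib-+)
  open SetoidReasoning setoid
  private
    module 𝕊 = CommutativeRing seriesRing
    module S = Solver commutativeSemiring

  infixr 8 _^_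
  _^_ : Series → ℕ → Series
  f ^ zero  = 1ˢ
  f ^ suc n = f ⊗ f ^ n

  ^-def : ∀ f n → f ^ˢ n ≈ˢ f ^ n
  ^-def f zero    m = refl
  ^-def f (suc n) m = trans (⊗-def f (f ^ˢ n) m) (⊗-cong {f = f} (λ _ → refl) (^-def f n) m)

  ^-homo-+ : ∀ f m n → f ^ (m ℕ.+ n) ≈ˢ f ^ m ⊗ f ^ n
  ^-homo-+ f zero    n = 𝕊.sym (𝕊.*-identityˡ (f ^ n))
  ^-homo-+ f (suc m) n = 𝕊.trans (𝕊.*-congˡ (^-homo-+ f m n)) (𝕊.sym (𝕊.*-assoc f (f ^ m) (f ^ n)))

  -- The only coefficient of the second factor of as high a degree as the coefficient being computed
  -- is multiplied by `h 0`, which vanishes.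
  ⊗-raise : ∀ h {f g} n → h 0 ≈ 0# → f ≈[ n ] g → h ⊗ f ≈[ suc n ] h ⊗ g
  ⊗-raise h {f} {g} n h0 e zero _ = begin
    (h ⊗ f) 0    ≈⟨ ⊗-zero h f ⟩
    h 0 * f 0    ≈⟨ trans (*-congʳ h0) (zeroˡ _) ⟩
    0#           ≈⟨ trans (*-congʳ h0) (zeroˡ _) ⟨
    h 0 * g 0    ≈⟨ ⊗-zero h g ⟨
    (h ⊗ g) 0    ∎
  ⊗-raise h {f} {g} n h0 e (suc m) (s≤s m<n) = begin
    (h ⊗ f) (suc m)                      ≈⟨ ⊗-sucˡ h f m ⟩
    h 0 * f (suc m) + (tail h ⊗ f) m     ≈⟨ +-cong (trans (*-congʳ h0) (zeroˡ _)) (⊗-cong[] n (λ _ _ → refl) e m m<n) ⟩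
    0# + (tail h ⊗ g) m                  ≈⟨ +-congʳ (trans (*-congʳ h0) (zeroˡ _)) ⟨
    h 0 * g (suc m) + (tail h ⊗ g) m     ≈⟨ ⊗-sucˡ h g m ⟨
    (h ⊗ g) (suc m)                      ∎

  ^-vanishes : ∀ h → h 0 ≈ 0# → ∀ k → h ^ k ≈[ k ] 0ˢ
  ^-vanishes h h0 zero    m ()
  ^-vanishes h h0 (suc k) m m<k = trans (⊗-raise h k h0 (^-vanishes h h0 k) m m<k) (𝕊.zeroʳ h m)

  ⊗^-vanishes : ∀ f h → h 0 ≈ 0# → ∀ k → f ⊗ h ^ k ≈[ k ] 0ˢ
  ⊗^-vanishes f h h0 k m m<k = trans (⊗-cong[] k {f = f} (λ _ _ → refl) (^-vanishes h h0 k) m m<k) (𝕊.zeroʳ f m)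

  ⊗-∑ : ∀ h N (a : ℕ → Carrier) (p : ℕ → Series) →
        h ⊗ (λ n → ∑< N (λ k → a k * p k n)) ≈ˢ λ n → ∑< N (λ k → a k * (h ⊗ p k) n)
  ⊗-∑ h zero    a p = 𝕊.zeroʳ h
  ⊗-∑ h (suc N) a p n = begin
    (h ⊗ ((λ m → ∑< N (λ k → a k * p k m)) +ˢ (λ m → a N * p N m))) n
      ≈⟨ 𝕊.distribˡ h _ _ n ⟩
    (h ⊗ (λ m → ∑< N (λ k → a k * p k m))) n + (h ⊗ (λ m → a N * p N m)) n
      ≈⟨ +-cong (⊗-∑ h N a p n) (trans (⊗-comm h _ n) (trans (scale-⊗ (a N) (p N) h n) (*-congˡ (⊗-comm (p N) h n)))) ⟩
    ∑< (suc N) (λ k → a k * (h ⊗ p k) n)  ∎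

  private
    -- The Euler operator t d/dt preserves degrees, so its Leibniz rule fits the recursion `⊗-sucˡ`;
    -- the rule for `deriv` is read off from it in degree n + 1.
    θ : Series → Series
    θ f n = n · f n

    θ-⊗ : ∀ f g → θ (f ⊗ g) ≈ˢ θ f ⊗ g +ˢ f ⊗ θ g
    θ-⊗ f g zero    = sym (begin
      (θ f ⊗ g) 0 + (f ⊗ θ g) 0   ≈⟨ +-cong (trans (⊗-zero (θ f) g) (zeroˡ _)) (trans (⊗-zero f (θ g)) (zeroʳ _)) ⟩
      0# + 0#                     ≈⟨ +-identityˡ 0# ⟩
      0#                          ∎)
    θ-⊗ f g (suc n) = begin
      suc n · (f ⊗ g) (suc n)
        ≈⟨ ·-congʳ (suc n) (⊗-sucˡ f g n) ⟩
      suc n · (f 0 * g (suc n) + (tail f ⊗ g) n)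
        ≈⟨ ·-distrib-+ _ _ (suc n) ⟩
      suc n · (f 0 * g (suc n)) + ((tail f ⊗ g) n + n · (tail f ⊗ g) n)
        ≈⟨ +-cong (sym (·-comm-* (suc n) _ _)) (+-congˡ (θ-⊗ (tail f) g n)) ⟩
      f 0 * θ g (suc n) + ((tail f ⊗ g) n + ((θ (tail f) ⊗ g) n + (tail f ⊗ θ g) n))
        ≈⟨ S.solve 4 (λ x a b c → x S.:+ (a S.:+ (b S.:+ c)) S.:= (a S.:+ b) S.:+ (x S.:+ c)) refl _ _ _ _ ⟩
      ((tail f ⊗ g) n + (θ (tail f) ⊗ g) n) + (f 0 * θ g (suc n) + (tail f ⊗ θ g) n)
        -- By definition of multiples, `tail (θ f)` is `tail f +ˢ θ (tail f)`.
        ≈⟨ +-cong (⊗-distribʳ g (tail f) (θ (tail f)) n) (⊗-sucˡ f (θ g) n) ⟨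
      (tail (θ f) ⊗ g) n + (f ⊗ θ g) (suc n)
        ≈⟨ +-congʳ (trans (⊗-sucˡ (θ f) g n) (trans (+-congʳ (zeroˡ _)) (+-identityˡ _))) ⟨
      (θ f ⊗ g) (suc n) + (f ⊗ θ g) (suc n)  ∎

  deriv-cong : ∀ {f g} → f ≈ˢ g → deriv f ≈ˢ deriv g
  deriv-cong e n = ·-congʳ (suc n) (e (suc n))

  deriv-+ : ∀ f g → deriv (f +ˢ g) ≈ˢ deriv f +ˢ deriv g
  deriv-+ f g n = ·-distrib-+ _ _ (suc n)

  deriv-const : ∀ a → deriv (constˢ a) ≈ˢ 0ˢ
  deriv-const a n = trans (sym (*-identityʳ _)) (trans (·-assoc-* (suc n) 0# 1#) (trans (sym (·-comm-* (suc n) 0# 1#)) (zeroˡ _)))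

  deriv-⊗ : ∀ f g → deriv (f ⊗ g) ≈ˢ deriv f ⊗ g +ˢ f ⊗ deriv g
  deriv-⊗ f g n = trans (θ-⊗ f g (suc n)) (+-cong
    (trans (⊗-sucˡ (θ f) g n) (trans (+-congʳ (zeroˡ _)) (+-identityˡ _)))
    (trans (⊗-sucʳ f (θ g) n) (trans (+-congˡ (zeroʳ _)) (+-identityʳ _))))

  ⊗-· : ∀ k f g → f ⊗ (λ m → k · g m) ≈ˢ λ m → k · (f ⊗ g) m
  ⊗-· zero    f g = 𝕊.zeroʳ f
  ⊗-· (suc k) f g = 𝕊.trans (𝕊.distribˡ f g (λ m → k · g m)) (𝕊.+-congˡ (⊗-· k f g))

  -- The derivative of the q-th power map at `f`. The factor `deriv f` is left out to match `M`,
  -- which yields q Hᑫ⁻¹ while H′ is supplied by another operator.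
  power′ : Series → ℕ → Series
  power′ f zero    = 0ˢ
  power′ f (suc q) n = suc q · (f ^ q) n

  deriv-^ : ∀ f q → deriv (f ^ q) ≈ˢ power′ f q ⊗ deriv f
  deriv-^ f zero    = 𝕊.trans (deriv-const 1#) (𝕊.sym (𝕊.zeroˡ (deriv f)))
  deriv-^ f (suc q) n = begin
    deriv (f ⊗ f ^ q) n                                  ≈⟨ deriv-⊗ f (f ^ q) n ⟩
    (deriv f ⊗ f ^ q) n + (f ⊗ deriv (f ^ q)) n          ≈⟨ +-cong (𝕊.*-comm (deriv f) (f ^ q) n) (lower q n) ⟩
    (f ^ q ⊗ deriv f) n + ((λ m → q · (f ^ q) m) ⊗ deriv f) n  ≈⟨ ⊗-distribʳ (deriv f) (f ^ q) (λ m → q · (f ^ q) m) n ⟨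
    (power′ f (suc q) ⊗ deriv f) n                       ∎
    where
    lower : ∀ q → f ⊗ deriv (f ^ q) ≈ˢ (λ m → q · (f ^ q) m) ⊗ deriv f
    lower zero    = 𝕊.trans (𝕊.*-congˡ (deriv-^ f zero)) (𝕊.trans (𝕊.*-congˡ (𝕊.zeroˡ (deriv f)))
                      (𝕊.trans (𝕊.zeroʳ f) (𝕊.sym (𝕊.zeroˡ (deriv f)))))
    lower (suc q) = 𝕊.trans (𝕊.*-congˡ (deriv-^ f (suc q)))
      (𝕊.trans (𝕊.sym (𝕊.*-assoc f (power′ f (suc q)) (deriv f))) (𝕊.*-congʳ (⊗-· (suc q) f (f ^ q))))

  private
    -- Partial sums of f(h) in nested form: they satisfy a recursion in `tail f` that the sum over
    -- powers hides.
    horner : ℕ → Series → Series → Series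
    horner zero    f h = 0ˢ
    horner (suc N) f h = constˢ (f 0) +ˢ h ⊗ horner N (tail f) h

    horner-∑ : ∀ N f h n → ∑< N (λ k → f k * (h ^ k) n) ≈ horner N f h n
    horner-∑ zero    f h n = refl
    horner-∑ (suc N) f h n = begin
      ∑< (suc N) (λ k → f k * (h ^ k) n)
        ≈⟨ ∑-suc N _ ⟩
      f 0 * 1ˢ n + ∑< N (λ k → f (suc k) * (h ⊗ h ^ k) n)
        ≈⟨ +-cong (*-1ˢ n) (⊗-∑ h N (tail f) (h ^_) n) ⟨
      constˢ (f 0) n + (h ⊗ (λ m → ∑< N (λ k → f (suc k) * (h ^ k) m))) n
        ≈⟨ +-congˡ (𝕊.*-congˡ {h} (horner-∑ N (tail f) h) n) ⟩
      constˢ (f 0) n + (h ⊗ horner N (tail f) h) n  ∎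
      where
      *-1ˢ : ∀ n → constˢ (f 0) n ≈ f 0 * 1ˢ n
      *-1ˢ zero    = sym (*-identityʳ _)
      *-1ˢ (suc _) = sym (zeroʳ _)

    horner-congˡ : ∀ N {f g} h → f ≈ˢ g → horner N f h ≈ˢ horner N g h
    horner-congˡ zero    h e n = refl
    horner-congˡ (suc N) h e = 𝕊.+-cong (const-cong (e 0)) (𝕊.*-congˡ {h} (horner-congˡ N h (e ∘ suc)))

    horner-cong[]ʳ : ∀ N f {h h′} n → h ≈[ n ] h′ → horner N f h ≈[ n ] horner N f h′
    horner-cong[]ʳ zero    f n e m m<n = refl
    horner-cong[]ʳ (suc N) f n e m m<n = +-congˡ (⊗-cong[] n e (horner-cong[]ʳ N (tail f) n e) m m<n)

    -- The additional levels of nesting stand behind N factors of h, whose product vanishes below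
    -- degree N.
    horner-stable : ∀ N d f h → h 0 ≈ 0# → horner N f h ≈[ N ] horner (N ℕ.+ d) f h
    horner-stable zero    d f h h0 m ()
    horner-stable (suc N) d f h h0 m m<N = +-congˡ (⊗-raise h N h0 (horner-stable N d (tail f) h h0) m m<N)

  infixl 9 _⊙_
  opaque
    _⊙_ : Series → Series → Series
    (f ⊙ h) n = horner (suc n) f h n

    ⊙-∑ : ∀ f h n → ∑< (suc n) (λ k → f k * (h ^ k) n) ≈ (f ⊙ h) n
    ⊙-∑ f h n = horner-∑ (suc n) f h n

    ⊙-def : ∀ f h → f ∘ˢ h ≈ˢ f ⊙ h
    ⊙-def f h n = trans (∑-cong (suc n) (λ k _ → *-congˡ (^-def h k n))) (⊙-∑ f h n)

    ⊙-congˡ : ∀ {f g} h → f ≈ˢ g → f ⊙ h ≈ˢ g ⊙ h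
    ⊙-congˡ h e n = horner-congˡ (suc n) h e n

    ⊙-cong[]ʳ : ∀ f {h h′} n → h ≈[ n ] h′ → f ⊙ h ≈[ n ] f ⊙ h′
    ⊙-cong[]ʳ f n e m = horner-cong[]ʳ (suc m) f n e m

    -- The two sides cut off differently: on the left the inner Horner form has n levels in every
    -- degree, on the right the number of levels follows the degree. They agree below degree n by
    -- `horner-stable`, and the factor h extends this to degree n.
    ⊙-step : ∀ f h → h 0 ≈ 0# → f ⊙ h ≈ˢ constˢ (f 0) +ˢ h ⊗ (tail f ⊙ h)
    ⊙-step f h h0 n = +-congˡ (⊗-raise h n h0 agree n ℕₚ.≤-refl)
      where
      agree : horner n (tail f) h ≈[ n ] tail f ⊙ h
      agree m m<n = sym (≡.subst (λ N → horner (suc m) (tail f) h m ≈ horner N (tail f) h m)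
        (ℕₚ.m+[n∸m]≡n m<n) (horner-stable (suc m) (n ℕ.∸ suc m) (tail f) h h0 m ℕₚ.≤-refl))

  ⊙-congʳ : ∀ f {h h′} → h ≈ˢ h′ → f ⊙ h ≈ˢ f ⊙ h′
  ⊙-congʳ f e n = ⊙-cong[]ʳ f (suc n) (λ m _ → e m) n ℕₚ.≤-refl

  ⊙-zero : ∀ f h → h 0 ≈ 0# → (f ⊙ h) 0 ≈ f 0
  ⊙-zero f h h0 = trans (⊙-step f h h0 0) (trans (+-congˡ (trans (⊗-zero h _) (trans (*-congʳ h0) (zeroˡ _)))) (+-identityʳ _))

  -- Since h ^ k starts in degree k, the first n + 1 terms give f(h) correctly in all degrees up to
  -- n, which are the only ones the product with g reads.
  ⊗-⊙-∑ : ∀ f h → h 0 ≈ 0# → ∀ g n → ∑< (suc n) (λ k → f k * (g ⊗ h ^ k) n) ≈ (g ⊗ (f ⊙ h)) n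
  ⊗-⊙-∑ f h h0 g n = trans (sym (⊗-∑ g (suc n) f (h ^_) n))
    (⊗-cong[] (suc n) {f = g} (λ _ _ → refl) agree n ℕₚ.≤-refl)
    where
    agree : (λ m → ∑< (suc n) (λ k → f k * (h ^ k) m)) ≈[ suc n ] f ⊙ h
    agree m (s≤s m≤n) = trans (∑-supports (suc n) (suc m)
        (λ k n<k → vanish k (ℕₚ.≤-<-trans m≤n n<k)) vanish) (⊙-∑ f h m)
      where
      vanish : ∀ k → m < k → f k * (h ^ k) m ≈ 0#
      vanish k m<k = trans (*-congˡ (^-vanishes h h0 k m m<k)) (zeroʳ _)

-- Composition as a ring homomorphism, chain rule and associativity.

module Composition {c ℓ} (R : CommutativeRing c ℓ) where
  open CommutativeRing R hiding (zero)
  open PowerSeries rawRing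
  open SeriesRing R
  open SeriesCalculus R
  private
    module 𝕊 = CommutativeRing seriesRing
    module S = Solver 𝕊.commutativeSemiring
  open SetoidReasoning 𝕊.setoid

  fromAgreement : ∀ {f g} → (∀ n → f ≈[ n ] g) → f ≈ˢ g
  fromAgreement e n = e (suc n) n ℕₚ.≤-refl

  ⊙-t : ∀ f → f ⊙ t ≈ˢ f
  ⊙-t f zero    = ⊙-zero f t refl
  ⊙-t f (suc n) = trans (⊙-step f t refl (suc n)) (trans (+-identityˡ _) (trans (t-⊗-suc (tail f ⊙ t) n) (⊙-t (tail f) n)))

  const-* : ∀ a b → constˢ (a * b) ≈ˢ constˢ a ⊗ constˢ b
  const-* a b zero    = sym (const-⊗ a (constˢ b) zero)
  const-* a b (suc n) = sym (trans (const-⊗ a (constˢ b) (suc n)) (zeroʳ a))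

  module _ (h : Series) (h0 : h 0 ≈ 0#) where

    -- Each identity unfolds by ⊙-step on both sides; the recursive call is
    -- multiplied by h, which has no constant term, so induction on the degree applies.
    agreementStep : ∀ {f u v g} n → f ⊙ h ≈ˢ u +ˢ h ⊗ v → v ≈[ n ] g → f ⊙ h ≈[ suc n ] u +ˢ h ⊗ g
    agreementStep n e e′ m m<n = trans (e m) (+-congˡ (⊗-raise h n h0 e′ m m<n))

    0-⊙ : 0ˢ ⊙ h ≈ˢ 0ˢ
    0-⊙ = fromAgreement go
      where
      go : ∀ n → 0ˢ ⊙ h ≈[ n ] 0ˢ
      go zero    m ()
      go (suc n) m m<n = trans (agreementStep n (⊙-step 0ˢ h h0) (go n) m m<n)
        (trans (+-cong (const-0 m) (𝕊.zeroʳ h m)) (+-identityˡ _))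

    const-⊙ : ∀ a → constˢ a ⊙ h ≈ˢ constˢ a
    const-⊙ a = begin
      constˢ a ⊙ h                ≈⟨ ⊙-step (constˢ a) h h0 ⟩
      constˢ a +ˢ h ⊗ (0ˢ ⊙ h)    ≈⟨ 𝕊.+-congˡ (𝕊.trans (𝕊.*-congˡ 0-⊙) (𝕊.zeroʳ h)) ⟩
      constˢ a +ˢ 0ˢ              ≈⟨ 𝕊.+-identityʳ _ ⟩
      constˢ a                    ∎

    t-⊙ : t ⊙ h ≈ˢ h
    t-⊙ = begin
      t ⊙ h                              ≈⟨ ⊙-step t h h0 ⟩
      constˢ 0# +ˢ h ⊗ (tail t ⊙ h)      ≈⟨ 𝕊.+-cong const-0 (𝕊.*-congˡ (𝕊.trans (⊙-congˡ h tail-t) (const-⊙ 1#))) ⟩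
      0ˢ +ˢ h ⊗ 1ˢ                       ≈⟨ 𝕊.+-identityˡ _ ⟩
      h ⊗ 1ˢ                             ≈⟨ 𝕊.*-identityʳ h ⟩
      h                                  ∎

    +-⊙ : ∀ f g → (f +ˢ g) ⊙ h ≈ˢ f ⊙ h +ˢ g ⊙ h
    +-⊙ f g = fromAgreement (λ n → go n f g)
      where
      go : ∀ n f g → (f +ˢ g) ⊙ h ≈[ n ] f ⊙ h +ˢ g ⊙ h
      go zero    f g m ()
      go (suc n) f g m m<n = trans (agreementStep n (⊙-step (f +ˢ g) h h0) (go n (tail f) (tail g)) m m<n) (regroup m)
        where
        const-+ : constˢ (f 0 + g 0) ≈ˢ constˢ (f 0) +ˢ constˢ (g 0)
        const-+ zero    = refl
        const-+ (suc _) = sym (+-identityˡ _)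
        regroup = begin
          constˢ (f 0 + g 0) +ˢ h ⊗ (tail f ⊙ h +ˢ tail g ⊙ h)
            ≈⟨ 𝕊.+-congʳ const-+ ⟩
          (constˢ (f 0) +ˢ constˢ (g 0)) +ˢ h ⊗ (tail f ⊙ h +ˢ tail g ⊙ h)
            ≈⟨ S.solve 5 (λ a b h x y → (a S.:+ b) S.:+ h S.:* (x S.:+ y) S.:= (a S.:+ h S.:* x) S.:+ (b S.:+ h S.:* y)) 𝕊.refl
                 (constˢ (f 0)) (constˢ (g 0)) h (tail f ⊙ h) (tail g ⊙ h) ⟩
          (constˢ (f 0) +ˢ h ⊗ (tail f ⊙ h)) +ˢ (constˢ (g 0) +ˢ h ⊗ (tail g ⊙ h))
            ≈⟨ 𝕊.+-cong (⊙-step f h h0) (⊙-step g h h0) ⟨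
          f ⊙ h +ˢ g ⊙ h  ∎

    -- Needed before the product rule: `tail (f ⊗ g)` splits into a constant multiple of `tail g`
    -- and a product with `tail f`, and only the latter is covered by the induction in `⊗-⊙`.
    scale-⊙ : ∀ a f → (constˢ a ⊗ f) ⊙ h ≈ˢ constˢ a ⊗ (f ⊙ h)
    scale-⊙ a f = fromAgreement (λ n → go n f)
      where
      go : ∀ n f → (constˢ a ⊗ f) ⊙ h ≈[ n ] constˢ a ⊗ (f ⊙ h)
      go zero    f m ()
      go (suc n) f m m<n = trans (agreementStep n (𝕊.trans (⊙-step (constˢ a ⊗ f) h h0)
            (𝕊.+-cong (𝕊.trans (const-cong (const-⊗ a f 0)) (const-* a (f 0)))
                      (𝕊.*-congˡ (⊙-congˡ h tail-scale)))) (go n (tail f)) m m<n) (regroup m)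
        where
        tail-scale : tail (constˢ a ⊗ f) ≈ˢ constˢ a ⊗ tail f
        tail-scale m = trans (const-⊗ a f (suc m)) (sym (const-⊗ a (tail f) m))
        regroup = begin
          constˢ a ⊗ constˢ (f 0) +ˢ h ⊗ (constˢ a ⊗ (tail f ⊙ h))
            ≈⟨ S.solve 4 (λ a b h x → a S.:* b S.:+ h S.:* (a S.:* x) S.:= a S.:* (b S.:+ h S.:* x)) 𝕊.refl
                 (constˢ a) (constˢ (f 0)) h (tail f ⊙ h) ⟩
          constˢ a ⊗ (constˢ (f 0) +ˢ h ⊗ (tail f ⊙ h))
            ≈⟨ 𝕊.*-congˡ (⊙-step f h h0) ⟨
          constˢ a ⊗ (f ⊙ h)  ∎

    ⊗-⊙ : ∀ f g → (f ⊗ g) ⊙ h ≈ˢ (f ⊙ h) ⊗ (g ⊙ h)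
    ⊗-⊙ f g = fromAgreement (λ n → go n f)
      where
      go : ∀ n f → (f ⊗ g) ⊙ h ≈[ n ] (f ⊙ h) ⊗ (g ⊙ h)
      go zero    f m ()
      go (suc n) f m m<n = trans (agreementStep n unfolded (λ k k<n → +-congˡ (go n (tail f) k k<n)) m m<n) (regroup m)
        where
        a = constˢ (f 0)
        tail-f⊗g : tail (f ⊗ g) ≈ˢ a ⊗ tail g +ˢ tail f ⊗ g
        tail-f⊗g k = trans (tail-⊗ f g k) (+-congʳ (sym (const-⊗ (f 0) (tail g) k)))
        unfolded = begin
          (f ⊗ g) ⊙ h
            ≈⟨ ⊙-step (f ⊗ g) h h0 ⟩
          constˢ ((f ⊗ g) 0) +ˢ h ⊗ (tail (f ⊗ g) ⊙ h)
            ≈⟨ 𝕊.+-cong (𝕊.trans (const-cong (⊗-zero f g)) (const-* (f 0) (g 0))) (𝕊.*-congˡ (⊙-congˡ h tail-f⊗g)) ⟩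
          a ⊗ constˢ (g 0) +ˢ h ⊗ ((a ⊗ tail g +ˢ tail f ⊗ g) ⊙ h)
            ≈⟨ 𝕊.+-congˡ (𝕊.*-congˡ (𝕊.trans (+-⊙ (a ⊗ tail g) (tail f ⊗ g)) (𝕊.+-congʳ (scale-⊙ (f 0) (tail g))))) ⟩
          a ⊗ constˢ (g 0) +ˢ h ⊗ (a ⊗ (tail g ⊙ h) +ˢ (tail f ⊗ g) ⊙ h)  ∎
        regroup = begin
          a ⊗ constˢ (g 0) +ˢ h ⊗ (a ⊗ (tail g ⊙ h) +ˢ (tail f ⊙ h) ⊗ (g ⊙ h))
            ≈⟨ S.solve 6 (λ a b h x y z → a S.:* b S.:+ h S.:* (a S.:* x S.:+ y S.:* z) S.:= a S.:* (b S.:+ h S.:* x) S.:+ (h S.:* y) S.:* z) 𝕊.refl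
                 a (constˢ (g 0)) h (tail g ⊙ h) (tail f ⊙ h) (g ⊙ h) ⟩
          a ⊗ (constˢ (g 0) +ˢ h ⊗ (tail g ⊙ h)) +ˢ (h ⊗ (tail f ⊙ h)) ⊗ (g ⊙ h)
            ≈⟨ 𝕊.+-congʳ (𝕊.*-congˡ (⊙-step g h h0)) ⟨
          a ⊗ (g ⊙ h) +ˢ (h ⊗ (tail f ⊙ h)) ⊗ (g ⊙ h)
            ≈⟨ 𝕊.distribʳ (g ⊙ h) a (h ⊗ (tail f ⊙ h)) ⟨
          (a +ˢ h ⊗ (tail f ⊙ h)) ⊗ (g ⊙ h)
            ≈⟨ 𝕊.*-congʳ (⊙-step f h h0) ⟨
          (f ⊙ h) ⊗ (g ⊙ h)  ∎

    -- From f = f(0) + t · `tail f` comes f′ = `tail f` + t (`tail f`)′. Differentiating `⊙-step`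
    -- gives the same pattern with h in place of t.
    deriv-⊙ : ∀ f → deriv (f ⊙ h) ≈ˢ (deriv f ⊙ h) ⊗ deriv h
    deriv-⊙ f = fromAgreement (λ n → go n f)
      where
      deriv-tail : ∀ f → deriv f ≈ˢ tail f +ˢ t ⊗ deriv (tail f)
      deriv-tail f zero    = +-congˡ (sym (t-⊗-zero (deriv (tail f))))
      deriv-tail f (suc n) = +-congˡ (sym (t-⊗-suc (deriv (tail f)) n))
      go : ∀ n f → deriv (f ⊙ h) ≈[ n ] (deriv f ⊙ h) ⊗ deriv h
      go zero    f m ()
      go (suc n) f m m<n = trans (unfolded m) (trans (+-congˡ (⊗-raise h n h0 (go n (tail f)) m m<n)) (regroup m))
        where
        unfolded = begin
          deriv (f ⊙ h)
            ≈⟨ deriv-cong (⊙-step f h h0) ⟩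
          deriv (constˢ (f 0) +ˢ h ⊗ (tail f ⊙ h))
            ≈⟨ deriv-+ (constˢ (f 0)) (h ⊗ (tail f ⊙ h)) ⟩
          deriv (constˢ (f 0)) +ˢ deriv (h ⊗ (tail f ⊙ h))
            ≈⟨ 𝕊.+-cong (deriv-const (f 0)) (deriv-⊗ h (tail f ⊙ h)) ⟩
          0ˢ +ˢ (deriv h ⊗ (tail f ⊙ h) +ˢ h ⊗ deriv (tail f ⊙ h))
            ≈⟨ 𝕊.+-identityˡ _ ⟩
          deriv h ⊗ (tail f ⊙ h) +ˢ h ⊗ deriv (tail f ⊙ h)  ∎
        regroup = begin
          deriv h ⊗ (tail f ⊙ h) +ˢ h ⊗ ((deriv (tail f) ⊙ h) ⊗ deriv h)
            ≈⟨ S.solve 4 (λ d x h y → d S.:* x S.:+ h S.:* (y S.:* d) S.:= (x S.:+ h S.:* y) S.:* d) 𝕊.refl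
                 (deriv h) (tail f ⊙ h) h (deriv (tail f) ⊙ h) ⟩
          (tail f ⊙ h +ˢ h ⊗ (deriv (tail f) ⊙ h)) ⊗ deriv h
            ≈⟨ 𝕊.*-congʳ (𝕊.+-congˡ (𝕊.*-congʳ t-⊙)) ⟨
          (tail f ⊙ h +ˢ (t ⊙ h) ⊗ (deriv (tail f) ⊙ h)) ⊗ deriv h
            ≈⟨ 𝕊.*-congʳ (𝕊.+-congˡ (⊗-⊙ t (deriv (tail f)))) ⟨
          (tail f ⊙ h +ˢ (t ⊗ deriv (tail f)) ⊙ h) ⊗ deriv h
            ≈⟨ 𝕊.*-congʳ (𝕊.trans (⊙-congˡ h (deriv-tail f)) (+-⊙ (tail f) (t ⊗ deriv (tail f)))) ⟨
          (deriv f ⊙ h) ⊗ deriv h  ∎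

    -- Composition with `h` is a ring homomorphism, so it carries the recursion for f at g to the
    -- recursion for f at `g ⊙ h`, which again has no constant term.
    ⊙-assoc : ∀ f g → g 0 ≈ 0# → (f ⊙ g) ⊙ h ≈ˢ f ⊙ (g ⊙ h)
    ⊙-assoc f g g0 = fromAgreement (λ n → go n f)
      where
      gh0 : (g ⊙ h) 0 ≈ 0#
      gh0 = trans (⊙-zero g h h0) g0
      go : ∀ n f → (f ⊙ g) ⊙ h ≈[ n ] f ⊙ (g ⊙ h)
      go zero    f m ()
      go (suc n) f m m<n = trans (unfolded m) (trans
          (+-congˡ (⊗-raise (g ⊙ h) n gh0 (go n (tail f)) m m<n))
          (sym (⊙-step f (g ⊙ h) gh0 m)))
        where
        unfolded = begin
          (f ⊙ g) ⊙ h
            ≈⟨ ⊙-congˡ h (⊙-step f g g0) ⟩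
          (constˢ (f 0) +ˢ g ⊗ (tail f ⊙ g)) ⊙ h
            ≈⟨ +-⊙ (constˢ (f 0)) (g ⊗ (tail f ⊙ g)) ⟩
          constˢ (f 0) ⊙ h +ˢ (g ⊗ (tail f ⊙ g)) ⊙ h
            ≈⟨ 𝕊.+-cong (const-⊙ (f 0)) (⊗-⊙ g (tail f ⊙ g)) ⟩
          constˢ (f 0) +ˢ (g ⊙ h) ⊗ ((tail f ⊙ g) ⊙ h)  ∎

-- Reciprocals, compositional inverses and the logarithmic derivative of A.

module ShefferSeries {c ℓ₁ ℓ₂} (K : CharacteristicZeroField c ℓ₁ ℓ₂) where
  private
    module K = CharacteristicZeroField K
  open K hiding (zero; rawRing)
  open Sheffer K
  open SeriesRing K.commutativeRing
  open SeriesCalculus K.commutativeRing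
  open Composition K.commutativeRing
  private
    module 𝕊 = CommutativeRing seriesRing
    module S = Solver 𝕊.commutativeSemiring
  open RingProperties 𝕊.ring using (-‿distribʳ-*; +-cancelʳ)
  open SetoidReasoning 𝕊.setoid

  -- Fixed points of contractions for the t-adic distance

  module _ (o : ℕ) (a : ℕ → Series) (a-agree : ∀ m → a m ≈[ m ℕ.+ o ] a (suc m))
           (k : ℕ → ℕ) (n<k+o : ∀ n → n < k n ℕ.+ o) where

    private
      agree-+ : ∀ d m → a m ≈[ m ℕ.+ o ] a (d ℕ.+ m)
      agree-+ zero    m n n<m+o = refl
      agree-+ (suc d) m n n<m+o = trans (agree-+ d m n n<m+o)
        (a-agree (d ℕ.+ m) n (ℕₚ.≤-trans n<m+o (ℕₚ.+-monoˡ-≤ o (ℕₚ.m≤n+m m d))))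

      agree-≤ : ∀ {m m′} → m ≤ m′ → a m ≈[ m ℕ.+ o ] a m′
      agree-≤ {m} m≤m′ = ≡.subst (λ l → a m ≈[ m ℕ.+ o ] a l) (ℕₚ.m∸n+n≡m m≤m′) (agree-+ _ m)

    -- `k n` is the iterate from which the coefficient of degree n is read, and `o` counts the
    -- degrees that are settled at iterate 0. Whichever of `k n` and `m` comes first already agrees
    -- with the other in degree n. Reciprocals use `o = 0` and `k = suc`; compositional inverses
    -- start with the correct constant term and use `o = 1` and the diagonal.
    limit-agrees : ∀ m → (λ n → a (k n) n) ≈[ m ℕ.+ o ] a m
    limit-agrees m n n<m+o with ℕₚ.≤-total (k n) m
    ... | inj₁ kn≤m = agree-≤ kn≤m n (n<k+o n)
    ... | inj₂ m≤kn = sym (agree-≤ m≤kn n n<m+o)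

  const-inverse : ∀ a (a#0 : a # 0#) → constˢ a ⊗ constˢ (inv a a#0) ≈ˢ 1ˢ
  const-inverse a a#0 n = trans (const-⊗ a _ n) (pointwise n)
    where
    pointwise : ∀ n → a * constˢ (inv a a#0) n ≈ 1ˢ n
    pointwise zero    = inv-inverse a a#0
    pointwise (suc _) = zeroʳ a

  module _ (h : InvertibleSeries) where
    private
      u v d : Series
      u = constˢ (series h 0)
      v = constˢ (inv (series h 0) (InvertibleSeries.constant h))
      d = dropConstant (series h)

      step-⊗ : ∀ q → reciprocalStep h q ≈ˢ v ⊗ (1ˢ -ˢ d ⊗ q)
      step-⊗ q = 𝕊.trans (⊗-def v (1ˢ -ˢ d *ˢ q)) (𝕊.*-congˡ (λ n → +-congˡ (-‿cong (⊗-def d q n))))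

      contraction : ∀ n {q q′} → q ≈[ n ] q′ → reciprocalStep h q ≈[ suc n ] reciprocalStep h q′
      contraction n {q} {q′} e m m<n = trans (step-⊗ q m) (trans
        (⊗-cong[] (suc n) {f = v} (λ _ _ → refl) (λ k k<n → +-congˡ (-‿cong (⊗-raise d n refl e k k<n))) m m<n)
        (sym (step-⊗ q′ m)))

      agree : ∀ m → reciprocalApprox h m ≈[ m ℕ.+ 0 ] reciprocalApprox h (suc m)
      agree zero    m ()
      agree (suc m) = contraction (m ℕ.+ 0) (agree m)

      q : Series
      q = series (reciprocal h)

      q-agrees : ∀ m → q ≈[ m ℕ.+ 0 ] reciprocalApprox h m
      q-agrees = limit-agrees 0 (reciprocalApprox h) agree suc (λ n → s≤s (ℕₚ.m≤m+n n 0))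

      fixed : q ≈ˢ v ⊗ (1ˢ -ˢ d ⊗ q)
      fixed n = trans (q-agrees (suc n) n n<) (trans (sym (contraction (n ℕ.+ 0) (q-agrees n) n n<)) (step-⊗ q n))
        where
        n< : n < suc (n ℕ.+ 0)
        n< = s≤s (ℕₚ.m≤m+n n 0)

    -- Multiplied by u, the fixed-point equation reads u q = 1 - d q, and h = u + d.
    reciprocal-inverse : series h ⊗ series (reciprocal h) ≈ˢ 1ˢ
    reciprocal-inverse = begin
      series h ⊗ q                       ≈⟨ 𝕊.*-congʳ split ⟩
      (u +ˢ d) ⊗ q                       ≈⟨ 𝕊.distribʳ q u d ⟩
      u ⊗ q +ˢ d ⊗ q                     ≈⟨ 𝕊.+-congʳ (𝕊.*-congˡ fixed) ⟩
      u ⊗ (v ⊗ (1ˢ -ˢ d ⊗ q)) +ˢ d ⊗ q   ≈⟨ 𝕊.+-congʳ (𝕊.*-assoc u v _) ⟨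
      u ⊗ v ⊗ (1ˢ -ˢ d ⊗ q) +ˢ d ⊗ q     ≈⟨ 𝕊.+-congʳ (𝕊.trans (𝕊.*-congʳ (const-inverse _ (InvertibleSeries.constant h))) (𝕊.*-identityˡ _)) ⟩
      (1ˢ -ˢ d ⊗ q) +ˢ d ⊗ q             ≈⟨ 𝕊.+-assoc _ _ _ ⟩
      1ˢ +ˢ (-ˢ (d ⊗ q) +ˢ d ⊗ q)        ≈⟨ 𝕊.+-congˡ (𝕊.-‿inverseˡ (d ⊗ q)) ⟩
      1ˢ +ˢ 0ˢ                           ≈⟨ 𝕊.+-identityʳ 1ˢ ⟩
      1ˢ                                 ∎
      where
      split : series h ≈ˢ u +ˢ d
      split zero    = sym (+-identityʳ _)
      split (suc _) = sym (+-identityˡ _)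

  module _ (f : DeltaSeries) where
    private
      u v d : Series
      u = constˢ (deriv (series f) 0)
      v = constˢ (inv (deriv (series f) 0) (DeltaSeries.derivAt0 f))
      d = dropLinear (series f)

      step-⊗ : ∀ H → inverseStep f H ≈ˢ v ⊗ (t -ˢ d ⊙ H)
      step-⊗ H = 𝕊.trans (⊗-def v (t -ˢ d ∘ˢ H)) (𝕊.*-congˡ (λ n → +-congˡ (-‿cong (⊙-def d H n))))

      -- Terms of order at least two exhibit two factors H, the shape required by `⊗-raise₂`.
      d-⊙ : ∀ H → H 0 ≈ 0# → d ⊙ H ≈ˢ H ⊗ (H ⊗ (tail (tail d) ⊙ H))
      d-⊙ H H0 = begin
        d ⊙ H                                                 ≈⟨ ⊙-step d H H0 ⟩
        constˢ 0# +ˢ H ⊗ (tail d ⊙ H)                         ≈⟨ 𝕊.trans (𝕊.+-congʳ const-0) (𝕊.+-identityˡ _) ⟩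
        H ⊗ (tail d ⊙ H)                                      ≈⟨ 𝕊.*-congˡ (⊙-step (tail d) H H0) ⟩
        H ⊗ (constˢ 0# +ˢ H ⊗ (tail (tail d) ⊙ H))            ≈⟨ 𝕊.*-congˡ (𝕊.trans (𝕊.+-congʳ const-0) (𝕊.+-identityˡ _)) ⟩
        H ⊗ (H ⊗ (tail (tail d) ⊙ H))                         ∎

      -- Both factors vary here, so `⊗-raise` does not apply. The vanishing constant terms remove
      -- the two outermost terms of the Cauchy product; the others read both factors strictly below
      -- degree m, hence below n.
      ⊗-raise₂ : ∀ n {F F′ G G′} → F 0 ≈ 0# → F′ 0 ≈ 0# → G 0 ≈ 0# → G′ 0 ≈ 0# →
                 F ≈[ n ] F′ → G ≈[ n ] G′ → F ⊗ G ≈[ suc n ] F′ ⊗ G′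
      ⊗-raise₂ n {F} {F′} {G} {G′} F0 F′0 G0 G′0 e e′ m m<n = ⊗-terms m term
        where
        term : ∀ p → p ≤ m → F p * G (m ℕ.∸ p) ≈ F′ p * G′ (m ℕ.∸ p)
        term zero    _ = trans (trans (*-congʳ F0) (zeroˡ _)) (sym (trans (*-congʳ F′0) (zeroˡ _)))
        term (suc p) p<m with ℕₚ.m≤n⇒m<n∨m≡n p<m
        ... | inj₂ ≡.refl = trans (trans (*-congˡ (trans (reflexive (≡.cong G (ℕₚ.n∸n≡0 p))) G0)) (zeroʳ _))
                              (sym (trans (*-congˡ (trans (reflexive (≡.cong G′ (ℕₚ.n∸n≡0 p))) G′0)) (zeroʳ _)))
        ... | inj₁ sp<m = *-cong (e (suc p) (ℕₚ.<-≤-trans sp<m (ℕₚ.≤-pred m<n)))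
                                 (e′ _ (ℕₚ.<-≤-trans (ℕₚ.∸-monoʳ-< (s≤s z≤n) p<m) (ℕₚ.≤-pred m<n)))

      contraction : ∀ n {H H′} → H 0 ≈ 0# → H′ 0 ≈ 0# → H ≈[ n ] H′ → inverseStep f H ≈[ suc n ] inverseStep f H′
      contraction n {H} {H′} H0 H′0 e m m<n = trans (step-⊗ H m) (trans
        (⊗-cong[] (suc n) {f = v} (λ _ _ → refl) (λ k k<n → +-congˡ (-‿cong (trans (d-⊙ H H0 k) (trans
          (⊗-raise₂ n H0 H′0 (⊗0 H H0) (⊗0 H′ H′0) e (⊗-cong[] n e (⊙-cong[]ʳ (tail (tail d)) n e)) k k<n)
          (sym (d-⊙ H′ H′0 k)))))) m m<n)
        (sym (step-⊗ H′ m)))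
        where
        ⊗0 : ∀ H {G} → H 0 ≈ 0# → (H ⊗ G) 0 ≈ 0#
        ⊗0 H {G} H0 = trans (⊗-zero H G) (trans (*-congʳ H0) (zeroˡ _))

      approx0 : ∀ m → inverseApprox f m 0 ≈ 0#
      approx0 zero    = refl
      approx0 (suc m) = trans (step-⊗ _ 0) (trans (⊗-zero v _) (trans (*-congˡ (trans (+-identityˡ _)
        (trans (-‿cong (⊙-zero d (inverseApprox f m) (approx0 m))) -0#≈0#))) (zeroʳ _)))
        where open RingProperties ring using (-0#≈0#)

      agree : ∀ m → inverseApprox f m ≈[ m ℕ.+ 1 ] inverseApprox f (suc m)
      agree zero    zero _  = sym (approx0 1)
      agree zero    (suc m) (s≤s ())
      agree (suc m) = contraction (m ℕ.+ 1) (approx0 m) (approx0 (suc m)) (agree m)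

      H : Series
      H = series (f ⁻¹)

      H-agrees : ∀ m → H ≈[ m ℕ.+ 1 ] inverseApprox f m
      H-agrees = limit-agrees 1 (inverseApprox f) agree (λ n → n) (λ n → ℕₚ.≤-reflexive (ℕₚ.+-comm 1 n))

      fixed : H ≈ˢ v ⊗ (t -ˢ d ⊙ H)
      fixed n = trans (H-agrees (suc n) n n<) (trans (sym (contraction (n ℕ.+ 1) refl (approx0 n) (H-agrees n) n n<)) (step-⊗ H n))
        where
        n< : n < suc (n ℕ.+ 1)
        n< = s≤s (ℕₚ.m≤m+n n 1)

    -- Multiplied by u = f′(0), the fixed-point equation becomes u H + d(H) = t, whose left side is
    -- f(H).
    ⊙-inverse : series f ⊙ series (f ⁻¹) ≈ˢ t
    ⊙-inverse = begin
      series f ⊙ H                        ≈⟨ ⊙-congˡ H split ⟩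
      (u ⊗ t +ˢ d) ⊙ H                    ≈⟨ +-⊙ H refl (u ⊗ t) d ⟩
      (u ⊗ t) ⊙ H +ˢ d ⊙ H                ≈⟨ 𝕊.+-congʳ (𝕊.trans (scale-⊙ H refl _ t) (𝕊.*-congˡ (t-⊙ H refl))) ⟩
      u ⊗ H +ˢ d ⊙ H                      ≈⟨ 𝕊.+-congʳ (𝕊.*-congˡ fixed) ⟩
      u ⊗ (v ⊗ (t -ˢ d ⊙ H)) +ˢ d ⊙ H     ≈⟨ 𝕊.+-congʳ (𝕊.*-assoc u v _) ⟨
      u ⊗ v ⊗ (t -ˢ d ⊙ H) +ˢ d ⊙ H       ≈⟨ 𝕊.+-congʳ (𝕊.trans (𝕊.*-congʳ (const-inverse _ (DeltaSeries.derivAt0 f))) (𝕊.*-identityˡ _)) ⟩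
      (t -ˢ d ⊙ H) +ˢ d ⊙ H               ≈⟨ 𝕊.+-assoc _ _ _ ⟩
      t +ˢ (-ˢ (d ⊙ H) +ˢ d ⊙ H)          ≈⟨ 𝕊.+-congˡ (𝕊.-‿inverseˡ (d ⊙ H)) ⟩
      t +ˢ 0ˢ                             ≈⟨ 𝕊.+-identityʳ t ⟩
      t                                   ∎
      where
      split : series f ≈ˢ u ⊗ t +ˢ d
      split n = trans (pointwise n) (+-congʳ (sym (const-⊗ _ t n)))
        where
        pointwise : ∀ n → series f n ≈ deriv (series f) 0 * t n + d n
        pointwise zero          = trans (DeltaSeries.constant f) (sym (trans (+-identityʳ _) (zeroʳ _)))
        pointwise (suc zero)    = sym (trans (+-identityʳ _) (trans (*-identityʳ _) (+-identityʳ _)))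
        pointwise (suc (suc n)) = sym (trans (+-congʳ (zeroʳ _)) (+-identityˡ _))

  inverse-unique : ∀ f {g h} → f ⊗ g ≈ˢ 1ˢ → f ⊗ h ≈ˢ 1ˢ → g ≈ˢ h
  inverse-unique f {g} {h} fg fh = begin
    g              ≈⟨ 𝕊.*-identityʳ g ⟨
    g ⊗ 1ˢ         ≈⟨ 𝕊.*-congˡ fh ⟨
    g ⊗ (f ⊗ h)    ≈⟨ S.solve 3 (λ f g h → g S.:* (f S.:* h) S.:= (f S.:* g) S.:* h) 𝕊.refl f g h ⟩
    f ⊗ g ⊗ h      ≈⟨ 𝕊.*-congʳ fg ⟩
    1ˢ ⊗ h         ≈⟨ 𝕊.*-identityˡ h ⟩
    h              ∎

  reciprocal-⊙ : ∀ g h → h 0 ≈ 0# → (series g ⊙ h) ⊗ (series (reciprocal g) ⊙ h) ≈ˢ 1ˢ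
  reciprocal-⊙ g h h0 = begin
    (series g ⊙ h) ⊗ (series (reciprocal g) ⊙ h)   ≈⟨ ⊗-⊙ h h0 (series g) (series (reciprocal g)) ⟨
    (series g ⊗ series (reciprocal g)) ⊙ h         ≈⟨ ⊙-congˡ h (reciprocal-inverse g) ⟩
    1ˢ ⊙ h                                         ≈⟨ const-⊙ h h0 1# ⟩
    1ˢ                                             ∎

  module _ (f : DeltaSeries) where
    private
      H H⁻¹ : Series
      H   = series (f ⁻¹)
      H⁻¹ = series ((f ⁻¹) ⁻¹)

    -- Differentiating f(H) = t shows that H′ is an inverse of f′(H); the composite of 1/f′ with H
    -- is another.
    inverse-deriv : series (reciprocal (deriv-delta f)) ⊙ H ≈ˢ deriv H
    inverse-deriv = inverse-unique (deriv (series f) ⊙ H) (reciprocal-⊙ (deriv-delta f) H refl) (begin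
      (deriv (series f) ⊙ H) ⊗ deriv H     ≈⟨ deriv-⊙ H refl (series f) ⟨
      deriv (series f ⊙ H)                 ≈⟨ deriv-cong (⊙-inverse f) ⟩
      deriv t                              ≈⟨ deriv-t ⟩
      1ˢ                                   ∎)
      where
      deriv-t : deriv t ≈ˢ 1ˢ
      deriv-t zero    = +-identityʳ 1#
      deriv-t (suc n) = deriv-const 0# (suc n)

    -- The iteration only provides right inverses, f(H) = t and H(H⁻¹) = t. By associativity f =
    -- f(H(H⁻¹)) = H⁻¹, so H is a left inverse as well, as `cancel-⊙` requires.
    double-inverse : H⁻¹ ≈ˢ series f
    double-inverse = begin
      H⁻¹                       ≈⟨ t-⊙ H⁻¹ refl ⟨
      t ⊙ H⁻¹                   ≈⟨ ⊙-congˡ H⁻¹ (⊙-inverse f) ⟨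
      (series f ⊙ H) ⊙ H⁻¹      ≈⟨ ⊙-assoc H⁻¹ refl (series f) H refl ⟩
      series f ⊙ (H ⊙ H⁻¹)      ≈⟨ ⊙-congʳ (series f) (⊙-inverse (f ⁻¹)) ⟩
      series f ⊙ t              ≈⟨ ⊙-t (series f) ⟩
      series f                  ∎

    cancel-⊙ : ∀ φ → (φ ∘ˢ H⁻¹) ⊙ H ≈ˢ φ
    cancel-⊙ φ = begin
      (φ ∘ˢ H⁻¹) ⊙ H     ≈⟨ ⊙-congˡ H (⊙-def φ H⁻¹) ⟩
      (φ ⊙ H⁻¹) ⊙ H      ≈⟨ ⊙-assoc H refl φ H⁻¹ refl ⟩
      φ ⊙ (H⁻¹ ⊙ H)      ≈⟨ ⊙-congʳ φ (𝕊.trans (⊙-congˡ H double-inverse) (⊙-inverse f)) ⟩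
      φ ⊙ t              ≈⟨ ⊙-t φ ⟩
      φ                  ∎

  module _ (f : DeltaSeries) (g : InvertibleSeries) where
    private
      H H⁻¹ A : Series
      H   = series (f ⁻¹)
      H⁻¹ = series ((f ⁻¹) ⁻¹)
      A   = series (reciprocal (g ∘ᴵ (f ⁻¹)))

    g∘H-inverse : (series g ⊙ H) ⊗ A ≈ˢ 1ˢ
    g∘H-inverse = 𝕊.trans (𝕊.*-congʳ (𝕊.sym (⊙-def (series g) H))) (reciprocal-inverse (g ∘ᴵ (f ⁻¹)))

    -- With G = g(H), differentiating G A = 1 gives G A′ = -G′ A; multiplying by A isolates A′.
    A-deriv : deriv A ≈ˢ -ˢ (((deriv (series g) /ˢ g) ⊙ H) ⊗ (deriv H ⊗ A))
    A-deriv = begin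
      deriv A                                              ≈⟨ 𝕊.*-identityˡ _ ⟨
      1ˢ ⊗ deriv A                                         ≈⟨ 𝕊.*-congʳ g∘H-inverse ⟨
      G ⊗ A ⊗ deriv A                                      ≈⟨ S.solve 3 (λ g a b → g S.:* a S.:* b S.:= a S.:* (g S.:* b)) 𝕊.refl G A (deriv A) ⟩
      A ⊗ (G ⊗ deriv A)                                    ≈⟨ 𝕊.*-congˡ GA′ ⟩
      A ⊗ (-ˢ (deriv G ⊗ A))                               ≈⟨ -‿distribʳ-* A (deriv G ⊗ A) ⟨
      -ˢ (A ⊗ (deriv G ⊗ A))                               ≈⟨ 𝕊.-‿cong (𝕊.*-congˡ (𝕊.*-congʳ (deriv-⊙ H refl (series g)))) ⟩
      -ˢ (A ⊗ ((deriv (series g) ⊙ H) ⊗ deriv H ⊗ A))      ≈⟨ 𝕊.-‿cong (S.solve 3 (λ a g h → a S.:* (g S.:* h S.:* a) S.:= g S.:* a S.:* (h S.:* a)) 𝕊.refl A (deriv (series g) ⊙ H) (deriv H)) ⟩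
      -ˢ ((deriv (series g) ⊙ H) ⊗ A ⊗ (deriv H ⊗ A))      ≈⟨ 𝕊.-‿cong (𝕊.*-congʳ quotient) ⟨
      -ˢ (((deriv (series g) /ˢ g) ⊙ H) ⊗ (deriv H ⊗ A))   ∎
      where
      G = series g ⊙ H
      GA′ : G ⊗ deriv A ≈ˢ -ˢ (deriv G ⊗ A)
      GA′ = +-cancelʳ (deriv G ⊗ A) (G ⊗ deriv A) (-ˢ (deriv G ⊗ A)) (begin
        G ⊗ deriv A +ˢ deriv G ⊗ A       ≈⟨ 𝕊.+-comm (G ⊗ deriv A) (deriv G ⊗ A) ⟩
        deriv G ⊗ A +ˢ G ⊗ deriv A       ≈⟨ deriv-⊗ G A ⟨
        deriv (G ⊗ A)                    ≈⟨ deriv-cong g∘H-inverse ⟩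
        deriv 1ˢ                         ≈⟨ deriv-const 1# ⟩
        0ˢ                               ≈⟨ 𝕊.-‿inverseˡ (deriv G ⊗ A) ⟨
        -ˢ (deriv G ⊗ A) +ˢ deriv G ⊗ A  ∎)
      quotient : (deriv (series g) /ˢ g) ⊙ H ≈ˢ (deriv (series g) ⊙ H) ⊗ A
      quotient = begin
        (deriv (series g) /ˢ g) ⊙ H                                 ≈⟨ ⊙-congˡ H (⊗-def (deriv (series g)) (series (reciprocal g))) ⟩
        (deriv (series g) ⊗ series (reciprocal g)) ⊙ H              ≈⟨ ⊗-⊙ H refl (deriv (series g)) (series (reciprocal g)) ⟩
        (deriv (series g) ⊙ H) ⊗ (series (reciprocal g) ⊙ H)        ≈⟨ 𝕊.*-congˡ (inverse-unique G (reciprocal-⊙ g H refl) g∘H-inverse) ⟩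
        (deriv (series g) ⊙ H) ⊗ A                                  ∎

    -- Composition with H turns A(H⁻¹) back into A, so its reciprocal becomes an inverse of A. The
    -- case φ = A′ serves the second operator.
    quotient-cancel-⊙ : ∀ φ → ((φ ∘ˢ H⁻¹) /ˢ (reciprocal (g ∘ᴵ (f ⁻¹)) ∘ᴵ ((f ⁻¹) ⁻¹))) ⊙ H ⊗ A ≈ˢ φ
    quotient-cancel-⊙ φ = begin
      ((φ ∘ˢ H⁻¹) /ˢ B) ⊙ H ⊗ A                                 ≈⟨ 𝕊.*-congʳ (𝕊.trans (⊙-congˡ H (⊗-def (φ ∘ˢ H⁻¹) (series (reciprocal B)))) (⊗-⊙ H refl (φ ∘ˢ H⁻¹) (series (reciprocal B)))) ⟩
      ((φ ∘ˢ H⁻¹) ⊙ H) ⊗ (series (reciprocal B) ⊙ H) ⊗ A        ≈⟨ 𝕊.*-assoc ((φ ∘ˢ H⁻¹) ⊙ H) (series (reciprocal B) ⊙ H) A ⟩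
      ((φ ∘ˢ H⁻¹) ⊙ H) ⊗ ((series (reciprocal B) ⊙ H) ⊗ A)      ≈⟨ 𝕊.*-cong (cancel-⊙ f φ) (𝕊.trans (𝕊.*-comm (series (reciprocal B) ⊙ H) A) A⊗) ⟩
      φ ⊗ 1ˢ                                                    ≈⟨ 𝕊.*-identityʳ φ ⟩
      φ                                                         ∎
      where
      B = reciprocal (g ∘ᴵ (f ⁻¹)) ∘ᴵ ((f ⁻¹) ⁻¹)
      A⊗ : A ⊗ (series (reciprocal B) ⊙ H) ≈ˢ 1ˢ
      A⊗ = 𝕊.trans (𝕊.*-congʳ (𝕊.sym (cancel-⊙ f A))) (reciprocal-⊙ B H refl)

-- Transport along ring homomorphisms, from polynomials to power series.

module _ {a ℓ₁ b ℓ₂} {R : RawRing a ℓ₁} (S : CommutativeRing b ℓ₂)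
         {φ : RawRing.Carrier R → CommutativeRing.Carrier S}
         (φ-homo : RingMorphisms.IsRingHomomorphism R (CommutativeRing.rawRing S) φ) where
  private
    module R = RawRing R
    module Rˢ = PowerSeries R
    module Rᴾ = Polynomial R
  open CommutativeRing S hiding (zero)
  open PowerSeries rawRing
  open SeriesRing S
  open SeriesCalculus S
  open RingMorphisms.IsRingHomomorphism φ-homo
  open RingProperties ring using (-0#≈0#)
  open SetoidReasoning setoid

  ∑-homo : ∀ n a → φ (Rˢ.∑< n a) ≈ ∑< n (φ ∘ a)
  ∑-homo zero    a = 0#-homo
  ∑-homo (suc n) a = trans (+-homo _ _) (+-congʳ (∑-homo n a))

  *ˢ-homo : ∀ f g → φ ∘ (f Rˢ.*ˢ g) ≈ˢ (φ ∘ f) ⊗ (φ ∘ g)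
  *ˢ-homo f g n = begin
    φ ((f Rˢ.*ˢ g) n)                                   ≈⟨ ∑-homo (suc n) _ ⟩
    ∑< (suc n) (λ k → φ (f k R.* g (n ℕ.∸ k)))          ≈⟨ ∑-cong (suc n) (λ k _ → *-homo _ _) ⟩
    ((φ ∘ f) *ˢ (φ ∘ g)) n                              ≈⟨ ⊗-def (φ ∘ f) (φ ∘ g) n ⟩
    ((φ ∘ f) ⊗ (φ ∘ g)) n                               ∎

  constˢ-homo : ∀ a → φ ∘ Rˢ.constˢ a ≈ˢ constˢ (φ a)
  constˢ-homo a zero    = refl
  constˢ-homo a (suc _) = 0#-homo

  ^ˢ-homo : ∀ f m → φ ∘ (f Rˢ.^ˢ m) ≈ˢ (φ ∘ f) ^ m
  ^ˢ-homo f zero    n = trans (constˢ-homo R.1# n) (const-cong 1#-homo n)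
  ^ˢ-homo f (suc m) n = trans (*ˢ-homo f (f Rˢ.^ˢ m) n) (⊗-cong {f = φ ∘ f} (λ _ → refl) (^ˢ-homo f m) n)

  ∘ˢ-homo : ∀ f h → φ ∘ (f Rˢ.∘ˢ h) ≈ˢ (φ ∘ f) ⊙ (φ ∘ h)
  ∘ˢ-homo f h n = begin
    φ ((f Rˢ.∘ˢ h) n)                                    ≈⟨ ∑-homo (suc n) _ ⟩
    ∑< (suc n) (λ k → φ (f k R.* (h Rˢ.^ˢ k) n))         ≈⟨ ∑-cong (suc n) (λ k _ → trans (*-homo _ _) (*-congˡ (^ˢ-homo h k n))) ⟩
    ∑< (suc n) (λ k → φ (f k) * ((φ ∘ h) ^ k) n)         ≈⟨ ⊙-∑ (φ ∘ f) (φ ∘ h) n ⟩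
    ((φ ∘ f) ⊙ (φ ∘ h)) n                                ∎

  coefficients : Rᴾ.Poly → Series
  coefficients p n = φ (Rᴾ.coeff p n)

  coefficients-C : ∀ a → coefficients (Rᴾ.C a) ≈ˢ constˢ (φ a)
  coefficients-C a zero    = refl
  coefficients-C a (suc _) = 0#-homo

  coefficients-X : coefficients Rᴾ.X ≈ˢ t
  coefficients-X zero          = 0#-homo
  coefficients-X (suc zero)    = 1#-homo
  coefficients-X (suc (suc _)) = 0#-homo

  coefficients-+ : ∀ p q → coefficients (p Rᴾ.+ᴾ q) ≈ˢ coefficients p +ˢ coefficients q
  coefficients-+ []      q       n       = sym (trans (+-congʳ 0#-homo) (+-identityˡ _))
  coefficients-+ (a ∷ p) []      n       = sym (trans (+-congˡ 0#-homo) (+-identityʳ _))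
  coefficients-+ (a ∷ p) (b ∷ q) zero    = +-homo a b
  coefficients-+ (a ∷ p) (b ∷ q) (suc n) = coefficients-+ p q n

  coefficients-scale : ∀ a q n → coefficients (map (a R.*_) q) n ≈ φ a * coefficients q n
  coefficients-scale a []      n       = trans 0#-homo (sym (trans (*-congˡ 0#-homo) (zeroʳ _)))
  coefficients-scale a (b ∷ q) zero    = *-homo a b
  coefficients-scale a (b ∷ q) (suc n) = coefficients-scale a q n

  coefficients-* : ∀ p q → coefficients (p Rᴾ.*ᴾ q) ≈ˢ coefficients p ⊗ coefficients q
  coefficients-* []      q n = begin
    φ R.0#                             ≈⟨ 0#-homo ⟩
    0#                                 ≈⟨ ⊗-zeroˡ (coefficients q) n ⟨
    (0ˢ ⊗ coefficients q) n            ≈⟨ ⊗-cong {g = coefficients q} (λ _ → 0#-homo) (λ _ → refl) n ⟨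
    (coefficients [] ⊗ coefficients q) n  ∎
  coefficients-* (a ∷ p) q n = trans (coefficients-+ (map (a R.*_) q) (R.0# ∷ (p Rᴾ.*ᴾ q)) n)
    (trans (+-congʳ (coefficients-scale a q n)) (shifted n))
    where
    shifted : ∀ n → φ a * coefficients q n + coefficients (R.0# ∷ (p Rᴾ.*ᴾ q)) n ≈ (coefficients (a ∷ p) ⊗ coefficients q) n
    shifted zero    = trans (+-congˡ 0#-homo) (trans (+-identityʳ _) (sym (⊗-zero (coefficients (a ∷ p)) (coefficients q))))
    shifted (suc n) = trans (+-congˡ (coefficients-* p q n)) (sym (⊗-sucˡ (coefficients (a ∷ p)) (coefficients q) n))

  coefficients-neg : ∀ p → coefficients (map R.-_ p) ≈ˢ -ˢ coefficients p
  coefficients-neg []      n       = trans 0#-homo (sym (trans (-‿cong 0#-homo) -0#≈0#))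
  coefficients-neg (a ∷ p) zero    = -‿homo a
  coefficients-neg (a ∷ p) (suc n) = coefficients-neg p n

  -- The result has the form of the input, a homomorphism from a raw ring to a commutative ring, so
  -- the construction can be repeated once per variable.
  coefficients-homo : RingMorphisms.IsRingHomomorphism Rᴾ.rawRing (CommutativeRing.rawRing seriesRing) coefficients
  coefficients-homo = record
    { isSemiringHomomorphism = record
      { isNearSemiringHomomorphism = record
        { +-isMonoidHomomorphism = record
          { isMagmaHomomorphism = record
            { isRelHomomorphism = record { cong = λ e n → ⟦⟧-cong (e n) }
            ; homo = coefficients-+
            }
          ; ε-homo = λ _ → 0#-homo
          }
        ; *-homo = coefficients-*
        }
      ; 1#-homo = λ n → trans (coefficients-C R.1# n) (const-cong 1#-homo n)
      }
    ; -‿homo = coefficients-neg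
    }

-- The generating function, monomial by monomial.

module ClosedForm {c ℓ₁ ℓ₂} (K : CharacteristicZeroField c ℓ₁ ℓ₂) where
  private
    module K = CharacteristicZeroField K
  open K hiding (zero; rawRing)
  open Sheffer K
  open SeriesRing K.commutativeRing
  open SeriesCalculus K.commutativeRing
  open Mult semiring using () renaming (×-homo-+ to ·-homo-+; ×-assoc-* to ·-assoc-*; ×-congʳ to ·-congʳ)
  open RingProperties ring using (-0#≈0#; -‿distribˡ-*; -‿distribʳ-*; -‿involutive)
  open SetoidReasoning setoid

  K[[x]] K[[x,y]] K[[x,y,z]] : CommutativeRing c ℓ₁
  K[[x]]     = SeriesRing.seriesRing K.commutativeRing
  K[[x,y]]   = SeriesRing.seriesRing K[[x]]
  K[[x,y,z]] = SeriesRing.seriesRing K[[x,y]]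

  private
    module S = Solver commutativeSemiring
    module Y = SeriesRing K[[x]]
    module Z = SeriesRing K[[x,y]]
    module T where
      open PowerSeries (CommutativeRing.rawRing K[[x,y,z]]) public
      open SeriesRing K[[x,y,z]] public
      open SeriesCalculus K[[x,y,z]] public
    module 𝕋 = CommutativeRing (SeriesRing.seriesRing K[[x,y,z]])
    module R₁ = CommutativeRing K[[x]]
    module R₂ = CommutativeRing K[[x,y]]
    module R₃ = CommutativeRing K[[x,y,z]]
    module P₁ = Polynomial K.rawRing
    module P₂ = Polynomial P₁.rawRing
    module P₃ = Polynomial P₂.rawRing

    id-homo : RingMorphisms.IsRingHomomorphism K.rawRing K.rawRing (λ a → a)
    id-homo = record
      { isSemiringHomomorphism = record
        { isNearSemiringHomomorphism = record
          { +-isMonoidHomomorphism = record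
            { isMagmaHomomorphism = record { isRelHomomorphism = record { cong = λ e → e } ; homo = λ _ _ → refl }
            ; ε-homo = refl
            }
          ; *-homo = λ _ _ → refl
          }
        ; 1#-homo = refl
        }
      ; -‿homo = λ _ → refl
      }

    homo₁ = coefficients-homo K.commutativeRing id-homo
    homo₂ = coefficients-homo K[[x]] homo₁
    homo₃ = coefficients-homo K[[x,y]] homo₂

  -- The innermost homomorphism is the identity, so `⟦ p ⟧ k j i` is definitionally the coefficient
  -- of xⁱyʲzᵏ, and statements with `_≈ᵖ_` apply to it directly. The order k, j, i follows the
  -- nesting, with z outermost.
  ⟦_⟧ : K[x,y,z] → R₃.Carrier
  ⟦_⟧ = coefficients K[[x,y]] homo₂

  ⟦⟧-homo : RingMorphisms.IsRingHomomorphism P₃.rawRing R₃.rawRing ⟦_⟧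
  ⟦⟧-homo = homo₃

  ⟦const⟧-* : ∀ a w k j i → (⟦ constᵖ a ⟧ Z.⊗ w) k j i ≈ a * w k j i
  ⟦const⟧-* a w k j i = begin
    (⟦ constᵖ a ⟧ Z.⊗ w) k j i
      ≈⟨ R₃.*-congʳ {w} (coefficients-C K[[x,y]] homo₂ (P₂.C (P₁.C a))) k j i ⟩
    (PowerSeries.constˢ R₂.rawRing _ Z.⊗ w) k j i
      ≈⟨ Z.const-⊗ _ w k j i ⟩
    (coefficients K[[x]] homo₁ (P₂.C (P₁.C a)) Y.⊗ w k) j i
      ≈⟨ R₂.*-congʳ {w k} (coefficients-C K[[x]] homo₁ (P₁.C a)) j i ⟩
    (PowerSeries.constˢ R₁.rawRing _ Y.⊗ w k) j i
      ≈⟨ Y.const-⊗ _ (w k) j i ⟩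
    (coefficients K.commutativeRing id-homo (P₁.C a) ⊗ w k j) i
      ≈⟨ R₁.*-congʳ {w k j} (coefficients-C K.commutativeRing id-homo a) i ⟩
    (constˢ a ⊗ w k j) i
      ≈⟨ const-⊗ a (w k j) i ⟩
    a * w k j i  ∎

  ⟦x⟧-* : ∀ w k j i → (⟦ x ⟧ Z.⊗ w) k j i ≈ (t ⊗ w k j) i
  ⟦x⟧-* w k j i = begin
    (⟦ x ⟧ Z.⊗ w) k j i
      ≈⟨ R₃.*-congʳ {w} (coefficients-C K[[x,y]] homo₂ (P₂.C P₁.X)) k j i ⟩
    (PowerSeries.constˢ R₂.rawRing _ Z.⊗ w) k j i
      ≈⟨ Z.const-⊗ _ w k j i ⟩
    (coefficients K[[x]] homo₁ (P₂.C P₁.X) Y.⊗ w k) j i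
      ≈⟨ R₂.*-congʳ {w k} (coefficients-C K[[x]] homo₁ P₁.X) j i ⟩
    (PowerSeries.constˢ R₁.rawRing _ Y.⊗ w k) j i
      ≈⟨ Y.const-⊗ _ (w k) j i ⟩
    (coefficients K.commutativeRing id-homo P₁.X ⊗ w k j) i
      ≈⟨ R₁.*-congʳ {w k j} (coefficients-X K.commutativeRing id-homo) i ⟩
    (t ⊗ w k j) i  ∎

  ⟦y⟧-* : ∀ w k j i → (⟦ y ⟧ Z.⊗ w) k j i ≈ (PowerSeries.t R₁.rawRing Y.⊗ w k) j i
  ⟦y⟧-* w k j i = begin
    (⟦ y ⟧ Z.⊗ w) k j i
      ≈⟨ R₃.*-congʳ {w} (coefficients-C K[[x,y]] homo₂ P₂.X) k j i ⟩
    (PowerSeries.constˢ R₂.rawRing _ Z.⊗ w) k j i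
      ≈⟨ Z.const-⊗ _ w k j i ⟩
    (coefficients K[[x]] homo₁ P₂.X Y.⊗ w k) j i
      ≈⟨ R₂.*-congʳ {w k} (coefficients-X K[[x]] homo₁) j i ⟩
    (PowerSeries.t R₁.rawRing Y.⊗ w k) j i  ∎

  ⟦y⟧-*-zero : ∀ w k i → (⟦ y ⟧ Z.⊗ w) k zero i ≈ 0#
  ⟦y⟧-*-zero w k i = trans (⟦y⟧-* w k zero i) (Y.t-⊗-zero (w k) i)

  ⟦y⟧-*-suc : ∀ w k j i → (⟦ y ⟧ Z.⊗ w) k (suc j) i ≈ w k j i
  ⟦y⟧-*-suc w k j i = trans (⟦y⟧-* w k (suc j) i) (Y.t-⊗-suc (w k) j i)

  ⟦z⟧-*-zero : ∀ w j i → (⟦ z ⟧ Z.⊗ w) zero j i ≈ 0#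
  ⟦z⟧-*-zero w j i = trans (R₃.*-congʳ {w} (coefficients-X K[[x,y]] homo₂) zero j i) (Z.t-⊗-zero w j i)

  ⟦z⟧-*-suc : ∀ w k j i → (⟦ z ⟧ Z.⊗ w) (suc k) j i ≈ w k j i
  ⟦z⟧-*-suc w k j i = trans (R₃.*-congʳ {w} (coefficients-X K[[x,y]] homo₂) (suc k) j i) (Z.t-⊗-suc w k j i)

  at : ℕ → ℕ → ℕ → T.Series → Series
  at k j i W n = W n k j i

  lift : Series → T.Series
  lift φ n = ⟦ constᵖ (φ n) ⟧

  ∑-at : ∀ n a k j i → T.∑< n a k j i ≈ ∑< n (λ m → a m k j i)
  ∑-at zero    a k j i = refl
  ∑-at (suc n) a k j i = +-congʳ (∑-at n a k j i)

  ⊗-at : ∀ U V n k j i → (U T.⊗ V) n k j i ≈ ∑< (suc n) (λ p → (U p Z.⊗ V (n ℕ.∸ p)) k j i)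
  ⊗-at U V n k j i = trans (sym (T.⊗-def U V n k j i)) (∑-at (suc n) _ k j i)

  -- Extracting a monomial is linear over K[[t]]. This is what reduces A and the powers of H to
  -- one-variable series.
  lift-⊗ : ∀ φ W k j i → at k j i (lift φ T.⊗ W) ≈ˢ φ ⊗ at k j i W
  lift-⊗ φ W k j i n = begin
    (lift φ T.⊗ W) n k j i                                         ≈⟨ ⊗-at (lift φ) W n k j i ⟩
    ∑< (suc n) (λ p → (lift φ p Z.⊗ W (n ℕ.∸ p)) k j i)            ≈⟨ ∑-cong (suc n) (λ p _ → ⟦const⟧-* (φ p) (W (n ℕ.∸ p)) k j i) ⟩
    (φ *ˢ at k j i W) n                                            ≈⟨ ⊗-def φ (at k j i W) n ⟩
    (φ ⊗ at k j i W) n                                             ∎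

  lift^-⊗ : ∀ φ m W k j i → at k j i (lift φ T.^ m T.⊗ W) ≈ˢ φ ^ m ⊗ at k j i W
  lift^-⊗ φ zero    W k j i n = trans (T.⊗-identityˡ W n k j i) (sym (⊗-identityˡ (at k j i W) n))
  lift^-⊗ φ (suc m) W k j i n = begin
    (lift φ T.⊗ lift φ T.^ m T.⊗ W) n k j i       ≈⟨ T.⊗-assoc (lift φ) (lift φ T.^ m) W n k j i ⟩
    (lift φ T.⊗ (lift φ T.^ m T.⊗ W)) n k j i     ≈⟨ lift-⊗ φ (lift φ T.^ m T.⊗ W) k j i n ⟩
    (φ ⊗ at k j i (lift φ T.^ m T.⊗ W)) n         ≈⟨ ⊗-cong {f = φ} (λ _ → refl) (lift^-⊗ φ m W k j i) n ⟩
    (φ ⊗ (φ ^ m ⊗ at k j i W)) n                  ≈⟨ ⊗-assoc φ (φ ^ m) (at k j i W) n ⟨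
    (φ ⊗ φ ^ m ⊗ at k j i W) n                    ∎

  lift-⊙ : ∀ φ W n k j i → (lift φ T.⊙ W) n k j i ≈ ∑< (suc n) (λ m → φ m * (W T.^ m) n k j i)
  lift-⊙ φ W n k j i = begin
    (lift φ T.⊙ W) n k j i                                        ≈⟨ T.⊙-∑ (lift φ) W n k j i ⟨
    T.∑< (suc n) (λ m → lift φ m Z.⊗ (W T.^ m) n) k j i           ≈⟨ ∑-at (suc n) _ k j i ⟩
    ∑< (suc n) (λ m → (lift φ m Z.⊗ (W T.^ m) n) k j i)           ≈⟨ ∑-cong (suc n) (λ m _ → ⟦const⟧-* (φ m) ((W T.^ m) n) k j i) ⟩
    ∑< (suc n) (λ m → φ m * (W T.^ m) n k j i)                    ∎

  const-⊗-at : ∀ p W n k j i → (T.constˢ ⟦ p ⟧ T.⊗ W) n k j i ≈ (⟦ p ⟧ Z.⊗ W n) k j i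
  const-⊗-at p W n k j i = T.const-⊗ ⟦ p ⟧ W n k j i

  ⊗-scale : ∀ f a g → f ⊗ (λ n → a * g n) ≈ˢ λ n → a * (f ⊗ g) n
  ⊗-scale f a g n = trans (⊗-comm f _ n) (trans (scale-⊗ a g f n) (*-congˡ (⊗-comm g f n)))

  n·1*a≈n·a : ∀ n a → (n · 1#) * a ≈ n · a
  n·1*a≈n·a n a = trans (·-assoc-* n 1# a) (·-congʳ n (*-identityˡ a))

  fact-cancel : ∀ n → (suc n · 1#) * 1/fact (suc n) ≈ 1/fact n
  fact-cancel n = trans (sym (*-assoc _ _ _)) (trans (*-congʳ (inv-inverse (suc n · 1#) (characteristic-zero n))) (*-identityˡ _))

  1/suc-cancel : ∀ n a → 1/suc n * ((suc n · 1#) * a) ≈ a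
  1/suc-cancel n a = trans (sym (*-assoc _ _ _)) (trans (*-congʳ (trans (*-comm _ _) (inv-inverse (suc n · 1#) (characteristic-zero n)))) (*-identityˡ _))

  -- 1/(i!² j! k!) and 2i + j + rk: the coefficient of xⁱyʲzᵏ in C₀(-xH²) exp(yH + zHʳ)
  -- is weight k j i times H to the power degree r k j i.
  weight : ℕ → ℕ → ℕ → Carrier
  weight k j i = (1/fact i * 1/fact i) * (1/fact j * 1/fact k)

  degree : ℕ → ℕ → ℕ → ℕ → ℕ
  degree r k j i = i ℕ.* 2 ℕ.+ (j ℕ.+ k ℕ.* r)

  module _ (H : Series) where

    -- The name omits the minus sign, which the signs in C₀ cancel.
    xH² : T.Series
    xH² = T.-ˢ (T.constˢ ⟦ x ⟧ T.⊗ lift H T.^ 2)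

    private
      -- The coefficient of xⁱyʲzᵏ in xᵐ, defined by shifting so that it follows multiplication by x
      -- without deciding m = i.
      δ : ℕ → ℕ → ℕ → ℕ → Carrier
      δ zero    k j i       = R₃.1# k j i
      δ (suc m) k j zero    = 0#
      δ (suc m) k j (suc i) = δ m k j i

      δ-off : ∀ m k j i → m ≢ i → δ m k j i ≈ 0#
      δ-off zero    k       j       zero    0≢0 = ⊥-elim (0≢0 ≡.refl)
      δ-off zero    zero    zero    (suc i) _   = refl
      δ-off zero    zero    (suc j) (suc i) _   = refl
      δ-off zero    (suc k) j       (suc i) _   = refl
      δ-off (suc m) k       j       zero    _   = refl
      δ-off (suc m) k       j       (suc i) m≢i = δ-off m k j i (m≢i ∘ ≡.cong suc)

      δ-diagonal : ∀ i k j → δ i k j i ≈ R₃.1# k j zero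
      δ-diagonal zero    k j = refl
      δ-diagonal (suc i) k j = δ-diagonal i k j

      xH²-^suc : ∀ m n k j i → (xH² T.^ suc m) n k j i ≈ - (t ⊗ λ i′ → (H ^ 2 ⊗ at k j i′ (xH² T.^ m)) n) i
      xH²-^suc m n k j i = begin
        (xH² T.⊗ P) n k j i
          ≈⟨ RingProperties.-‿distribˡ-* 𝕋.ring (T.constˢ ⟦ x ⟧ T.⊗ L) P n k j i ⟨
        - (T.constˢ ⟦ x ⟧ T.⊗ L T.⊗ P) n k j i
          ≈⟨ -‿cong (T.⊗-assoc (T.constˢ ⟦ x ⟧) L P n k j i) ⟩
        - (T.constˢ ⟦ x ⟧ T.⊗ (L T.⊗ P)) n k j i
          ≈⟨ -‿cong (const-⊗-at x (L T.⊗ P) n k j i) ⟩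
        - (⟦ x ⟧ Z.⊗ (L T.⊗ P) n) k j i
          ≈⟨ -‿cong (⟦x⟧-* ((L T.⊗ P) n) k j i) ⟩
        - (t ⊗ (L T.⊗ P) n k j) i
          ≈⟨ -‿cong (⊗-cong {f = t} (λ _ → refl) (λ i′ → lift^-⊗ H 2 P k j i′ n) i) ⟩
        - (t ⊗ λ i′ → (H ^ 2 ⊗ at k j i′ P) n) i  ∎
        where
        L = lift H T.^ 2
        P = xH² T.^ m

      -- The sign of C₀ stays attached to the power, so that the two minus signs of each new factor
      -- cancel within the induction.
      xH²-^ : ∀ m k j i n → [-1]^ m * (xH² T.^ m) n k j i ≈ δ m k j i * (H ^ (m ℕ.* 2)) n
      xH²-^ zero    k j i n = trans (*-identityˡ _) (one n)
        where
        one : ∀ n → T.1ˢ n k j i ≈ R₃.1# k j i * 1ˢ n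
        one zero    = sym (*-identityʳ _)
        one (suc n) = sym (zeroʳ _)
      xH²-^ (suc m) k j zero n = begin
        - [-1]^ m * (xH² T.^ suc m) n k j zero   ≈⟨ *-congˡ (xH²-^suc m n k j zero) ⟩
        - [-1]^ m * - (t ⊗ _) zero               ≈⟨ *-congˡ (trans (-‿cong (t-⊗-zero _)) -0#≈0#) ⟩
        - [-1]^ m * 0#                           ≈⟨ zeroʳ _ ⟩
        0#                                       ≈⟨ zeroˡ _ ⟨
        0# * (H ^ (suc m ℕ.* 2)) n               ∎
      xH²-^ (suc m) k j (suc i) n = begin
        - [-1]^ m * (xH² T.^ suc m) n k j (suc i)
          ≈⟨ *-congˡ (trans (xH²-^suc m n k j (suc i)) (-‿cong (t-⊗-suc _ i))) ⟩
        - [-1]^ m * - (H ^ 2 ⊗ at k j i (xH² T.^ m)) n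
          ≈⟨ trans (sym (-‿distribˡ-* _ _)) (trans (-‿cong (sym (-‿distribʳ-* _ _))) (-‿involutive _)) ⟩
        [-1]^ m * (H ^ 2 ⊗ at k j i (xH² T.^ m)) n
          ≈⟨ ⊗-scale (H ^ 2) ([-1]^ m) (at k j i (xH² T.^ m)) n ⟨
        (H ^ 2 ⊗ λ l → [-1]^ m * (xH² T.^ m) l k j i) n
          ≈⟨ ⊗-cong {f = H ^ 2} (λ _ → refl) (xH²-^ m k j i) n ⟩
        (H ^ 2 ⊗ λ l → δ m k j i * (H ^ (m ℕ.* 2)) l) n
          ≈⟨ ⊗-scale (H ^ 2) (δ m k j i) (H ^ (m ℕ.* 2)) n ⟩
        δ m k j i * (H ^ 2 ⊗ H ^ (m ℕ.* 2)) n
          ≈⟨ *-congˡ (^-homo-+ H 2 (m ℕ.* 2) n) ⟨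
        δ m k j i * (H ^ (suc m ℕ.* 2)) n  ∎

    C₀-coefficient : ℕ → Series
    C₀-coefficient n i = (1/fact i * 1/fact i) * (H ^ (i ℕ.* 2)) n

    -- Only the term m = i reaches xⁱ. If i lies beyond the cutoff n, that term is absent from the
    -- sum, but H²ⁱ has no coefficient in degree n either.
    C₀-closed : H 0 ≈ 0# → ∀ n → (lift C₀ T.⊙ xH²) n R₃.≈ PowerSeries.constˢ R₂.rawRing (PowerSeries.constˢ R₁.rawRing (C₀-coefficient n))
    C₀-closed H0 n k j i = begin
      (lift C₀ T.⊙ xH²) n k j i
        ≈⟨ lift-⊙ C₀ xH² n k j i ⟩
      ∑< (suc n) (λ m → C₀ m * (xH² T.^ m) n k j i)
        ≈⟨ ∑-cong (suc n) (λ m _ → term m) ⟩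
      ∑< (suc n) (λ m → δ m k j i * C₀-coefficient n m)
        ≈⟨ ∑-single (suc n) i (λ m m≢i → trans (*-congʳ (δ-off m k j i m≢i)) (zeroˡ _))
             (λ n<i → trans (*-congˡ (trans (*-congˡ (^-vanishes H H0 (i ℕ.* 2) n (ℕₚ.≤-trans n<i (ℕₚ.m≤m*n i 2)))) (zeroʳ _))) (zeroʳ _)) ⟩
      δ i k j i * C₀-coefficient n i
        ≈⟨ *-congʳ (δ-diagonal i k j) ⟩
      R₃.1# k j zero * C₀-coefficient n i
        ≈⟨ constant k j ⟩
      PowerSeries.constˢ R₂.rawRing (PowerSeries.constˢ R₁.rawRing (C₀-coefficient n)) k j i  ∎
      where
      term : ∀ m → C₀ m * (xH² T.^ m) n k j i ≈ δ m k j i * C₀-coefficient n m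
      term m = trans (S.solve 3 (λ s f p → s S.:* f S.:* p S.:= f S.:* (s S.:* p)) refl ([-1]^ m) (1/fact m * 1/fact m) _)
        (trans (*-congˡ (xH²-^ m k j i n)) (S.solve 3 (λ f d h → f S.:* (d S.:* h) S.:= d S.:* (f S.:* h)) refl _ _ _))
      constant : ∀ k j → R₃.1# k j zero * C₀-coefficient n i ≈ PowerSeries.constˢ R₂.rawRing (PowerSeries.constˢ R₁.rawRing (C₀-coefficient n)) k j i
      constant zero    zero    = *-identityˡ _
      constant zero    (suc j) = zeroˡ _
      constant (suc k) j       = zeroˡ _

    module _ (r : ℕ) where

      yH+zHʳ : T.Series
      yH+zHʳ = T.constˢ ⟦ y ⟧ T.⊗ lift H T.+ˢ T.constˢ ⟦ z ⟧ T.⊗ lift H T.^ r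

      private
        -- Pascal's triangle: b m k j is the coefficient of yʲzᵏ in (y + z)ᵐ.
        b bʸ bᶻ : ℕ → ℕ → ℕ → ℕ → Carrier
        b zero    k       j       i = R₃.1# k j i
        b (suc m) k       j       i = bʸ m k j i + bᶻ m k j i
        bʸ m      k       zero    i = 0#
        bʸ m      k       (suc j) i = b m k j i
        bᶻ m      zero    j       i = 0#
        bᶻ m      (suc k) j       i = b m k j i

        b-off : ∀ m k j i → m ≢ j ℕ.+ k → b m k j i ≈ 0#
        b-off zero    zero    zero    i 0≢0 = ⊥-elim (0≢0 ≡.refl)
        b-off zero    zero    (suc j) i _   = refl
        b-off zero    (suc k) j       i _   = refl
        b-off (suc m) k       j       i m≢  = trans (+-cong (offʸ j m≢) (offᶻ k m≢)) (+-identityˡ 0#)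
          where
          offʸ : ∀ j → suc m ≢ j ℕ.+ k → bʸ m k j i ≈ 0#
          offʸ zero    _  = refl
          offʸ (suc j) m≢ = b-off m k j i (m≢ ∘ ≡.cong suc)
          offᶻ : ∀ k → suc m ≢ j ℕ.+ k → bᶻ m k j i ≈ 0#
          offᶻ zero    _  = refl
          offᶻ (suc k) m≢ = b-off m k j i (λ e → m≢ (≡.trans (≡.cong suc e) (≡.sym (ℕₚ.+-suc j k))))

        -- Divided by m!, the two neighbours in Pascal's triangle contribute j w and k w with w =
        -- 1/(j! k!), and j + k = m + 1 cancels 1/(m + 1).
        b-value : ∀ m k j i → m ≡ j ℕ.+ k → 1/fact m * b m k j i ≈ (1/fact j * 1/fact k) * 1ˢ i
        b-value zero    zero    zero    i _ = trans (*-identityˡ _) (sym (trans (*-congʳ (*-identityˡ _)) (*-identityˡ _)))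
        b-value (suc m) k       j       i e = begin
          1/suc m * 1/fact m * (bʸ m k j i + bᶻ m k j i)
            ≈⟨ S.solve 4 (λ s f u v → s S.:* f S.:* (u S.:+ v) S.:= s S.:* (f S.:* u S.:+ f S.:* v)) refl _ _ _ _ ⟩
          1/suc m * (1/fact m * bʸ m k j i + 1/fact m * bᶻ m k j i)
            ≈⟨ *-congˡ (+-cong (valueʸ j e) (valueᶻ k e)) ⟩
          1/suc m * ((j · 1#) * w + (k · 1#) * w)
            ≈⟨ *-congˡ (trans (*-congʳ (·-homo-+ 1# j k)) (distribʳ w _ _)) ⟨
          1/suc m * (((j ℕ.+ k) · 1#) * w)
            ≡⟨ ≡.cong (λ l → 1/suc m * ((l · 1#) * w)) e ⟨
          1/suc m * ((suc m · 1#) * w)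
            ≈⟨ 1/suc-cancel m w ⟩
          w  ∎
          where
          w = (1/fact j * 1/fact k) * 1ˢ i
          valueʸ : ∀ j → suc m ≡ j ℕ.+ k → 1/fact m * bʸ m k j i ≈ (j · 1#) * ((1/fact j * 1/fact k) * 1ˢ i)
          valueʸ zero    _ = trans (zeroʳ _) (sym (zeroˡ _))
          valueʸ (suc j) e = begin
            1/fact m * b m k j i                                            ≈⟨ b-value m k j i (ℕₚ.suc-injective e) ⟩
            1/fact j * 1/fact k * 1ˢ i                                      ≈⟨ *-congʳ (*-congʳ (fact-cancel j)) ⟨
            (suc j · 1#) * 1/fact (suc j) * 1/fact k * 1ˢ i                 ≈⟨ S.solve 4 (λ a b c d → a S.:* b S.:* c S.:* d S.:= a S.:* (b S.:* c S.:* d)) refl _ _ _ _ ⟩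
            (suc j · 1#) * (1/fact (suc j) * 1/fact k * 1ˢ i)               ∎
          valueᶻ : ∀ k → suc m ≡ j ℕ.+ k → 1/fact m * bᶻ m k j i ≈ (k · 1#) * ((1/fact j * 1/fact k) * 1ˢ i)
          valueᶻ zero    _ = trans (zeroʳ _) (sym (zeroˡ _))
          valueᶻ (suc k) e = begin
            1/fact m * b m k j i                                            ≈⟨ b-value m k j i (ℕₚ.suc-injective (≡.trans e (ℕₚ.+-suc j k))) ⟩
            1/fact j * 1/fact k * 1ˢ i                                      ≈⟨ *-congʳ (*-congˡ (fact-cancel k)) ⟨
            1/fact j * ((suc k · 1#) * 1/fact (suc k)) * 1ˢ i               ≈⟨ S.solve 4 (λ a b c d → a S.:* (b S.:* c) S.:* d S.:= b S.:* (a S.:* c S.:* d)) refl _ _ _ _ ⟩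
            (suc k · 1#) * (1/fact j * 1/fact (suc k) * 1ˢ i)               ∎

        -- Each y brings a factor H and each z a factor Hʳ, so the power of H depends on the
        -- monomial alone and not on the path through Pascal's triangle.
        yH+zHʳ-^ : ∀ m k j i → at k j i (yH+zHʳ T.^ m) ≈ˢ λ n → b m k j i * (H ^ (j ℕ.+ k ℕ.* r)) n
        yH+zHʳ-^ zero    zero    zero    i zero    = sym (*-identityʳ _)
        yH+zHʳ-^ zero    zero    zero    i (suc n) = sym (zeroʳ _)
        yH+zHʳ-^ zero    zero    (suc j) i zero    = sym (zeroˡ _)
        yH+zHʳ-^ zero    zero    (suc j) i (suc n) = sym (zeroˡ _)
        yH+zHʳ-^ zero    (suc k) j       i zero    = sym (zeroˡ _)
        yH+zHʳ-^ zero    (suc k) j       i (suc n) = sym (zeroˡ _)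
        yH+zHʳ-^ (suc m) k j i n = begin
          (yH+zHʳ T.⊗ P) n k j i
            ≈⟨ 𝕋.distribʳ P (T.constˢ ⟦ y ⟧ T.⊗ lift H) (T.constˢ ⟦ z ⟧ T.⊗ lift H T.^ r) n k j i ⟩
          (T.constˢ ⟦ y ⟧ T.⊗ lift H T.⊗ P) n k j i + (T.constˢ ⟦ z ⟧ T.⊗ lift H T.^ r T.⊗ P) n k j i
            ≈⟨ +-cong (trans (T.⊗-assoc (T.constˢ ⟦ y ⟧) (lift H) P n k j i) (const-⊗-at y (lift H T.⊗ P) n k j i))
                      (trans (T.⊗-assoc (T.constˢ ⟦ z ⟧) (lift H T.^ r) P n k j i) (const-⊗-at z (lift H T.^ r T.⊗ P) n k j i)) ⟩
          (⟦ y ⟧ Z.⊗ (lift H T.⊗ P) n) k j i + (⟦ z ⟧ Z.⊗ (lift H T.^ r T.⊗ P) n) k j i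
            ≈⟨ +-cong (partʸ j) (partᶻ k) ⟩
          bʸ m k j i * (H ^ q) n + bᶻ m k j i * (H ^ q) n
            ≈⟨ distribʳ _ _ _ ⟨
          b (suc m) k j i * (H ^ q) n  ∎
          where
          P = yH+zHʳ T.^ m
          q = j ℕ.+ k ℕ.* r
          partʸ : ∀ j → (⟦ y ⟧ Z.⊗ (lift H T.⊗ P) n) k j i ≈ bʸ m k j i * (H ^ (j ℕ.+ k ℕ.* r)) n
          partʸ zero    = trans (⟦y⟧-*-zero _ k i) (sym (zeroˡ _))
          partʸ (suc j) = begin
            (⟦ y ⟧ Z.⊗ (lift H T.⊗ P) n) k (suc j) i                    ≈⟨ ⟦y⟧-*-suc _ k j i ⟩
            (lift H T.⊗ P) n k j i                                      ≈⟨ lift-⊗ H P k j i n ⟩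
            (H ⊗ at k j i P) n                                          ≈⟨ ⊗-cong {f = H} (λ _ → refl) (yH+zHʳ-^ m k j i) n ⟩
            (H ⊗ λ l → b m k j i * (H ^ (j ℕ.+ k ℕ.* r)) l) n           ≈⟨ ⊗-scale H (b m k j i) (H ^ (j ℕ.+ k ℕ.* r)) n ⟩
            b m k j i * (H ^ (suc j ℕ.+ k ℕ.* r)) n                     ∎
          partᶻ : ∀ k → (⟦ z ⟧ Z.⊗ (lift H T.^ r T.⊗ P) n) k j i ≈ bᶻ m k j i * (H ^ (j ℕ.+ k ℕ.* r)) n
          partᶻ zero    = trans (⟦z⟧-*-zero _ j i) (sym (zeroˡ _))
          partᶻ (suc k) = begin
            (⟦ z ⟧ Z.⊗ (lift H T.^ r T.⊗ P) n) (suc k) j i              ≈⟨ ⟦z⟧-*-suc _ k j i ⟩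
            (lift H T.^ r T.⊗ P) n k j i                                ≈⟨ lift^-⊗ H r P k j i n ⟩
            (H ^ r ⊗ at k j i P) n                                      ≈⟨ ⊗-cong {f = H ^ r} (λ _ → refl) (yH+zHʳ-^ m k j i) n ⟩
            (H ^ r ⊗ λ l → b m k j i * (H ^ (j ℕ.+ k ℕ.* r)) l) n       ≈⟨ ⊗-scale (H ^ r) (b m k j i) (H ^ (j ℕ.+ k ℕ.* r)) n ⟩
            b m k j i * (H ^ r ⊗ H ^ (j ℕ.+ k ℕ.* r)) n                 ≈⟨ *-congˡ (^-homo-+ H r (j ℕ.+ k ℕ.* r) n) ⟨
            b m k j i * (H ^ (r ℕ.+ (j ℕ.+ k ℕ.* r))) n                 ≡⟨ ≡.cong (λ l → b m k j i * (H ^ l) n) (exponent (k ℕ.* r)) ⟩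
            b m k j i * (H ^ (j ℕ.+ suc k ℕ.* r)) n                     ∎
            where
            exponent : ∀ l → r ℕ.+ (j ℕ.+ l) ≡ j ℕ.+ (r ℕ.+ l)
            exponent l = ≡.trans (≡.sym (ℕₚ.+-assoc r j l)) (≡.trans (≡.cong (ℕ._+ l) (ℕₚ.+-comm r j)) (ℕₚ.+-assoc j r l))

      -- Only m = j + k contributes. When n < j + k the cutoff removes this term; as r ≥ 1, the
      -- exponent j + kr then exceeds n too and the coefficient of the power of H vanishes.
      exp-closed : H 0 ≈ 0# → 1 ≤ r → ∀ n k j → (lift expˢ T.⊙ yH+zHʳ) n k j R₁.≈ constˢ ((1/fact j * 1/fact k) * (H ^ (j ℕ.+ k ℕ.* r)) n)
      exp-closed H0 1≤r n k j i = begin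
        (lift expˢ T.⊙ yH+zHʳ) n k j i
          ≈⟨ lift-⊙ expˢ yH+zHʳ n k j i ⟩
        ∑< (suc n) (λ m → 1/fact m * (yH+zHʳ T.^ m) n k j i)
          ≈⟨ ∑-cong (suc n) (λ m _ → trans (*-congˡ (yH+zHʳ-^ m k j i n)) (sym (*-assoc _ _ _))) ⟩
        ∑< (suc n) (λ m → 1/fact m * b m k j i * (H ^ q) n)
          ≈⟨ ∑-single (suc n) (j ℕ.+ k) (λ m m≢ → trans (*-congʳ (trans (*-congˡ (b-off m k j i m≢)) (zeroʳ _))) (zeroˡ _))
               (λ n<j+k → trans (*-congˡ (^-vanishes H H0 q n (ℕₚ.≤-trans n<j+k (ℕₚ.+-monoʳ-≤ j (ℕₚ.m≤m*n k r {{ℕ.>-nonZero 1≤r}}))))) (zeroʳ _)) ⟩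
        1/fact (j ℕ.+ k) * b (j ℕ.+ k) k j i * (H ^ q) n
          ≈⟨ *-congʳ (b-value (j ℕ.+ k) k j i ≡.refl) ⟩
        1/fact j * 1/fact k * 1ˢ i * (H ^ q) n
          ≈⟨ constant i ⟩
        constˢ ((1/fact j * 1/fact k) * (H ^ q) n) i  ∎
        where
        q = j ℕ.+ k ℕ.* r
        constant : ∀ i → 1/fact j * 1/fact k * 1ˢ i * (H ^ q) n ≈ constˢ ((1/fact j * 1/fact k) * (H ^ q) n) i
        constant zero    = *-congʳ (*-identityʳ _)
        constant (suc i) = trans (*-congʳ (zeroʳ _)) (zeroˡ _)

      -- The first factor involves x alone and the second y and z alone, so no sum over monomials
      -- arises; only the product in t remains.
      product-closed : H 0 ≈ 0# → 1 ≤ r → ∀ k j i → at k j i ((lift C₀ T.⊙ xH²) T.⊗ (lift expˢ T.⊙ yH+zHʳ)) ≈ˢ λ n → weight k j i * (H ^ degree r k j i) n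
      product-closed H0 1≤r k j i n = begin
        (Cx T.⊗ Ex) n k j i
          ≈⟨ ⊗-at Cx Ex n k j i ⟩
        ∑< (suc n) (λ p → (Cx p Z.⊗ Ex (n ℕ.∸ p)) k j i)
          ≈⟨ ∑-cong (suc n) (λ p _ → term p (n ℕ.∸ p)) ⟩
        ∑< (suc n) (λ p → weight k j i * ((H ^ (i ℕ.* 2)) p * (H ^ (j ℕ.+ k ℕ.* r)) (n ℕ.∸ p)))
          ≈⟨ *-∑ (suc n) (weight k j i) _ ⟨
        weight k j i * (H ^ (i ℕ.* 2) *ˢ H ^ (j ℕ.+ k ℕ.* r)) n
          ≈⟨ *-congˡ (trans (⊗-def (H ^ (i ℕ.* 2)) (H ^ (j ℕ.+ k ℕ.* r)) n) (sym (^-homo-+ H (i ℕ.* 2) (j ℕ.+ k ℕ.* r) n))) ⟩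
        weight k j i * (H ^ degree r k j i) n  ∎
        where
        Cx = lift C₀ T.⊙ xH²
        Ex = lift expˢ T.⊙ yH+zHʳ
        term : ∀ p q → (Cx p Z.⊗ Ex q) k j i ≈ weight k j i * ((H ^ (i ℕ.* 2)) p * (H ^ (j ℕ.+ k ℕ.* r)) q)
        term p q = begin
          (Cx p Z.⊗ Ex q) k j i
            ≈⟨ R₃.*-congʳ {Ex q} (C₀-closed H0 p) k j i ⟩
          (PowerSeries.constˢ R₂.rawRing (PowerSeries.constˢ R₁.rawRing (C₀-coefficient p)) Z.⊗ Ex q) k j i
            ≈⟨ trans (Z.const-⊗ _ (Ex q) k j i) (Y.const-⊗ _ (Ex q k) j i) ⟩
          (C₀-coefficient p ⊗ Ex q k j) i
            ≈⟨ R₁.*-congˡ {C₀-coefficient p} (exp-closed H0 1≤r q k j) i ⟩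
          (C₀-coefficient p ⊗ constˢ _) i
            ≈⟨ trans (⊗-comm (C₀-coefficient p) _ i) (const-⊗ _ (C₀-coefficient p) i) ⟩
          (1/fact j * 1/fact k) * (H ^ (j ℕ.+ k ℕ.* r)) q * ((1/fact i * 1/fact i) * (H ^ (i ℕ.* 2)) p)
            ≈⟨ S.solve 4 (λ a u b v → a S.:* u S.:* (b S.:* v) S.:= (b S.:* a) S.:* (v S.:* u)) refl _ _ _ _ ⟩
          weight k j i * ((H ^ (i ℕ.* 2)) p * (H ^ (j ℕ.+ k ℕ.* r)) q)  ∎

  generatingFunction-closed : ∀ f g r → 1 ≤ r → ∀ n k j i →
    ⟦ generatingFunction f g r n ⟧ k j i ≈
    weight k j i * (series (reciprocal (g ∘ᴵ (f ⁻¹))) ⊗ series (f ⁻¹) ^ degree r k j i) n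
  generatingFunction-closed f g r 1≤r n k j i = begin
    ⟦ generatingFunction f g r n ⟧ k j i
      ≈⟨ trans (*ˢ-homo K[[x,y,z]] ⟦⟧-homo (liftˢ A P.*ˢ Cp) Ep n k j i)
               (𝕋.*-cong (*ˢ-homo K[[x,y,z]] ⟦⟧-homo (liftˢ A) Cp) (𝕋.refl {⟦_⟧ ∘ Ep}) n k j i) ⟩
    (lift A T.⊗ (⟦_⟧ ∘ Cp) T.⊗ (⟦_⟧ ∘ Ep)) n k j i
      ≈⟨ T.⊗-assoc (lift A) (⟦_⟧ ∘ Cp) (⟦_⟧ ∘ Ep) n k j i ⟩
    (lift A T.⊗ ((⟦_⟧ ∘ Cp) T.⊗ (⟦_⟧ ∘ Ep))) n k j i
      ≈⟨ 𝕋.*-congˡ {lift A} (𝕋.*-cong Cp-image Ep-image) n k j i ⟩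
    (lift A T.⊗ ((lift C₀ T.⊙ xH² H) T.⊗ (lift expˢ T.⊙ yH+zHʳ H r))) n k j i
      ≈⟨ lift-⊗ A _ k j i n ⟩
    (A ⊗ at k j i ((lift C₀ T.⊙ xH² H) T.⊗ (lift expˢ T.⊙ yH+zHʳ H r))) n
      ≈⟨ ⊗-cong {f = A} (λ _ → refl) (product-closed H r refl 1≤r k j i) n ⟩
    (A ⊗ λ l → weight k j i * (H ^ degree r k j i) l) n
      ≈⟨ ⊗-scale A _ (H ^ degree r k j i) n ⟩
    weight k j i * (A ⊗ H ^ degree r k j i) n  ∎
    where
    module P = PowerSeries P₃.rawRing
    open RingMorphisms.IsRingHomomorphism ⟦⟧-homo using (-‿homo; +-homo)
    H = series (f ⁻¹)
    A = series (reciprocal (g ∘ᴵ (f ⁻¹)))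
    xHᵖ = P.constˢ x P.*ˢ liftˢ H P.^ˢ 2
    Cp = liftˢ C₀ P.∘ˢ (P.-ˢ xHᵖ)
    yHᵖ = P.constˢ y P.*ˢ liftˢ H
    zHᵖ = P.constˢ z P.*ˢ liftˢ H P.^ˢ r
    Ep = liftˢ expˢ P.∘ˢ (yHᵖ P.+ˢ zHᵖ)
    monomial : ∀ p m → ⟦_⟧ ∘ (P.constˢ p P.*ˢ liftˢ H P.^ˢ m) T.≈ˢ T.constˢ ⟦ p ⟧ T.⊗ lift H T.^ m
    monomial p m = 𝕋.trans (*ˢ-homo K[[x,y,z]] ⟦⟧-homo (P.constˢ p) (liftˢ H P.^ˢ m))
      (𝕋.*-cong (constˢ-homo K[[x,y,z]] ⟦⟧-homo p) (^ˢ-homo K[[x,y,z]] ⟦⟧-homo (liftˢ H) m))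
    Cp-image : ⟦_⟧ ∘ Cp T.≈ˢ lift C₀ T.⊙ xH² H
    Cp-image = 𝕋.trans (∘ˢ-homo K[[x,y,z]] ⟦⟧-homo (liftˢ C₀) (P.-ˢ xHᵖ))
      (T.⊙-congʳ (lift C₀) (λ n → R₃.trans (-‿homo (xHᵖ n)) (R₃.-‿cong (monomial x 2 n))))
    Ep-image : ⟦_⟧ ∘ Ep T.≈ˢ lift expˢ T.⊙ yH+zHʳ H r
    Ep-image = 𝕋.trans (∘ˢ-homo K[[x,y,z]] ⟦⟧-homo (liftˢ expˢ) (yHᵖ P.+ˢ zHᵖ))
      (T.⊙-congʳ (lift expˢ) (λ n → R₃.trans (+-homo (yHᵖ n) (zHᵖ n))
        (R₃.+-cong (𝕋.trans (*ˢ-homo K[[x,y,z]] ⟦⟧-homo (P.constˢ y) (liftˢ H))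
                             (𝕋.*-congʳ {lift H} (constˢ-homo K[[x,y,z]] ⟦⟧-homo y)) n)
                   (monomial z r n))))

-- Action of the operators on coefficients, and the iteration.

module Representation {c ℓ₁ ℓ₂} (K : CharacteristicZeroField c ℓ₁ ℓ₂) where
  private
    module K = CharacteristicZeroField K
  open K hiding (zero; rawRing)
  open Sheffer K
  open SeriesRing K.commutativeRing
  open SeriesCalculus K.commutativeRing
  open Composition K.commutativeRing
  open ShefferSeries K
  open ClosedForm K
  open Mult semiring using () renaming (×-homo-+ to ·-homo-+; ×-comm-* to ·-comm-*; ×-congʳ to ·-congʳ; ×-assocˡ to ·-assocˡ)
  open SetoidReasoning setoid
  private
    module S = Solver commutativeSemiring
    module 𝕊 = CommutativeRing seriesRing
    module SS = Solver 𝕊.commutativeSemiring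
    module P₁ = Polynomial K.rawRing
    module P₂ = Polynomial P₁.rawRing
    module P₃ = Polynomial P₂.rawRing
    module Sᵖ = PowerSeries P₃.rawRing
    module NS = +-*-Solver
    _·₁_ = RawMonoidDefs._×_ (RawRing.+-rawMonoid P₁.rawRing)
  open RingProperties ring using (-‿distribʳ-*)
  open RingProperties 𝕊.ring using () renaming (-‿distribˡ-* to -ˢ‿distribˡ-*; -‿distribʳ-* to -ˢ‿distribʳ-*)
  open RingMorphisms.IsRingHomomorphism ⟦⟧-homo using (+-homo; *-homo; -‿homo)

  -- Coefficients of the images of the operators

  ·-zeroʳ : ∀ n → n · 0# ≈ 0#
  ·-zeroʳ n = trans (sym (n·1*a≈n·a n 0#)) (zeroʳ _)

  ·ᵖ-coeff : ∀ n p k j i → ⟦ n ·ᵖ p ⟧ k j i ≈ n · ⟦ p ⟧ k j i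
  ·ᵖ-coeff zero    p k j i = refl
  ·ᵖ-coeff (suc n) p k j i = trans (+-homo p (n ·ᵖ p) k j i) (+-congˡ (·ᵖ-coeff n p k j i))

  ∑-coeff : ∀ n a k j i → ⟦ Sᵖ.∑< n a ⟧ k j i ≈ ∑< n (λ m → ⟦ a m ⟧ k j i)
  ∑-coeff zero    a k j i = refl
  ∑-coeff (suc n) a k j i = trans (+-homo (Sᵖ.∑< n a) (a n) k j i) (+-congʳ (∑-coeff n a k j i))

  constᵖ-coeff : ∀ a p k j i → ⟦ constᵖ a *ᵖ p ⟧ k j i ≈ a * ⟦ p ⟧ k j i
  constᵖ-coeff a p k j i = trans (*-homo (constᵖ a) p k j i) (⟦const⟧-* a ⟦ p ⟧ k j i)

  ∂y-coeff : ∀ p k j i → ⟦ ∂y p ⟧ k j i ≈ suc j · ⟦ p ⟧ k (suc j) i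
  ∂y-coeff []      k       j i = sym (·-zeroʳ (suc j))
  ∂y-coeff (p ∷ q) (suc k) j i = ∂y-coeff q k j i
  ∂y-coeff ([] ∷ q)      zero j i = sym (·-zeroʳ (suc j))
  ∂y-coeff ((a ∷ p) ∷ q) zero j i = scaleFrom-coeff 1 p j
    where
    +-coeff : ∀ p q i → P₁.coeff (p P₁.+ᴾ q) i ≈ P₁.coeff p i + P₁.coeff q i
    +-coeff []      q       i       = sym (+-identityˡ _)
    +-coeff (a ∷ p) []      i       = sym (+-identityʳ _)
    +-coeff (a ∷ p) (b ∷ q) zero    = refl
    +-coeff (a ∷ p) (b ∷ q) (suc i) = +-coeff p q i
    ·-coeff : ∀ n p → P₁.coeff (n ·₁ p) i ≈ n · P₁.coeff p i
    ·-coeff zero    p = refl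
    ·-coeff (suc n) p = trans (+-coeff p (n ·₁ p) i) (+-congˡ (·-coeff n p))
    scaleFrom-coeff : ∀ n p j → P₁.coeff (P₂.coeff (P₂.scaleFrom n p) j) i ≈ (n ℕ.+ j) · P₁.coeff (P₂.coeff p j) i
    scaleFrom-coeff n []      j       = sym (·-zeroʳ (n ℕ.+ j))
    scaleFrom-coeff n (a ∷ p) zero    = trans (·-coeff n a) (reflexive (≡.cong (_· P₁.coeff a i) (≡.sym (ℕₚ.+-identityʳ n))))
    scaleFrom-coeff n (a ∷ p) (suc j) = trans (scaleFrom-coeff (suc n) p j)
      (reflexive (≡.cong (_· P₁.coeff (P₂.coeff p j) i) (≡.sym (ℕₚ.+-suc n j))))

  Dx⁻¹-zero : ∀ p k j → ⟦ Dx⁻¹ p ⟧ k j zero ≈ 0#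
  Dx⁻¹-zero []            k       j       = refl
  Dx⁻¹-zero (p ∷ q)       (suc k) j       = Dx⁻¹-zero q k j
  Dx⁻¹-zero ([] ∷ q)      zero    j       = refl
  Dx⁻¹-zero ((a ∷ p) ∷ q) zero    zero    = refl
  Dx⁻¹-zero ((a ∷ p) ∷ q) zero    (suc j) = Dx⁻¹-zero (p ∷ q) zero j

  Dx⁻¹-suc : ∀ p k j i → ⟦ Dx⁻¹ p ⟧ k j (suc i) ≈ 1/suc i * ⟦ p ⟧ k j i
  Dx⁻¹-suc []            k       j       i = sym (zeroʳ _)
  Dx⁻¹-suc (p ∷ q)       (suc k) j       i = Dx⁻¹-suc q k j i
  Dx⁻¹-suc ([] ∷ q)      zero    j       i = sym (zeroʳ _)
  Dx⁻¹-suc ((a ∷ p) ∷ q) zero    (suc j) i = Dx⁻¹-suc (p ∷ q) zero j i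
  Dx⁻¹-suc ((a ∷ p) ∷ q) zero    zero    i = divideFrom-coeff 0 a i
    where
    divideFrom-coeff : ∀ n a i → P₁.coeff (divideFrom n a) i ≈ 1/suc (n ℕ.+ i) * P₁.coeff a i
    divideFrom-coeff n []      i       = sym (zeroʳ _)
    divideFrom-coeff n (b ∷ a) zero    = *-congʳ (reflexive (≡.cong 1/suc (≡.sym (ℕₚ.+-identityʳ n))))
    divideFrom-coeff n (b ∷ a) (suc i) = trans (divideFrom-coeff (suc n) a i)
      (*-congʳ (reflexive (≡.cong 1/suc (≡.sym (ℕₚ.+-suc n i)))))

  yLength : K[x,y,z] → ℕ
  yLength p = foldr ℕ._⊔_ 0 (map length p)

  VanishesFrom : ℕ → K[x,y,z] → Set ℓ₁
  VanishesFrom N p = ∀ k j i → N ≤ j → ⟦ p ⟧ k j i ≈ 0#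

  vanishesFrom-yLength : ∀ p → VanishesFrom (yLength p) p
  vanishesFrom-yLength []      k       j i _   = refl
  vanishesFrom-yLength (p ∷ q) (suc k) j i N≤j = vanishesFrom-yLength q k j i (ℕₚ.≤-trans (ℕₚ.m≤n⊔m (length p) (yLength q)) N≤j)
  vanishesFrom-yLength (p ∷ q) zero    j i N≤j = beyond p j (ℕₚ.≤-trans (ℕₚ.m≤m⊔n (length p) (yLength q)) N≤j)
    where
    beyond : ∀ p j → length p ≤ j → P₁.coeff (P₂.coeff p j) i ≈ 0#
    beyond []      j       _         = refl
    beyond (a ∷ p) (suc j) (s≤s p≤j) = beyond p j p≤j

  vanishesFrom-∂y^ : ∀ m {N p} → VanishesFrom N p → ∀ k j i → N ≤ m ℕ.+ j → ⟦ (∂y ^ᵒ m) p ⟧ k j i ≈ 0#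
  vanishesFrom-∂y^ zero    v = v
  vanishesFrom-∂y^ (suc m) {N} {p} v k j i N≤ = trans (∂y-coeff ((∂y ^ᵒ m) p) k j i)
    (trans (·-congʳ (suc j) (vanishesFrom-∂y^ m v k (suc j) i (≡.subst (N ≤_) (≡.sym (ℕₚ.+-suc m j)) N≤))) (·-zeroʳ (suc j)))

  -- Beyond its weight, a monomial enters only through q = 2i + j + rk, so an operator on
  -- polynomials becomes an operation on families of one-variable series indexed by q. The
  -- coefficient index n stays fixed while operators are composed.
  record Represents (r : ℕ) (V : ℕ → Series) (n : ℕ) (p : K[x,y,z]) : Set ℓ₁ where
    field
      coefficient : ∀ k j i → ⟦ p ⟧ k j i ≈ weight k j i * V (degree r k j i) n
  open Represents

  module _ (r′ : ℕ) where
    private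
      r = suc r′

    weight-y : ∀ k j i → (suc j · 1#) * weight k (suc j) i ≈ weight k j i
    weight-y k j i = trans (S.solve 4 (λ a b c d → a S.:* (b S.:* (c S.:* d)) S.:= b S.:* ((a S.:* c) S.:* d)) refl _ _ _ _)
      (*-congˡ (*-congʳ (fact-cancel j)))

    weight-z : ∀ k j i → (suc k · 1#) * weight (suc k) j i ≈ weight k j i
    weight-z k j i = trans (S.solve 4 (λ a b c d → a S.:* (b S.:* (c S.:* d)) S.:= b S.:* (c S.:* (a S.:* d))) refl _ _ _ _)
      (*-congˡ (*-congˡ (fact-cancel k)))

    -- The weight contains i! squared: cancelling i + 1 once leaves the divisor 1/(i + 1) produced
    -- by integration in x.
    weight-x : ∀ k j i → (suc i · 1#) * weight k j (suc i) ≈ 1/suc i * weight k j i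
    weight-x k j i = trans (S.solve 4 (λ a s f c → a S.:* ((s S.:* f) S.:* (s S.:* f) S.:* c) S.:= s S.:* ((a S.:* (s S.:* f)) S.:* f S.:* c)) refl _ _ _ _)
      (*-congˡ (*-congʳ (*-congʳ (fact-cancel i))))

    degree-y : ∀ k j i → degree r k (suc j) i ≡ suc (degree r k j i)
    degree-y k j i = ℕₚ.+-suc (i ℕ.* 2) (j ℕ.+ k ℕ.* r)

    -- One more z raises the degree by r; `∂y ^ᵒ r′` accounts for all of it but one.
    degree-z : ∀ k j i → degree r (suc k) j i ≡ suc (r′ ℕ.+ degree r k j i)
    degree-z k j i = NS.solve 4 (λ i j r′ k → i NS.:+ (j NS.:+ (NS.con 1 NS.:+ r′ NS.:+ k)) NS.:= NS.con 1 NS.:+ (r′ NS.:+ (i NS.:+ (j NS.:+ k)))) ≡.refl (i ℕ.* 2) j r′ (k ℕ.* r)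

    represents-∂y : ∀ {V n p} → Represents r V n p → Represents r (V ∘ suc) n (∂y p)
    represents-∂y {V} {n} {p} rep .coefficient k j i = begin
      ⟦ ∂y p ⟧ k j i
        ≈⟨ ∂y-coeff p k j i ⟩
      suc j · ⟦ p ⟧ k (suc j) i
        ≈⟨ n·1*a≈n·a (suc j) _ ⟨
      (suc j · 1#) * ⟦ p ⟧ k (suc j) i
        ≈⟨ *-congˡ (coefficient rep k (suc j) i) ⟩
      (suc j · 1#) * (weight k (suc j) i * V (degree r k (suc j) i) n)
        ≈⟨ *-assoc _ _ _ ⟨
      (suc j · 1#) * weight k (suc j) i * V (degree r k (suc j) i) n
        ≈⟨ *-cong (weight-y k j i) (reflexive (≡.cong (λ q → V q n) (degree-y k j i))) ⟩
      weight k j i * V (suc (degree r k j i)) n  ∎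

    represents-∂y^ : ∀ m {V n p} → Represents r V n p → Represents r (λ q → V (m ℕ.+ q)) n ((∂y ^ᵒ m) p)
    represents-∂y^ zero    rep = rep
    represents-∂y^ (suc m) {V} {n} rep .coefficient k j i =
      trans (coefficient (represents-∂y (represents-∂y^ m rep)) k j i)
            (*-congˡ (reflexive (≡.cong (λ q → V q n) (ℕₚ.+-suc m _))))

    represents-cong : ∀ {V V′ n p} → (∀ q → V q n ≈ V′ q n) → Represents r V n p → Represents r V′ n p
    represents-cong e rep .coefficient k j i = trans (coefficient rep k j i) (*-congˡ (e _))

    represents-unique : ∀ {V n p p′} → Represents r V n p → Represents r V n p′ → p ≈ᵖ p′
    represents-unique rep rep′ k j i = trans (coefficient rep k j i) (sym (coefficient rep′ k j i))

    represents-+ : ∀ {U V n p p′} → Represents r U n p → Represents r V n p′ → Represents r (λ q → U q +ˢ V q) n (p +ᵖ p′)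
    represents-+ {p = p} {p′} rep rep′ .coefficient k j i = trans (+-homo p p′ k j i) (trans (+-cong (coefficient rep k j i) (coefficient rep′ k j i)) (sym (distribˡ _ _ _)))

    represents-neg : ∀ {V n p} → Represents r V n p → Represents r (λ q → -ˢ V q) n (-ᵖ p)
    represents-neg {p = p} rep .coefficient k j i = trans (-‿homo p k j i) (trans (-‿cong (coefficient rep k j i)) (-‿distribʳ-* _ _))

    -- With r = `suc r′` the power r - 1 of ∂y involves no truncated subtraction.
    M : Operator
    M = multiplyBy y ⊕ 2 • (Dx⁻¹ ∘ ∂y) ⊕ r • (multiplyBy z ∘ (∂y ^ᵒ r′))

    module _ (H : Series) (H0 : H 0 ≈ 0#) where

      -- On the generating function ∂y acts as multiplication by H.
      represents-⟨∂y⟩ : ∀ φ {W n p} → Represents r (λ q → W ⊗ H ^ q) n p →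
                        Represents r (λ q → (φ ⊙ H) ⊗ W ⊗ H ^ q) n ((φ ⟨∂y⟩) p)
      represents-⟨∂y⟩ φ {W} {n} {p} rep .coefficient k j i = begin
        ⟦ (φ ⟨∂y⟩) p ⟧ k j i
          ≈⟨ ∑-coeff (yLength p) _ k j i ⟩
        ∑< (yLength p) (λ m → ⟦ constᵖ (φ m) *ᵖ (∂y ^ᵒ m) p ⟧ k j i)
          -- The operator stops at the y-length of `p`. Its m-th term also carries Hᵐ and so
          -- vanishes for m > n, which allows the cutoff that composition with H uses.
          ≈⟨ ∑-supports (yLength p) (suc n) beyond-degree beyond-n ⟩
        ∑< (suc n) (λ m → ⟦ constᵖ (φ m) *ᵖ (∂y ^ᵒ m) p ⟧ k j i)
          ≈⟨ ∑-cong (suc n) (λ m _ → trans (term m) (rearrange m)) ⟩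
        ∑< (suc n) (λ m → weight k j i * (φ m * ((W ⊗ H ^ q) ⊗ H ^ m) n))
          ≈⟨ *-∑ (suc n) (weight k j i) _ ⟨
        weight k j i * ∑< (suc n) (λ m → φ m * ((W ⊗ H ^ q) ⊗ H ^ m) n)
          ≈⟨ *-congˡ (⊗-⊙-∑ φ H H0 (W ⊗ H ^ q) n) ⟩
        weight k j i * ((W ⊗ H ^ q) ⊗ (φ ⊙ H)) n
          ≈⟨ *-congˡ (SS.solve 3 (λ w h f → (w SS.:* h) SS.:* f SS.:= f SS.:* w SS.:* h) 𝕊.refl W (H ^ q) (φ ⊙ H) n) ⟩
        weight k j i * ((φ ⊙ H) ⊗ W ⊗ H ^ q) n  ∎
        where
        q = degree r k j i
        term : ∀ m → ⟦ constᵖ (φ m) *ᵖ (∂y ^ᵒ m) p ⟧ k j i ≈ φ m * (weight k j i * (W ⊗ H ^ (m ℕ.+ q)) n)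
        term m = trans (constᵖ-coeff (φ m) ((∂y ^ᵒ m) p) k j i) (*-congˡ (coefficient (represents-∂y^ m rep) k j i))
        rearrange : ∀ m → φ m * (weight k j i * (W ⊗ H ^ (m ℕ.+ q)) n) ≈ weight k j i * (φ m * ((W ⊗ H ^ q) ⊗ H ^ m) n)
        rearrange m = trans (S.solve 3 (λ a b c → a S.:* (b S.:* c) S.:= b S.:* (a S.:* c)) refl _ _ _)
          (*-congˡ (*-congˡ (trans (𝕊.*-congˡ {W} (^-homo-+ H m q) n)
            (SS.solve 3 (λ w a b → w SS.:* (a SS.:* b) SS.:= (w SS.:* b) SS.:* a) 𝕊.refl W (H ^ m) (H ^ q) n))))
        beyond-degree : ∀ m → yLength p ≤ m → ⟦ constᵖ (φ m) *ᵖ (∂y ^ᵒ m) p ⟧ k j i ≈ 0#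
        beyond-degree m N≤m = trans (constᵖ-coeff (φ m) ((∂y ^ᵒ m) p) k j i) (trans (*-congˡ
          (vanishesFrom-∂y^ m (vanishesFrom-yLength p) k j i (ℕₚ.≤-trans N≤m (ℕₚ.m≤m+n m j)))) (zeroʳ _))
        beyond-n : ∀ m → suc n ≤ m → ⟦ constᵖ (φ m) *ᵖ (∂y ^ᵒ m) p ⟧ k j i ≈ 0#
        beyond-n m n<m = trans (term m) (trans (*-congˡ (trans (*-congˡ
          (⊗^-vanishes W H H0 (m ℕ.+ q) n (ℕₚ.≤-trans n<m (ℕₚ.m≤m+n m q)))) (zeroʳ _))) (zeroʳ _))

      -- The three summands contribute j, 2i and rk to the factor 2i + j + rk that
      -- differentiating H to this power produces.
      represents-M : ∀ {W n p} → Represents r (λ q → W ⊗ H ^ q) n p → Represents r (λ q → W ⊗ power′ H q) n (M p)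
      represents-M {W} {n} {p} rep .coefficient k j i = begin
        ⟦ M p ⟧ k j i
          ≈⟨ trans (+-homo (multiplyBy y p +ᵖ 2 ·ᵖ Dx⁻¹ (∂y p)) (r ·ᵖ multiplyBy z ((∂y ^ᵒ r′) p)) k j i)
                   (+-cong (+-homo (multiplyBy y p) (2 ·ᵖ Dx⁻¹ (∂y p)) k j i) (·ᵖ-coeff r (z *ᵖ (∂y ^ᵒ r′) p) k j i)) ⟩
        ⟦ y *ᵖ p ⟧ k j i + ⟦ 2 ·ᵖ Dx⁻¹ (∂y p) ⟧ k j i + r · ⟦ z *ᵖ (∂y ^ᵒ r′) p ⟧ k j i
          ≈⟨ +-cong (+-cong (part-y j) (trans (·ᵖ-coeff 2 (Dx⁻¹ (∂y p)) k j i) (·-congʳ 2 (part-x i)))) (·-congʳ r (part-z k)) ⟩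
        j · w q + 2 · (i · w q) + r · (k · w q)
          ≈⟨ +-cong (+-congˡ (trans (·-assocˡ (w q) 2 i) (reflexive (≡.cong (_· w q) (ℕₚ.*-comm 2 i)))))
                    (trans (·-assocˡ (w q) r k) (reflexive (≡.cong (_· w q) (ℕₚ.*-comm r k)))) ⟩
        j · w q + (i ℕ.* 2) · w q + (k ℕ.* r) · w q
          ≈⟨ S.solve 3 (λ a b c → a S.:+ b S.:+ c S.:= b S.:+ (a S.:+ c)) refl _ _ _ ⟩
        (i ℕ.* 2) · w q + (j · w q + (k ℕ.* r) · w q)
          ≈⟨ trans (·-homo-+ (w q) (i ℕ.* 2) _) (+-congˡ (·-homo-+ (w q) j (k ℕ.* r))) ⟨
        q · w q
          ≈⟨ total q ⟩
        weight k j i * (W ⊗ power′ H q) n  ∎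
        where
        -- The family at q - 1; the default 0 occurs only for q = 0, where its multiplier is 0.
        V⁻ : ℕ → Carrier
        V⁻ zero    = 0#
        V⁻ (suc q) = (W ⊗ H ^ q) n
        q = degree r k j i
        w : ℕ → Carrier
        w q = weight k j i * V⁻ q
        absorb : ∀ l v v′ a → (suc l · 1#) * v ≈ v′ → suc l · (v * a) ≈ v′ * a
        absorb l v v′ a e = trans (sym (n·1*a≈n·a (suc l) _)) (trans (sym (*-assoc _ _ _)) (*-congʳ e))
        part-y : ∀ j → ⟦ y *ᵖ p ⟧ k j i ≈ j · (weight k j i * V⁻ (degree r k j i))
        part-y zero    = trans (*-homo y p k zero i) (⟦y⟧-*-zero ⟦ p ⟧ k i)
        part-y (suc j) = begin
          ⟦ y *ᵖ p ⟧ k (suc j) i                                      ≈⟨ trans (*-homo y p k (suc j) i) (⟦y⟧-*-suc ⟦ p ⟧ k j i) ⟩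
          ⟦ p ⟧ k j i                                                 ≈⟨ coefficient rep k j i ⟩
          weight k j i * V⁻ (suc (degree r k j i))                    ≈⟨ absorb j _ _ _ (weight-y k j i) ⟨
          suc j · (weight k (suc j) i * V⁻ (suc (degree r k j i)))    ≡⟨ ≡.cong (λ q → suc j · (weight k (suc j) i * V⁻ q)) (degree-y k j i) ⟨
          suc j · (weight k (suc j) i * V⁻ (degree r k (suc j) i))    ∎
        part-x : ∀ i → ⟦ Dx⁻¹ (∂y p) ⟧ k j i ≈ i · (weight k j i * V⁻ (degree r k j i))
        part-x zero    = Dx⁻¹-zero (∂y p) k j
        part-x (suc i) = begin
          ⟦ Dx⁻¹ (∂y p) ⟧ k j (suc i)                                 ≈⟨ Dx⁻¹-suc (∂y p) k j i ⟩
          1/suc i * ⟦ ∂y p ⟧ k j i                                    ≈⟨ *-congˡ (coefficient (represents-∂y rep) k j i) ⟩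
          -- Going from index i + 1 to i lowers the degree by two and ∂y raises it by one, a net
          -- drop of one.
          1/suc i * (weight k j i * V⁻ (degree r k j (suc i)))        ≈⟨ *-assoc _ _ _ ⟨
          1/suc i * weight k j i * V⁻ (degree r k j (suc i))          ≈⟨ absorb i _ _ _ (weight-x k j i) ⟨
          suc i · (weight k j (suc i) * V⁻ (degree r k j (suc i)))    ∎
        part-z : ∀ k → ⟦ z *ᵖ (∂y ^ᵒ r′) p ⟧ k j i ≈ k · (weight k j i * V⁻ (degree r k j i))
        part-z zero    = trans (*-homo z ((∂y ^ᵒ r′) p) zero j i) (⟦z⟧-*-zero ⟦ (∂y ^ᵒ r′) p ⟧ j i)
        part-z (suc k) = begin
          ⟦ z *ᵖ (∂y ^ᵒ r′) p ⟧ (suc k) j i                           ≈⟨ trans (*-homo z ((∂y ^ᵒ r′) p) (suc k) j i) (⟦z⟧-*-suc ⟦ (∂y ^ᵒ r′) p ⟧ k j i) ⟩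
          ⟦ (∂y ^ᵒ r′) p ⟧ k j i                                      ≈⟨ coefficient (represents-∂y^ r′ rep) k j i ⟩
          weight k j i * V⁻ (suc (r′ ℕ.+ degree r k j i))             ≈⟨ absorb k _ _ _ (weight-z k j i) ⟨
          suc k · (weight (suc k) j i * V⁻ (suc (r′ ℕ.+ degree r k j i)))  ≡⟨ ≡.cong (λ q → suc k · (weight (suc k) j i * V⁻ q)) (degree-z k j i) ⟨
          suc k · (weight (suc k) j i * V⁻ (degree r (suc k) j i))    ∎
        total : ∀ q → q · w q ≈ weight k j i * (W ⊗ power′ H q) n
        total zero    = sym (trans (*-congˡ (𝕊.zeroʳ W n)) (zeroʳ _))
        total (suc q) = trans (sym (·-comm-* (suc q) _ _)) (*-congˡ (sym (⊗-· (suc q) W (H ^ q) n)))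

      private
        vanishAt0 : ∀ W k j i → 0 < degree r k j i → weight k j i * (W ⊗ H ^ degree r k j i) 0 ≈ 0#
        vanishAt0 W k j i 0<q = trans (*-congˡ (⊗^-vanishes W H H0 (degree r k j i) 0 0<q)) (zeroʳ _)

      -- At t = 0 all positive powers of H vanish, and as r ≥ 1 only the monomial 1 has degree 0.
      -- The cases are split until the degree computes to a successor.
      represents-1ᵖ : ∀ W → W 0 ≈ 1# → Represents r (λ q → W ⊗ H ^ q) 0 1ᵖ
      represents-1ᵖ W W0 .coefficient zero zero zero = sym (begin
        weight 0 0 0 * (W ⊗ 1ˢ) 0    ≈⟨ *-cong (*-cong (*-identityˡ 1#) (*-identityˡ 1#)) (trans (𝕊.*-identityʳ W 0) W0) ⟩
        1# * 1# * 1#                 ≈⟨ trans (*-identityʳ _) (*-identityˡ _) ⟩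
        1#                           ∎)
      represents-1ᵖ W W0 .coefficient zero    zero    (suc i) = sym (vanishAt0 W zero zero (suc i) (s≤s z≤n))
      represents-1ᵖ W W0 .coefficient zero    (suc j) (suc i) = sym (vanishAt0 W zero (suc j) (suc i) (s≤s z≤n))
      represents-1ᵖ W W0 .coefficient (suc k) j       (suc i) = sym (vanishAt0 W (suc k) j (suc i) (s≤s z≤n))
      represents-1ᵖ W W0 .coefficient zero    (suc j) zero    = sym (vanishAt0 W zero (suc j) zero (s≤s z≤n))
      represents-1ᵖ W W0 .coefficient (suc k) zero    zero    = sym (vanishAt0 W (suc k) zero zero (s≤s z≤n))
      represents-1ᵖ W W0 .coefficient (suc k) (suc j) zero    = sym (vanishAt0 W (suc k) (suc j) zero (s≤s z≤n))

  fact : ℕ → Carrier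
  fact zero    = 1#
  fact (suc n) = (suc n · 1#) * fact n

  fact-inverse : ∀ n → fact n * 1/fact n ≈ 1#
  fact-inverse zero    = *-identityˡ 1#
  fact-inverse (suc n) = begin
    (suc n · 1#) * fact n * (1/suc n * 1/fact n)     ≈⟨ S.solve 4 (λ a b c d → a S.:* b S.:* (c S.:* d) S.:= (a S.:* (c S.:* d)) S.:* b) refl _ _ _ _ ⟩
    (suc n · 1#) * 1/fact (suc n) * fact n           ≈⟨ *-congʳ (fact-cancel n) ⟩
    1/fact n * fact n                                ≈⟨ *-comm _ _ ⟩
    fact n * 1/fact n                                ≈⟨ fact-inverse n ⟩
    1#                                               ∎

  module _ (f : DeltaSeries) (g : InvertibleSeries) (r′ : ℕ) where
    private
      r = suc r′
      H A : Series
      H = series (f ⁻¹)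
      A = series (reciprocal (g ∘ᴵ (f ⁻¹)))

      -- The factor n! undoes the exponential normalisation, so that the coefficient of tⁿ belongs
      -- to the n-th polynomial itself.
      W : ℕ → Series
      W n = constˢ (fact n) ⊗ A

    -- The invariant of the iteration.
    IsTerm : ℕ → K[x,y,z] → Set ℓ₁
    IsTerm n = Represents r (λ q → W n ⊗ H ^ q) n

    -- The normalisation g(0) = 1 enters here: the constant term of g(H) A = 1 then gives A(0) = 1.
    isTerm-1ᵖ : series g 0 ≈ 1# → IsTerm 0 1ᵖ
    isTerm-1ᵖ g0 = represents-1ᵖ r′ H refl (W 0) (begin
      W 0 0                    ≈⟨ trans (const-⊗ 1# A 0) (*-identityˡ _) ⟩
      A 0                      ≈⟨ *-identityˡ _ ⟨
      1# * A 0                 ≈⟨ *-congʳ (trans (⊙-zero (series g) H refl) g0) ⟨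
      (series g ⊙ H) 0 * A 0   ≈⟨ ⊗-zero (series g ⊙ H) A ⟨
      ((series g ⊙ H) ⊗ A) 0   ≈⟨ g∘H-inverse f g 0 ⟩
      1#                       ∎)

    isTerm-generated : ∀ s → IsLegendreGouldHopperSheffer f g r s → ∀ n → IsTerm n (s n)
    isTerm-generated s gen n .coefficient k j i = begin
      ⟦ s n ⟧ k j i
        ≈⟨ *-identityˡ _ ⟨
      1# * ⟦ s n ⟧ k j i
        ≈⟨ *-congʳ (fact-inverse n) ⟨
      fact n * 1/fact n * ⟦ s n ⟧ k j i
        ≈⟨ *-assoc _ _ _ ⟩
      fact n * (1/fact n * ⟦ s n ⟧ k j i)
        ≈⟨ *-congˡ (constᵖ-coeff (1/fact n) (s n) k j i) ⟨
      fact n * ⟦ exponentialSeries s n ⟧ k j i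
        ≈⟨ *-congˡ (gen n k j i) ⟨
      fact n * ⟦ generatingFunction f g r n ⟧ k j i
        ≈⟨ *-congˡ (generatingFunction-closed f g r (s≤s z≤n) n k j i) ⟩
      fact n * (weight k j i * (A ⊗ H ^ q) n)
        ≈⟨ S.solve 3 (λ a b c → a S.:* (b S.:* c) S.:= b S.:* (a S.:* c)) refl _ _ _ ⟩
      weight k j i * (fact n * (A ⊗ H ^ q) n)
        ≈⟨ *-congˡ (trans (𝕊.*-assoc (constˢ (fact n)) A (H ^ q) n) (const-⊗ (fact n) (A ⊗ H ^ q) n)) ⟨
      weight k j i * (W n ⊗ H ^ q) n  ∎
      where q = degree r k j i

    -- (W Hᑫ)′ = W′ Hᑫ + W (Hᑫ)′, and the derivative moves the coefficient index from n + 1 to n.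
    isTerm-suc : ∀ n p → Represents r (λ q → deriv H ⊗ W n ⊗ power′ H q +ˢ deriv (W n) ⊗ H ^ q) n p → IsTerm (suc n) p
    isTerm-suc n p rep .coefficient k j i = trans (coefficient rep k j i) (*-congˡ (begin
      (deriv H ⊗ W n ⊗ power′ H q +ˢ deriv (W n) ⊗ H ^ q) n
        ≈⟨ SS.solve 5 (λ h w p d e → h SS.:* w SS.:* p SS.:+ d SS.:* e SS.:= d SS.:* e SS.:+ w SS.:* (p SS.:* h)) 𝕊.refl
             (deriv H) (W n) (power′ H q) (deriv (W n)) (H ^ q) n ⟩
      (deriv (W n) ⊗ H ^ q +ˢ W n ⊗ (power′ H q ⊗ deriv H)) n
        ≈⟨ +-congˡ (𝕊.*-congˡ {W n} (deriv-^ H q) n) ⟨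
      (deriv (W n) ⊗ H ^ q +ˢ W n ⊗ deriv (H ^ q)) n
        ≈⟨ deriv-⊗ (W n) (H ^ q) n ⟨
      suc n · (W n ⊗ H ^ q) (suc n)
        ≈⟨ n·1*a≈n·a (suc n) _ ⟨
      (suc n · 1#) * (W n ⊗ H ^ q) (suc n)
        ≈⟨ *-congˡ (scaled n) ⟩
      (suc n · 1#) * (fact n * (A ⊗ H ^ q) (suc n))
        -- The factor n + 1 from differentiation completes n! to (n + 1)!.
        ≈⟨ *-assoc _ _ _ ⟨
      fact (suc n) * (A ⊗ H ^ q) (suc n)
        ≈⟨ scaled (suc n) ⟨
      (W (suc n) ⊗ H ^ q) (suc n)  ∎))
      where
      q = degree r k j i
      scaled : ∀ m → (W m ⊗ H ^ q) (suc n) ≈ fact m * (A ⊗ H ^ q) (suc n)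
      scaled m = trans (𝕊.*-assoc (constˢ (fact m)) A (H ^ q) (suc n)) (const-⊗ (fact m) (A ⊗ H ^ q) (suc n))

    W-deriv : ∀ n → deriv (W n) ≈ˢ constˢ (fact n) ⊗ deriv A
    W-deriv n m = trans (deriv-⊗ (constˢ (fact n)) A m) (trans (+-congʳ (trans (𝕊.*-congʳ {A} (deriv-const (fact n)) m) (𝕊.zeroˡ A m))) (+-identityˡ _))

    firstOperator secondOperator : Operator
    firstOperator = (M r′ ⊖ (deriv (series g) /ˢ g) ⟨∂y⟩) ∘ series (reciprocal (deriv-delta f)) ⟨∂y⟩
    secondOperator = (M r′ ∘ (deriv H ∘ˢ series ((f ⁻¹) ⁻¹)) ⟨∂y⟩)
      ⊕ ((deriv A ∘ˢ series ((f ⁻¹) ⁻¹)) /ˢ (reciprocal (g ∘ᴵ (f ⁻¹)) ∘ᴵ ((f ⁻¹) ⁻¹))) ⟨∂y⟩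

    -- The inner operator supplies H′ to both summands. `M` then yields H′ W q Hᑫ⁻¹, and the
    -- subtracted term yields -(g′/g)(H) H′ W Hᑫ, which is W′ Hᑫ by `A-deriv`.
    isTerm-firstOperator : ∀ n p → IsTerm n p → IsTerm (suc n) (firstOperator p)
    isTerm-firstOperator n p rep = isTerm-suc n (firstOperator p)
      (represents-cong r′ (λ q → +-congˡ (logarithmic q n))
        (represents-+ r′ (represents-M r′ H refl rep′)
          (represents-neg r′ (represents-⟨∂y⟩ r′ H refl ψ rep′))))
      where
      φ = series (reciprocal (deriv-delta f))
      ψ = deriv (series g) /ˢ g
      rep′ : Represents r (λ q → deriv H ⊗ W n ⊗ H ^ q) n ((φ ⟨∂y⟩) p)
      rep′ = represents-cong r′
        (λ q → 𝕊.*-congʳ {H ^ q} (𝕊.*-congʳ {W n} (inverse-deriv f)) n) (represents-⟨∂y⟩ r′ H refl φ rep)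
      logarithmic : ∀ q → -ˢ ((ψ ⊙ H) ⊗ (deriv H ⊗ W n) ⊗ H ^ q) ≈ˢ deriv (W n) ⊗ H ^ q
      logarithmic q = 𝕊.trans
        (𝕊.-‿cong (SS.solve 5 (λ a b c d x → a SS.:* (b SS.:* (c SS.:* d)) SS.:* x SS.:= c SS.:* (a SS.:* (b SS.:* d)) SS.:* x) 𝕊.refl
          (ψ ⊙ H) (deriv H) (constˢ (fact n)) A (H ^ q)))
        (𝕊.trans (-ˢ‿distribˡ-* (constˢ (fact n) ⊗ U) (H ^ q))
        (𝕊.*-congʳ (𝕊.trans (-ˢ‿distribʳ-* (constˢ (fact n)) U)
          (𝕊.trans (𝕊.*-congˡ (𝕊.sym (A-deriv f g))) (𝕊.sym (W-deriv n))))))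
        where U = (ψ ⊙ H) ⊗ (deriv H ⊗ A)

    -- Only `M` is preceded by a factor H′. The quotient acts on `p` directly, since composition
    -- with H makes it A′/A, which multiplies W to W′.
    isTerm-secondOperator : ∀ n p → IsTerm n p → IsTerm (suc n) (secondOperator p)
    isTerm-secondOperator n p rep = isTerm-suc n (secondOperator p)
      (represents-+ r′ (represents-M r′ H refl
          (represents-cong r′ (λ q → 𝕊.*-congʳ {H ^ q} (𝕊.*-congʳ {W n} (cancel-⊙ f (deriv H))) n)
            (represents-⟨∂y⟩ r′ H refl (deriv H ∘ˢ series ((f ⁻¹) ⁻¹)) rep)))
        (represents-cong r′ (λ q → 𝕊.*-congʳ {H ^ q} logarithmic n) (represents-⟨∂y⟩ r′ H refl χ rep)))
      where
      χ = (deriv A ∘ˢ series ((f ⁻¹) ⁻¹)) /ˢ (reciprocal (g ∘ᴵ (f ⁻¹)) ∘ᴵ ((f ⁻¹) ⁻¹))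
      logarithmic : (χ ⊙ H) ⊗ W n ≈ˢ deriv (W n)
      logarithmic = 𝕊.trans (SS.solve 3 (λ x c a → x SS.:* (c SS.:* a) SS.:= c SS.:* (x SS.:* a)) 𝕊.refl (χ ⊙ H) (constˢ (fact n)) A)
        (𝕊.trans (𝕊.*-congˡ (quotient-cancel-⊙ f g (deriv A))) (𝕊.sym (W-deriv n)))

    iterates : series g 0 ≈ 1# → ∀ {T : Operator} → (∀ n p → IsTerm n p → IsTerm (suc n) (T p)) →
               ∀ n → IsTerm n ((T ^ᵒ n) 1ᵖ)
    iterates g0 step zero    = isTerm-1ᵖ g0
    iterates g0 step (suc n) = step n _ (iterates g0 step n)

    -- The nested series are variables, because comparing them as closed terms over ℂ
    -- would make Agda unfold the reciprocals and inverses down to Cauchy sequences.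
    explicitRepresentations : series g 0 ≈ 1# → ∀ s → IsLegendreGouldHopperSheffer f g r s → ∀ n {H H̄ : DeltaSeries} {G A B : InvertibleSeries} →
      H ≡ f ⁻¹ → H̄ ≡ H ⁻¹ → G ≡ g ∘ᴵ H → A ≡ reciprocal G → B ≡ A ∘ᴵ H̄ →
      let M = multiplyBy y ⊕ 2 • (Dx⁻¹ ∘ ∂y) ⊕ r • (multiplyBy z ∘ (∂y ^ᵒ r′)) in
        (s n ≈ᵖ (((M ⊖ (deriv (series g) /ˢ g) ⟨∂y⟩)
                   ∘ series (reciprocal (deriv-delta f)) ⟨∂y⟩) ^ᵒ n) 1ᵖ)
        ×
        (s n ≈ᵖ (((M ∘ (deriv (series H) ∘ˢ series H̄) ⟨∂y⟩)
                   ⊕ ((deriv (series A) ∘ˢ series H̄) /ˢ B) ⟨∂y⟩) ^ᵒ n) 1ᵖ)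
    explicitRepresentations g0 s gen n ≡.refl ≡.refl ≡.refl ≡.refl ≡.refl =
        represents-unique r′ (isTerm-generated s gen n) (iterates g0 isTerm-firstOperator n)
      , represents-unique r′ (isTerm-generated s gen n) (iterates g0 isTerm-secondOperator n)

-- The representations over the complex numbers.

open import Defs

representations : (f : DeltaSeries) (g : InvertibleSeries) → series g 0 ≈ᶜ 1ᶜ →
    (r′ : ℕ) (s : ℕ → ℂ[x,y,z]) → IsLegendreGouldHopperSheffer f g (suc r′) s → (n : ℕ) →
    {H H̄ : DeltaSeries} {G A B : InvertibleSeries} →
    H ≡ f ⁻¹ → H̄ ≡ H ⁻¹ → G ≡ g ∘ᴵ H → A ≡ reciprocal G → B ≡ A ∘ᴵ H̄ →
    let M = multiplyBy y ⊕ 2 • (Dx⁻¹ ∘ ∂y) ⊕ suc r′ • (multiplyBy z ∘ (∂y ^ᵒ r′)) in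
      (s n ≈ᵖ (((M ⊖ (deriv (series g) /ˢ g) ⟨∂y⟩)
                 ∘ series (reciprocal (deriv-delta f)) ⟨∂y⟩) ^ᵒ n) 1ᵖ)
      ×
      (s n ≈ᵖ (((M ∘ (deriv (series H) ∘ˢ series H̄) ⟨∂y⟩)
                 ⊕ ((deriv (series A) ∘ˢ series H̄) /ˢ B) ⟨∂y⟩) ^ᵒ n) 1ᵖ)
representations f g g0 r′ = Representation.explicitRepresentations ℂ-field f g r′ g0

corollary2p1 : (f : DeltaSeries) (g : InvertibleSeries) → series g 0 ≈ᶜ 1ᶜ →
    (r : ℕ) → 1 ≤ r →
    (s : ℕ → ℂ[x,y,z]) → IsLegendreGouldHopperSheffer f g r s →
    (n : ℕ) →
    let H = f ⁻¹
        A = reciprocal (g ∘ᴵ H)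
        M = multiplyBy y ⊕ 2 • (Dx⁻¹ ∘ ∂y) ⊕ r • (multiplyBy z ∘ (∂y ^ᵒ (r ∸ 1)))
    in
      (s n ≈ᵖ (((M ⊖ (deriv (series g) /ˢ g) ⟨∂y⟩)
                 ∘ series (reciprocal (deriv-delta f)) ⟨∂y⟩) ^ᵒ n) 1ᵖ)
      ×
      (s n ≈ᵖ (((M ∘ (deriv (series H) ∘ˢ series (H ⁻¹)) ⟨∂y⟩)
                 ⊕ ((deriv (series A) ∘ˢ series (H ⁻¹)) /ˢ (A ∘ᴵ (H ⁻¹))) ⟨∂y⟩) ^ᵒ n) 1ᵖ)
-- Matching on `1 ≤ r` exposes r = `suc r′`, so that `r ∸ 1` computes; the reflexivity proofs put
-- the actual nested series in place of the variables.
corollary2p1 f g g0 (suc r′) (s≤s z≤n) s gen n = representations f g g0 r′ s gen n ≡.refl ≡.refl ≡.refl ≡.refl ≡.refl
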